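{- Let $n$ be a positive integer, let $r>0$, and let $G$ be an $n$-vertex graph with at most $r$ cherries. Then every globally $\left(\frac{n}{1512\, r^{3/4}}\right)$-bounded coloring $c$ of $E(K_n)$ is $G$-rainbow.
   Context: A cherry in a graph is a path on three vertices (counted as a subgraph). An edge-coloring $c$ of $E(K_n)$ is globally $k$-bounded if no color appears on more than $k$ edges of $K_n$. A coloring $c$ of $E(K_n)$ is $G$-rainbow if there is a copy of $G$ in $K_n$ no two of whose edges have the same color under $c$.
   Formalization: r is taken to be an integer with r ≥ 1 (real r ≥ 1 follows by rounding down); for small 0 < r < 1 the claim is false: two disjoint edges on 4 vertices have no cherries, and a monochromatic coloring of K_4 meets the bound when r is tiny. -}

module Defs where

open import Data.Nat using (ℕ; _*_; _^_; _≤_)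
import Data.Nat as ℕ
open import Data.Fin using (Fin; _<_; _<?_)
open import Data.Fin.Properties using () renaming (_≟_ to _≟F_)
open import Data.Bool using (Bool; true; false; T; _∧_)
open import Data.List using (List; length; filter; cartesianProduct; allFin)
open import Data.Product using (_×_; _,_; proj₁; proj₂; ∃)
open import Relation.Nullary.Decidable using (⌊_⌋)
open import Relation.Binary.PropositionalEquality using (_≡_)
open import Function.Definitions using (Injective)

record Graph (n : ℕ) : Set where
  field
    adj    : Fin n → Fin n → Bool
    sym    : ∀ i j → adj i j ≡ adj j i
    irrefl : ∀ i → adj i i ≡ false
open Graph public

edgesK : (n : ℕ) → List (Fin n × Fin n)
edgesK n = filter (λ p → proj₁ p <? proj₂ p) (cartesianProduct (allFin n) (allFin n))

-- An edge-coloring of K_n with colours in ℕ: a symmetric function on pairs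
-- (its value on the diagonal is irrelevant).
Coloring : ℕ → Set
Coloring n = Fin n → Fin n → ℕ

IsSymmetric : {n : ℕ} → Coloring n → Set
IsSymmetric c = ∀ i j → c i j ≡ c j i

colorCount : {n : ℕ} → Coloring n → ℕ → ℕ
colorCount {n} c a = length (filter (λ p → c (proj₁ p) (proj₂ p) ℕ.≟ a) (edgesK n))

-- c is globally (n / (1512 r^{3/4}))-bounded: for every colour a,
-- colorCount c a ≤ n / (1512 r^{3/4}), written without reals as
-- (1512 · colorCount c a)^4 · r^3 ≤ n^4.
GloballyBounded : (n r : ℕ) → Coloring n → Set
GloballyBounded n r c = ∀ a → ((1512 * colorCount c a) ^ 4) * (r ^ 3) ≤ n ^ 4

-- Number of cherries (paths on three vertices u – v – w, as subgraphs):
-- triples (u , v , w) with u < w, u ~ v and v ~ w.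
cherries : {n : ℕ} → Graph n → ℕ
cherries {n} G =
  length (filter (λ t → T? (⌊ proj₁ t <? proj₂ (proj₂ t) ⌋
                            ∧ adj G (proj₁ t) (proj₁ (proj₂ t))
                            ∧ adj G (proj₁ (proj₂ t)) (proj₂ (proj₂ t))))
    (cartesianProduct (allFin n) (cartesianProduct (allFin n) (allFin n))))
  where open import Data.Bool using (T?)

Rainbow : {n : ℕ} → Graph n → Coloring n → Set
Rainbow {n} G c =
  ∃ λ (φ : Fin n → Fin n) → Injective _≡_ _≡_ φ ×
    (∀ u v x y → T (adj G u v) → T (adj G x y) → u < v → x < y →
       c (φ u) (φ v) ≡ c (φ x) (φ y) → (u ≡ x × v ≡ y))

{-# OPTIONS --safe #-}
module Submission where

-- Let ρ = r^{1/4}. At most about ρ vertices v have deg v (deg v − 1) > 2 ρ³; they are embedded greedily so that their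
-- images span a rainbow clique and no two images have many equally coloured pairs of edges to a common vertex.
-- The remaining vertices are embedded by a uniformly random bijection. Its bad events, "a ↦ a′, b ↦ b′, … makes
-- two edges of the copy agree in colour", satisfy the lopsided local lemma, because swapping two values of the
-- bijection moves any event to any other one on the same vertices without creating an event compatible with the
-- first. The local lemma is proved by counting bijections: if the events in conflict with A have total probability
-- at most 1/4, then conditioning on the avoidance of other events at most doubles the probability of A. Each of
-- the finitely many types of bad events contributes O(k ρ³ / n) to these sums, where k bounds the colour classes.

open import Defs hiding (sym)
open import Data.Bool using (if_then_else_; T; T?; _∧_)
open import Data.Bool.Properties using (T-∧)
open import Data.Empty using (⊥-elim)
open import Data.Fin using (Fin)
import Data.Fin as Fin
open import Data.Fin.Permutation.Components using (transpose; transpose-inverse)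
import Data.Fin.Properties as Fin
open import Data.List using (List; []; _∷_; _++_; map; filter; length; cartesianProduct; cartesianProductWith; allFin)
open import Data.List.Membership.Propositional using (_∈_; lose; find; _∉_)
open import Data.List.Membership.Propositional.Properties using (∈-∃++; ∈-++⁻; ∈-++⁺ˡ; ∈-++⁺ʳ; ∈-filter⁺; ∈-filter⁻; ∈-allFin; ∈-cartesianProductWith⁺; ∈-map⁺; ∈-map⁻; ∈-cartesianProduct⁺)
open import Data.List.Properties using (length-++; filter-notAll; length-map; length-tabulate)
open import Data.List.Relation.Unary.All as All using (All; []; _∷_)
open import Data.List.Relation.Unary.All.Properties using (all-filter; filter⁺; ¬All⇒Any¬)
open import Data.List.Relation.Unary.AllPairs as AllPairs using (AllPairs; []; _∷_)
open import Data.List.Relation.Unary.Any as Any using (here; there; Any)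
open import Data.List.Relation.Unary.Unique.Propositional using (Unique)
open import Data.List.Relation.Unary.Unique.Propositional.Properties using (allFin⁺; cartesianProductWith⁺; map⁺)
import Data.List.Relation.Unary.Unique.Propositional.Properties as Unique
open import Data.Nat using (ℕ; zero; suc; _+_; _*_; _∸_; _^_; _≤_; _<_; z≤n; s≤s; NonZero; >-nonZero; _≤ᵇ_)
open import Data.Nat.Base using (≢-nonZero⁻¹)
open import Data.Nat.DivMod using (_/_; m/n*n≤m; m*n/n≡m; /-monoˡ-≤)
open import Data.Nat.Induction using (<-wellFounded)
open import Data.Nat.Properties
open import Data.Nat.Tactic.RingSolver using (solve-∀)
open import Data.Product using (_×_; _,_; proj₁; proj₂; ∃)
open import Data.Sum using (_⊎_; inj₁; inj₂)
open import Data.Vec as Vec using (Vec; lookup; tabulate)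
open import Data.Vec.Properties using (lookup-map; lookup∘tabulate; ∷-injective; map-cong; map-id; map-∘)
open import Function using (_∘_; Equivalence)
open import Induction.WellFounded using (Acc; acc)
open import Relation.Binary.Definitions using (DecidableEquality; tri<; tri≈; tri>)
open import Relation.Binary.PropositionalEquality
open import Relation.Nullary using (¬_; Dec; yes; no; does; contradiction; ¬?)
open import Relation.Nullary.Decidable using (_×-dec_; decidable-stable; _⊎-dec_; _→-dec_; ⌊_⌋; fromWitness)
open import Relation.Unary using (Pred; Decidable)

-- Finite sums and indicators

-- Pinning is forced by equally coloured cherries: at a free vertex of degree d they contribute
-- about d² k / n to the sums of the local lemma. The cherry count alone allows d of order ρ², hence
-- ρ⁴ k / n, too large by a factor ρ; only d² = O(ρ³) is harmless. Pinning brings its own danger, a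
-- free vertex joined to two pinned ones whose images have many equally coloured pairs of edges.
-- Bounding these codegrees by 4 k ρ brings the at most ρ² pairs back to 4 k ρ³ / n. On the
-- constant: the local lemma asks for 1/4, and an event has at most four assignments through which
-- it can conflict with others, so 16 times the load through one vertex and one image must stay
-- below 1. With ρ rounded up to a multiple of 1/32, ρ³ k is at most n / 1370, and the loads add up
-- to 1498 / 27400. Sixteen times this is below 7/8, which leaves room for replacing n by the at
-- least 0.99 n values that a swap can really use.

𝟙 : ∀ {p} {P : Set p} → Dec P → ℕ
𝟙 d = if does d then 1 else 0

𝟙-yes : ∀ {p} {P : Set p} (d : Dec P) → P → 1 ≤ 𝟙 d
𝟙-yes (yes _) _ = ≤-refl
𝟙-yes (no ¬p) p = contradiction p ¬p

𝟙-≤ : ∀ {p} {P : Set p} {m} (d : Dec P) → (P → 1 ≤ m) → 𝟙 d ≤ m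
𝟙-≤ (yes p) h = h p
𝟙-≤ (no _) h = z≤n

𝟙≤1 : ∀ {p} {P : Set p} (d : Dec P) → 𝟙 d ≤ 1
𝟙≤1 d = 𝟙-≤ d λ _ → ≤-refl

𝟙-mono : ∀ {p q} {P : Set p} {Q : Set q} (d : Dec P) (e : Dec Q) → (P → Q) → 𝟙 d ≤ 𝟙 e
𝟙-mono d e h = 𝟙-≤ d (𝟙-yes e ∘ h)

𝟙≡0⇒¬ : ∀ {p} {P : Set p} (d : Dec P) → 𝟙 d ≡ 0 → ¬ P
𝟙≡0⇒¬ (no ¬p) _ = ¬p

𝟙-*-≤ : ∀ {p} {P : Set p} {m m′} (d : Dec P) → (P → m ≤ m′) → 𝟙 d * m ≤ 𝟙 d * m′
𝟙-*-≤ (yes p) h = *-monoʳ-≤ 1 (h p)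
𝟙-*-≤ (no _) h = z≤n

𝟙*≤ : ∀ {p} {P : Set p} (d : Dec P) m → 𝟙 d * m ≤ m
𝟙*≤ d m = ≤-trans (*-monoˡ-≤ m (𝟙≤1 d)) (≤-reflexive (*-identityˡ m))

*-𝟙-≤ : ∀ {p} {P : Set p} {m m′} (d : Dec P) → (P → m ≤ m′) → m * 𝟙 d ≤ m′
*-𝟙-≤ {m = m} (yes p) h = ≤-trans (≤-reflexive (*-identityʳ m)) (h p)
*-𝟙-≤ {m = m} (no _) h = ≤-trans (≤-reflexive (*-zeroʳ m)) z≤n

𝟙-≤₃ : ∀ {p q o} {P : Set p} {Q : Set q} {O : Set o} {m} (d : Dec P) (e : Dec Q) (f : Dec O) →
       (P → Q → O → 1 ≤ m) → 𝟙 d * (𝟙 e * 𝟙 f) ≤ m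
𝟙-≤₃ (no _) _ _ h = z≤n
𝟙-≤₃ (yes _) (no _) _ h = z≤n
𝟙-≤₃ (yes _) (yes _) (no _) h = z≤n
𝟙-≤₃ (yes p) (yes q) (yes o) h = h p q o

infixr 6 _⊗_

_⊗_ : ∀ {m m′} → 1 ≤ m → 1 ≤ m′ → 1 ≤ m * m′
_⊗_ = *-mono-≤

∑ : ∀ {a} {A : Set a} → List A → (A → ℕ) → ℕ
∑ [] f = 0
∑ (x ∷ xs) f = f x + ∑ xs f

infix 5 ∑
syntax ∑ xs (λ x → e) = ∑[ x ∈ xs ] e

module _ {a} {A : Set a} where

  ∑-mono-∈ : ∀ (xs : List A) {f g} → (∀ x → x ∈ xs → f x ≤ g x) → ∑ xs f ≤ ∑ xs g
  ∑-mono-∈ [] h = z≤n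
  ∑-mono-∈ (x ∷ xs) h = +-mono-≤ (h x (here refl)) (∑-mono-∈ xs λ y m → h y (there m))

  ∑-mono : ∀ (xs : List A) {f g} → (∀ x → f x ≤ g x) → ∑ xs f ≤ ∑ xs g
  ∑-mono xs h = ∑-mono-∈ xs λ x _ → h x

  ∑-cong : ∀ (xs : List A) {f g} → (∀ x → f x ≡ g x) → ∑ xs f ≡ ∑ xs g
  ∑-cong [] h = refl
  ∑-cong (x ∷ xs) h = cong₂ _+_ (h x) (∑-cong xs h)

  ∑-0 : ∀ (xs : List A) → ∑ xs (λ _ → 0) ≡ 0
  ∑-0 [] = refl
  ∑-0 (x ∷ xs) = ∑-0 xs

  ∑-+ : ∀ (xs : List A) f g → (∑[ x ∈ xs ] (f x + g x)) ≡ ∑ xs f + ∑ xs g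
  ∑-+ [] f g = refl
  ∑-+ (x ∷ xs) f g rewrite ∑-+ xs f g = interchange (f x) (g x) (∑ xs f) (∑ xs g)
    where
    interchange : ∀ p q u v → p + q + (u + v) ≡ p + u + (q + v)
    interchange = solve-∀

  ∑-*ʳ : ∀ (xs : List A) f m → (∑[ x ∈ xs ] (f x * m)) ≡ ∑ xs f * m
  ∑-*ʳ [] f m = refl
  ∑-*ʳ (x ∷ xs) f m rewrite ∑-*ʳ xs f m = sym (*-distribʳ-+ m (f x) (∑ xs f))

  ∑-*ˡ : ∀ (xs : List A) m f → (∑[ x ∈ xs ] (m * f x)) ≡ m * ∑ xs f
  ∑-*ˡ xs m f = trans (∑-cong xs λ x → *-comm m (f x)) (trans (∑-*ʳ xs f m) (*-comm _ m))

  ∑-const : ∀ (xs : List A) m → (∑[ _ ∈ xs ] m) ≡ length xs * m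
  ∑-const [] m = refl
  ∑-const (x ∷ xs) m = cong (m +_) (∑-const xs m)

  ∑-≤ : ∀ (xs : List A) {f g B C} → (∀ x → f x ≤ g x * B) → ∑ xs g ≤ C → ∑ xs f ≤ C * B
  ∑-≤ xs {f} {g} {B} h k = ≤-trans (∑-mono xs h) (≤-trans (≤-reflexive (∑-*ʳ xs g B)) (*-monoˡ-≤ B k))

  ∑-≤-const : ∀ (xs : List A) {f B C} → length xs ≤ C → (∀ x → f x ≤ B) → ∑ xs f ≤ C * B
  ∑-≤-const xs {f} {B} k h =
    ≤-trans (∑-mono xs h) (≤-trans (≤-reflexive (∑-const xs B)) (*-monoˡ-≤ B k))

  ∑-pull : ∀ (xs : List A) {f g} m {B} → (∀ x → f x ≤ m * g x) → ∑ xs g ≤ B → ∑ xs f ≤ m * B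
  ∑-pull xs {f} {g} m h k =
    ≤-trans (∑-mono xs h) (≤-trans (≤-reflexive (∑-*ˡ xs m g)) (*-monoʳ-≤ m k))

  ∑-++ : ∀ (xs ys : List A) f → ∑ (xs ++ ys) f ≡ ∑ xs f + ∑ ys f
  ∑-++ [] ys f = refl
  ∑-++ (x ∷ xs) ys f rewrite ∑-++ xs ys f = sym (+-assoc (f x) _ _)

  ∑-filter : ∀ {p} {P : Pred A p} (P? : Decidable P) xs f →
             ∑ (filter P? xs) f ≡ (∑[ x ∈ xs ] (𝟙 (P? x) * f x))
  ∑-filter P? [] f = refl
  ∑-filter P? (x ∷ xs) f with P? x
  ... | yes _ = cong₂ _+_ (sym (+-identityʳ (f x))) (∑-filter P? xs f)
  ... | no _ = ∑-filter P? xs f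

  length-filter-∑ : ∀ {p} {P : Pred A p} (P? : Decidable P) xs →
                    length (filter P? xs) ≡ (∑[ x ∈ xs ] 𝟙 (P? x))
  length-filter-∑ P? [] = refl
  length-filter-∑ P? (x ∷ xs) with P? x
  ... | yes _ = cong suc (length-filter-∑ P? xs)
  ... | no _ = length-filter-∑ P? xs

  ∑-filter-≤ : ∀ {p} {P : Pred A p} (P? : Decidable P) xs f → ∑ (filter P? xs) f ≤ ∑ xs f
  ∑-filter-≤ P? xs f =
    ≤-trans (≤-reflexive (∑-filter P? xs f)) (∑-mono xs λ x → 𝟙*≤ (P? x) (f x))

  ∈-∑ : ∀ {xs : List A} {x} f → x ∈ xs → f x ≤ ∑ xs f
  ∈-∑ f (here refl) = m≤m+n _ _
  ∈-∑ f (there m) = ≤-trans (∈-∑ f m) (m≤n+m _ _)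

  -- Each entry of `xs` is cut out of `ys` at one occurrence; uniqueness ensures that no later entry
  -- needs the removed place.
  ∑-⊆ : ∀ {xs : List A} ys f → Unique xs → (∀ x → x ∈ xs → x ∈ ys) → ∑ xs f ≤ ∑ ys f
  ∑-⊆ {[]} ys f u h = z≤n
  ∑-⊆ {x ∷ xs} ys f (x∉ ∷ u) h with ∈-∃++ (h x (here refl))
  ... | as , bs , refl = begin
    f x + ∑ xs f                ≤⟨ +-monoʳ-≤ (f x) (∑-⊆ (as ++ bs) f u sub) ⟩
    f x + ∑ (as ++ bs) f        ≡⟨ cong (f x +_) (∑-++ as bs f) ⟩
    f x + (∑ as f + ∑ bs f)     ≡⟨ swap₁₂ (f x) (∑ as f) (∑ bs f) ⟩
    ∑ as f + (f x + ∑ bs f)     ≡⟨ ∑-++ as (x ∷ bs) f ⟨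
    ∑ (as ++ x ∷ bs) f          ∎
    where
    open ≤-Reasoning
    swap₁₂ : ∀ p q o → p + (q + o) ≡ q + (p + o)
    swap₁₂ = solve-∀
    sub : ∀ y → y ∈ xs → y ∈ as ++ bs
    sub y m with ∈-++⁻ as (h y (there m))
    ... | inj₁ m′ = ∈-++⁺ˡ m′
    ... | inj₂ (here refl) = contradiction refl (All.lookup x∉ m)
    ... | inj₂ (there m′) = ∈-++⁺ʳ as m′

  ∑-δ-≤ : (_≟_ : DecidableEquality A) → ∀ {xs} → Unique xs → ∀ j (f : A → ℕ) →
          (∑[ i ∈ xs ] (𝟙 (i ≟ j) * f i)) ≤ f j
  ∑-δ-≤ _≟_ [] j f = z≤n
  ∑-δ-≤ _≟_ {i ∷ xs} (i∉ ∷ u) j f with i ≟ j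
  ... | no _ = ∑-δ-≤ _≟_ u j f
  ... | yes refl = ≤-reflexive (trans (cong₂ _+_ (+-identityʳ (f i)) (vanish i∉)) (+-identityʳ (f i)))
    where
    vanish : ∀ {ys} → All (i ≢_) ys → (∑[ l ∈ ys ] (𝟙 (l ≟ i) * f l)) ≡ 0
    vanish [] = refl
    vanish {y ∷ ys} (i≢y ∷ h) with y ≟ i
    ... | yes refl = contradiction refl i≢y
    ... | no _ = vanish h

  ∑-∃-pos : ∀ (xs : List A) f → 1 ≤ ∑ xs f → ∃ λ x → x ∈ xs × 1 ≤ f x
  ∑-∃-pos (x ∷ xs) f h with f x in eq
  ... | suc m = x , here refl , subst (1 ≤_) (sym eq) (s≤s z≤n)
  ... | zero with ∑-∃-pos xs f h
  ... | y , m , p = y , there m , p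

  ∑-∃-zero : ∀ (xs : List A) f → ∑ xs f < length xs → ∃ λ x → x ∈ xs × f x ≡ 0
  ∑-∃-zero (x ∷ xs) f h with f x in eq
  ... | zero = x , here refl , eq
  ... | suc m with ∑-∃-zero xs f (≤-trans (s≤s (m≤n+m (∑ xs f) m)) (≤-pred h))
  ... | y , m , p = y , there m , p

  *-∑-≤ : ∀ (xs : List A) {f g} m → (∀ x → x ∈ xs → m * f x ≤ g x) → m * ∑ xs f ≤ ∑ xs g
  *-∑-≤ xs {f} m h = ≤-trans (≤-reflexive (sym (∑-*ˡ xs m f))) (∑-mono-∈ xs h)

∑-swap : ∀ {a b} {A : Set a} {B : Set b} (xs : List A) (ys : List B) (f : A → B → ℕ) →
         (∑[ x ∈ xs ] ∑[ y ∈ ys ] f x y) ≡ (∑[ y ∈ ys ] ∑[ x ∈ xs ] f x y)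
∑-swap [] ys f = sym (∑-0 ys)
∑-swap (x ∷ xs) ys f rewrite ∑-swap xs ys f = sym (∑-+ ys (f x) _)

∑-map : ∀ {a b} {A : Set a} {B : Set b} (h : A → B) xs f → ∑ (map h xs) f ≡ ∑ xs (f ∘ h)
∑-map h [] f = refl
∑-map h (x ∷ xs) f = cong (f (h x) +_) (∑-map h xs f)

∑-× : ∀ {a b} {A : Set a} {B : Set b} (xs : List A) (ys : List B) f →
      ∑ (cartesianProduct xs ys) f ≡ (∑[ x ∈ xs ] ∑[ y ∈ ys ] f (x , y))
∑-× [] ys f = refl
∑-× (x ∷ xs) ys f = trans (∑-++ (map (x ,_) ys) _ f) (cong₂ _+_ (∑-map (x ,_) ys f) (∑-× xs ys f))

∑-×-≤ : ∀ {a b} {A : Set a} {B : Set b} (xs : List A) (ys : List B) {f g h C D} →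
        (∀ x y → f (x , y) ≤ g x * h y) → ∑ xs g ≤ C → ∑ ys h ≤ D →
        ∑ (cartesianProduct xs ys) f ≤ C * D
∑-×-≤ xs ys {f} {g} {h} {C} {D} p q o = ≤-trans (≤-reflexive (∑-× xs ys f))
  (∑-≤ xs (λ x → ≤-trans (∑-mono ys (p x)) (≤-trans (≤-reflexive (∑-*ˡ ys (g x) h)) (*-monoʳ-≤ (g x) o))) q)

-- Exchanging the two summation variables turns the `H y` half into the `H x` half. This is how
-- interchangeable places of a bad event are reduced to one of them at the cost of a factor 2.
∑-symmetric-≤ : ∀ {a} {A : Set a} (xs : List A) (F : A → A → ℕ) (H : A → ℕ) →
  (∀ x y → F x y ≤ F y x) →
  (∑[ x ∈ xs ] ∑[ y ∈ xs ] (F x y * (H x + H y))) ≤ 2 * (∑[ x ∈ xs ] (H x * (∑[ y ∈ xs ] F x y)))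
∑-symmetric-≤ xs F H F-sym = begin
  (∑[ x ∈ xs ] ∑[ y ∈ xs ] (F x y * (H x + H y)))
    ≤⟨ ∑-mono xs (λ x → ∑-mono xs λ y → ≤-reflexive (*-distribˡ-+ (F x y) (H x) (H y))) ⟩
  (∑[ x ∈ xs ] ∑[ y ∈ xs ] (F x y * H x + F x y * H y))
    ≡⟨ ∑-cong xs (λ x → ∑-+ xs _ _) ⟩
  (∑[ x ∈ xs ] ((∑[ y ∈ xs ] (F x y * H x)) + (∑[ y ∈ xs ] (F x y * H y))))
    ≡⟨ ∑-+ xs _ _ ⟩
  S + (∑[ x ∈ xs ] ∑[ y ∈ xs ] (F x y * H y))
    ≡⟨ cong (S +_) (∑-swap xs xs _) ⟩
  S + (∑[ y ∈ xs ] ∑[ x ∈ xs ] (F x y * H y))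
    ≤⟨ +-monoʳ-≤ S (∑-mono xs λ y → ∑-mono xs λ x → *-monoˡ-≤ (H y) (F-sym x y)) ⟩
  S + S
    ≡⟨ cong (S +_) (+-identityʳ S) ⟨
  2 * S
    ≡⟨ cong (2 *_) (∑-cong xs λ x → trans (∑-*ʳ xs (F x) (H x)) (*-comm _ (H x))) ⟩
  2 * (∑[ x ∈ xs ] (H x * (∑[ y ∈ xs ] F x y))) ∎
  where
  open ≤-Reasoning
  S = ∑[ x ∈ xs ] ∑[ y ∈ xs ] (F x y * H x)

-- The lopsided local lemma, by counting

module LocalLemma {Ω E : Set} (points : List Ω)
  (Hit : E → Ω → Set) (hit? : ∀ e ω → Dec (Hit e ω)) where

  Avoid : List E → Ω → Set
  Avoid S ω = All (λ B → ¬ Hit B ω) S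

  avoid? : ∀ S ω → Dec (Avoid S ω)
  avoid? S ω = All.all? (λ B → ¬? (hit? B ω)) S

  #avoid : List E → ℕ
  #avoid S = ∑[ ω ∈ points ] 𝟙 (avoid? S ω)

  #hit : E → List E → ℕ
  #hit A S = ∑[ ω ∈ points ] (𝟙 (hit? A ω) * 𝟙 (avoid? S ω))

  -- The quotient `w A / W` stands for an upper bound on the probability of `A`; a common
  -- denominator keeps every inequality in ℕ. The hypothesis `lopsided` is this bound conditioned on
  -- avoiding events that do not conflict with `A`.
  module _ (Conf : E → E → Set) (conf? : ∀ A B → Dec (Conf A B))
    (w : E → ℕ) (W : ℕ) (W>0 : 1 ≤ W) (Valid : E → Set)
    (lopsided : ∀ {A S} → Valid A → All (λ B → ¬ Conf A B) S → W * #hit A S ≤ w A * #avoid S)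
    where

    -- The neighbourhood bound concerns every valid `A`, in `S` or not, because `conditional-≤` is
    -- applied to events outside the list that is conditioned on.
    Good : List E → Set
    Good S = All Valid S × (∀ A → Valid A → 4 * (∑[ B ∈ S ] (𝟙 (conf? A B) * w B)) ≤ W)

    private
      nonZeroW : NonZero W
      nonZeroW = >-nonZero W>0

    -- A union bound: a point that avoids `S₂` but not `S` hits some member of `S₁`.
    split-≤ : ∀ A S →
      let S₁ = filter (conf? A) S ; S₂ = filter (λ B → ¬? (conf? A B)) S in
      #avoid S₂ ≤ #avoid S + (∑[ B ∈ S₁ ] #hit B S₂)
    split-≤ A S = begin
      #avoid S₂
        ≤⟨ ∑-mono points pointwise ⟩
      (∑[ ω ∈ points ] (𝟙 (avoid? S ω) + (∑[ B ∈ S₁ ] (𝟙 (hit? B ω) * 𝟙 (avoid? S₂ ω)))))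
        ≡⟨ ∑-+ points _ _ ⟩
      #avoid S + (∑[ ω ∈ points ] ∑[ B ∈ S₁ ] (𝟙 (hit? B ω) * 𝟙 (avoid? S₂ ω)))
        ≡⟨ cong (#avoid S +_) (∑-swap points S₁ _) ⟩
      #avoid S + (∑[ B ∈ S₁ ] #hit B S₂) ∎
      where
      open ≤-Reasoning
      S₁ = filter (conf? A) S
      S₂ = filter (λ B → ¬? (conf? A B)) S
      pointwise : ∀ ω → 𝟙 (avoid? S₂ ω)
        ≤ 𝟙 (avoid? S ω) + (∑[ B ∈ S₁ ] (𝟙 (hit? B ω) * 𝟙 (avoid? S₂ ω)))
      pointwise ω = 𝟙-≤ (avoid? S₂ ω) λ av → bound av (All.all? (λ B → ¬? (hit? B ω)) S₁)
        where
        bound : Avoid S₂ ω → Dec (Avoid S₁ ω) →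
          1 ≤ 𝟙 (avoid? S ω) + (∑[ B ∈ S₁ ] (𝟙 (hit? B ω) * 𝟙 (avoid? S₂ ω)))
        bound av (yes av₁) = ≤-trans (𝟙-yes (avoid? S ω) (All.tabulate join)) (m≤m+n _ _)
          where
          join : ∀ {B} → B ∈ S → ¬ Hit B ω
          join {B} m with conf? A B
          ... | yes p = All.lookup av₁ (∈-filter⁺ (conf? A) m p)
          ... | no ¬p = All.lookup av (∈-filter⁺ (λ B → ¬? (conf? A B)) m ¬p)
        bound av (no ¬av₁) with find (¬All⇒Any¬ (λ B → ¬? (hit? B ω)) S₁ ¬av₁)
        ... | B , m , ¬¬h = ≤-trans
          (𝟙-yes (hit? B ω) (decidable-stable (hit? B ω) ¬¬h) ⊗ 𝟙-yes (avoid? S₂ ω) av)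
          (≤-trans (∈-∑ (λ B → 𝟙 (hit? B ω) * 𝟙 (avoid? S₂ ω)) m) (m≤n+m _ _))

    -- Forgetting the conflicting events `S₁` only enlarges the left side, and `lopsided` handles
    -- the rest `S₂`. It remains to return from `#avoid S₂` to `#avoid S`, which costs a factor 2:
    -- by induction the events of `S₁` spoil at most half of the points avoiding `S₂`.
    conditional-≤ : ∀ {S} → Acc _<_ (length S) → Good S → ∀ {A} → Valid A →
      W * #hit A S ≤ 2 * w A * #avoid S
    conditional-≤ {S} (acc rec) (valid , nbr) {A} vA = begin
      W * #hit A S              ≤⟨ *-monoʳ-≤ W (∑-mono points λ ω →
                                     *-monoʳ-≤ (𝟙 (hit? A ω)) (𝟙-mono (avoid? S ω) (avoid? S₂ ω)
                                       (filter⁺ (λ B → ¬? (conf? A B))))) ⟩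
      W * #hit A S₂             ≤⟨ lopsided vA (all-filter (λ B → ¬? (conf? A B)) S) ⟩
      w A * #avoid S₂           ≤⟨ *-monoʳ-≤ (w A) halving ⟩
      w A * (2 * #avoid S)      ≡⟨ shuffle (w A) (#avoid S) ⟩
      2 * w A * #avoid S        ∎
      where
      open ≤-Reasoning
      S₁ = filter (conf? A) S
      S₂ = filter (λ B → ¬? (conf? A B)) S
      shuffle : ∀ p q → p * (2 * q) ≡ 2 * p * q
      shuffle = solve-∀
      good₂ : Good S₂
      good₂ = filter⁺ (λ B → ¬? (conf? A B)) valid ,
        λ A′ vA′ → ≤-trans (*-monoʳ-≤ 4 (∑-filter-≤ (λ B → ¬? (conf? A B)) S _)) (nbr A′ vA′)
      -- The induction is called only for members of `S₁`, and the existence of one makes `S₂`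
      -- strictly shorter than `S`.
      smaller : ∀ {B} → B ∈ S₁ → length S₂ < length S
      smaller m with ∈-filter⁻ (conf? A) {xs = S} m
      ... | B∈S , conf = filter-notAll (λ B → ¬? (conf? A B)) S (lose B∈S λ ¬c → ¬c conf)
      weight : W * (∑[ B ∈ S₁ ] #hit B S₂) ≤ 2 * (∑[ B ∈ S ] (𝟙 (conf? A B) * w B)) * #avoid S₂
      weight = begin
        W * (∑[ B ∈ S₁ ] #hit B S₂)
          ≤⟨ *-∑-≤ S₁ W (λ B m →
               conditional-≤ (rec (smaller m)) good₂ (All.lookup (filter⁺ (conf? A) valid) m)) ⟩
        (∑[ B ∈ S₁ ] (2 * w B * #avoid S₂))
          ≡⟨ ∑-*ʳ S₁ _ (#avoid S₂) ⟩
        (∑[ B ∈ S₁ ] (2 * w B)) * #avoid S₂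
          ≡⟨ cong (_* #avoid S₂) (∑-*ˡ S₁ 2 w) ⟩
        2 * ∑ S₁ w * #avoid S₂
          ≡⟨ cong (λ z → 2 * z * #avoid S₂) (∑-filter (conf? A) S w) ⟩
        2 * (∑[ B ∈ S ] (𝟙 (conf? A B) * w B)) * #avoid S₂ ∎
      σ = ∑[ B ∈ S ] (𝟙 (conf? A B) * w B)
      Σh = ∑[ B ∈ S₁ ] #hit B S₂
      halving : #avoid S₂ ≤ 2 * #avoid S
      -- One copy of `W * #avoid S₂` is added on both sides, since the union bound returns at most
      -- that much on the right: `4 * σ ≤ W`.
      halving = *-cancelˡ-≤ W {{nonZeroW}} (+-cancelʳ-≤ (W * #avoid S₂) _ _ (begin
        W * #avoid S₂ + W * #avoid S₂           ≡⟨ double W (#avoid S₂) ⟩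
        2 * (W * #avoid S₂)                     ≤⟨ *-monoʳ-≤ 2 (*-monoʳ-≤ W (split-≤ A S)) ⟩
        2 * (W * (#avoid S + Σh))               ≡⟨ expand W (#avoid S) Σh ⟩
        W * (2 * #avoid S) + 2 * (W * Σh)       ≤⟨ +-monoʳ-≤ (W * (2 * #avoid S)) (*-monoʳ-≤ 2 weight) ⟩
        W * (2 * #avoid S) + 2 * (2 * σ * #avoid S₂)
                                                ≡⟨ cong (W * (2 * #avoid S) +_) (regroup σ (#avoid S₂)) ⟩
        W * (2 * #avoid S) + 4 * σ * #avoid S₂  ≤⟨ +-monoʳ-≤ (W * (2 * #avoid S)) (*-monoˡ-≤ (#avoid S₂) (nbr A vA)) ⟩
        W * (2 * #avoid S) + W * #avoid S₂      ∎))
        where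
        double : ∀ p q → p * q + p * q ≡ 2 * (p * q)
        double = solve-∀
        expand : ∀ p q o → 2 * (p * (q + o)) ≡ p * (2 * q) + 2 * (p * o)
        expand = solve-∀
        regroup : ∀ p q → 2 * (2 * p * q) ≡ 4 * p * q
        regroup = solve-∀

    avoid-cons : ∀ A S → #avoid S ≤ #avoid (A ∷ S) + #hit A S
    avoid-cons A S = ≤-trans (∑-mono points pointwise) (≤-reflexive (∑-+ points _ _))
      where
      pointwise : ∀ ω → 𝟙 (avoid? S ω) ≤ 𝟙 (avoid? (A ∷ S) ω) + 𝟙 (hit? A ω) * 𝟙 (avoid? S ω)
      pointwise ω = 𝟙-≤ (avoid? S ω) λ av → case av (hit? A ω) refl
        where
        case : Avoid S ω → (d : Dec (Hit A ω)) → d ≡ hit? A ω →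
          1 ≤ 𝟙 (avoid? (A ∷ S) ω) + 𝟙 (hit? A ω) * 𝟙 (avoid? S ω)
        case av (yes h) _ = ≤-trans (𝟙-yes (hit? A ω) h ⊗ 𝟙-yes (avoid? S ω) av) (m≤n+m _ _)
        case av (no ¬h) _ = ≤-trans (𝟙-yes (avoid? (A ∷ S) ω) (¬h ∷ av)) (m≤m+n _ _)

    -- Events are added one at a time. Each removes at most the fraction `2 * w A / W`, less than 1,
    -- of the points that survived so far.
    avoidable : (∀ A → Valid A → 2 * w A < W) → 1 ≤ length points →
      ∀ S → Good S → 1 ≤ #avoid S
    avoidable small nonempty [] _ = ≤-trans nonempty
      (≤-reflexive (sym (trans (∑-const points 1) (*-identityʳ _))))
    avoidable small nonempty (A ∷ S) good@(vA ∷ valid , nbr) = *-cancelˡ-< W 0 (#avoid (A ∷ S)) (begin-strict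
      W * 0                  ≡⟨ *-zeroʳ W ⟩
      0                      <⟨ m<n⇒0<n∸m (*-monoˡ-< (#avoid S) {{>-nonZero ih}} (small A vA)) ⟩
      W * #avoid S ∸ 2 * w A * #avoid S
                             ≤⟨ ∸-monoʳ-≤ (W * #avoid S) (conditional-≤ (<-wellFounded _) goodS vA) ⟩
      W * #avoid S ∸ W * #hit A S
                             ≡⟨ *-distribˡ-∸ W (#avoid S) (#hit A S) ⟨
      W * (#avoid S ∸ #hit A S)
                             ≤⟨ *-monoʳ-≤ W (m≤n+o⇒m∸n≤o (#avoid S) (#hit A S) (≤-trans (avoid-cons A S) (≤-reflexive (+-comm (#avoid (A ∷ S)) _)))) ⟩
      W * #avoid (A ∷ S)     ∎)
      where
      open ≤-Reasoning
      goodS : Good S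
      goodS = valid , λ A′ vA′ → ≤-trans (*-monoʳ-≤ 4 (m≤n+m _ (𝟙 (conf? A′ A) * w A))) (nbr A′ vA′)
      ih : 1 ≤ #avoid S
      ih = avoidable small nonempty S goodS

-- Random bijections extending a given partial injection

infix 4 _∈?_

_∈?_ : ∀ {n} (v : Fin n) xs → Dec (v ∈ xs)
v ∈? xs = Any.any? (v Fin.≟_) xs

module _ {n : ℕ} where

  transpose-left : ∀ (i j : Fin n) → transpose i j i ≡ j
  transpose-left i j with i Fin.≟ i
  ... | yes _ = refl
  ... | no i≢i = contradiction refl i≢i

  transpose-other : ∀ (i j : Fin n) {l} → l ≢ i → l ≢ j → transpose i j l ≡ l
  transpose-other i j {l} l≢i l≢j with l Fin.≟ i
  ... | yes l≡i = contradiction l≡i l≢i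
  ... | no _ with l Fin.≟ j
  ... | yes l≡j = contradiction l≡j l≢j
  ... | no _ = refl

  transpose-right : ∀ (i j : Fin n) → transpose i j j ≡ i
  transpose-right i j with j Fin.≟ i
  ... | yes j≡i = j≡i
  ... | no _ with j Fin.≟ j
  ... | yes _ = refl
  ... | no j≢j = contradiction refl j≢j

  transpose-injective : ∀ (i j : Fin n) {l m} → transpose i j l ≡ transpose i j m → l ≡ m
  transpose-injective i j eq =
    trans (sym (transpose-inverse j i)) (trans (cong (transpose j i) eq) (transpose-inverse j i))

  allVecs : ∀ m → List (Vec (Fin n) m)
  allVecs zero = Vec.[] ∷ []
  allVecs (suc m) = cartesianProductWith Vec._∷_ (allFin n) (allVecs m)

  allVecs-unique : ∀ m → Unique (allVecs m)
  allVecs-unique zero = [] ∷ []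
  allVecs-unique (suc m) = cartesianProductWith⁺ Vec._∷_ ∷-injective (allFin⁺ n) (allVecs-unique m)

  ∈-allVecs : ∀ {m} (σ : Vec (Fin n) m) → σ ∈ allVecs m
  ∈-allVecs Vec.[] = here refl
  ∈-allVecs (i Vec.∷ σ) = ∈-cartesianProductWith⁺ Vec._∷_ (∈-allFin i) (∈-allVecs σ)

  -- Composition with a transposition is injective on the finite set of all vectors, so no value of
  -- `f` is counted twice.
  ∑-map-transpose-≤ : ∀ i j m (f : Vec (Fin n) m → ℕ) →
    (∑[ σ ∈ allVecs m ] f (Vec.map (transpose i j) σ)) ≤ ∑ (allVecs m) f
  ∑-map-transpose-≤ i j m f = ≤-trans
    (≤-reflexive (sym (∑-map (Vec.map (transpose i j)) (allVecs m) f)))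
    (∑-⊆ (allVecs m) f (map⁺ injective (allVecs-unique m)) λ σ _ → ∈-allVecs σ)
    where
    undo : ∀ (σ : Vec (Fin n) m) → Vec.map (transpose j i) (Vec.map (transpose i j) σ) ≡ σ
    undo σ = trans (sym (map-∘ (transpose j i) (transpose i j) σ))
      (trans (map-cong (λ _ → transpose-inverse j i) σ) (map-id σ))
    injective : ∀ {σ τ : Vec (Fin n) m} → Vec.map (transpose i j) σ ≡ Vec.map (transpose i j) τ → σ ≡ τ
    injective {σ} {τ} eq = trans (sym (undo σ)) (trans (cong (Vec.map (transpose j i)) eq) (undo τ))

  length-avoiding : ∀ (xs : List (Fin n)) →
    n ≤ length (filter (λ v → ¬? (v ∈? xs)) (allFin n)) + length xs
  length-avoiding xs = begin
    n                                                         ≡⟨ length-tabulate (λ i → i) ⟨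
    length V                                                  ≡⟨ *-identityʳ _ ⟨
    length V * 1                                              ≡⟨ ∑-const V 1 ⟨
    (∑[ _ ∈ V ] 1)                                            ≤⟨ ∑-mono V split ⟩
    (∑[ v ∈ V ] (𝟙 (¬? (v ∈? xs)) + (∑[ x ∈ xs ] (𝟙 (v Fin.≟ x) * 1))))
                                                              ≡⟨ ∑-+ V _ _ ⟩
    (∑[ v ∈ V ] 𝟙 (¬? (v ∈? xs))) + (∑[ v ∈ V ] ∑[ x ∈ xs ] (𝟙 (v Fin.≟ x) * 1))
      ≤⟨ +-mono-≤ (≤-reflexive (sym (length-filter-∑ (λ v → ¬? (v ∈? xs)) V)))
           (≤-reflexive (∑-swap V xs _)) ⟩
    length (filter (λ v → ¬? (v ∈? xs)) V) + (∑[ x ∈ xs ] ∑[ v ∈ V ] (𝟙 (v Fin.≟ x) * 1))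
      ≤⟨ +-monoʳ-≤ (length (filter (λ v → ¬? (v ∈? xs)) V))
           (≤-trans (∑-mono xs λ x → ∑-δ-≤ Fin._≟_ (allFin⁺ n) x (λ _ → 1))
             (≤-reflexive (trans (∑-const xs 1) (*-identityʳ _)))) ⟩
    length (filter (λ v → ¬? (v ∈? xs)) V) + length xs ∎
    where
    open ≤-Reasoning
    V = allFin n
    split : ∀ v → 1 ≤ 𝟙 (¬? (v ∈? xs)) + (∑[ x ∈ xs ] (𝟙 (v Fin.≟ x) * 1))
    split v with v ∈? xs
    ... | no _ = s≤s z≤n
    ... | yes m = ≤-trans (𝟙-yes (v Fin.≟ v) refl ⊗ ≤-refl) (∈-∑ (λ x → 𝟙 (v Fin.≟ x) * 1) m)

module Bijections {n : ℕ} (pinned : List (Fin n × Fin n)) where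

  -- The event that σ v = v′ for all listed pairs (v , v′).
  Event : Set
  Event = List (Fin n × Fin n)

  infix 4 _Extends_

  _Extends_ : Vec (Fin n) n → Event → Set
  σ Extends A = All (λ p → lookup σ (proj₁ p) ≡ proj₂ p) A

  extends? : ∀ A σ → Dec (σ Extends A)
  extends? A σ = All.all? (λ p → lookup σ (proj₁ p) Fin.≟ proj₂ p) A

  Inj : Vec (Fin n) n → Set
  Inj σ = ∀ i j → lookup σ i ≡ lookup σ j → i ≡ j

  Admissible : Vec (Fin n) n → Set
  Admissible σ = Inj σ × σ Extends pinned

  admissible? : ∀ σ → Dec (Admissible σ)
  admissible? σ =
    Fin.all? (λ i → Fin.all? λ j → (lookup σ i Fin.≟ lookup σ j) →-dec (i Fin.≟ j)) ×-dec extends? pinned σ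

  points : List (Vec (Fin n) n)
  points = filter admissible? (allVecs n)

  open LocalLemma points (λ A σ → σ Extends A) extends? public

  -- Two assignments that no bijection satisfies together. Equal assignments do not clash: events
  -- that agree where they meet are allowed in the conditioning, which is the lopsidedness.
  Clash : Fin n × Fin n → Fin n × Fin n → Set
  Clash (u , u′) (a , a′) = (u ≡ a × u′ ≢ a′) ⊎ (u ≢ a × u′ ≡ a′)

  clash? : ∀ p q → Dec (Clash p q)
  clash? (u , u′) (a , a′) =
    ((u Fin.≟ a) ×-dec ¬? (u′ Fin.≟ a′)) ⊎-dec (¬? (u Fin.≟ a) ×-dec (u′ Fin.≟ a′))

  Conf : Event → Event → Set
  Conf A B = Any (λ p → Any (Clash p) B) A

  conf? : ∀ A B → Dec (Conf A B)
  conf? A B = Any.any? (λ p → Any.any? (clash? p) B) A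

  -- These conditions are what a swap needs: it must move one assignment of the event without
  -- disturbing the others or the pinned ones. The bound 4 fixes the common denominator `M ^ 4`.
  Valid : Event → Set
  Valid A = All (λ p → proj₂ p ∉ map proj₂ pinned) A
          × AllPairs (λ p q → proj₁ p ≢ proj₁ q × proj₂ p ≢ proj₂ q) A
          × length A ≤ 4

  valid? : ∀ A → Dec (Valid A)
  valid? A = All.all? (λ p → ¬? (proj₂ p ∈? map proj₂ pinned)) A
      ×-dec AllPairs.allPairs? (λ p q → ¬? (proj₁ p Fin.≟ proj₁ q) ×-dec ¬? (proj₂ p Fin.≟ proj₂ q)) A
      ×-dec length A ≤? 4

  private
    swap : Fin n → Fin n → Vec (Fin n) n → Vec (Fin n) n
    swap i j = Vec.map (transpose i j)

    lookup-swap : ∀ i j σ u → lookup (swap i j σ) u ≡ transpose i j (lookup σ u)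
    lookup-swap i j σ u = lookup-map u (transpose i j) σ

  inj-swap : ∀ i j σ → Inj σ → Inj (swap i j σ)
  inj-swap i j σ inj u v eq = inj u v (transpose-injective i j
    (trans (sym (lookup-swap i j σ u)) (trans eq (lookup-swap i j σ v))))

  extends-swap : ∀ i j σ {A} → σ Extends A → All (λ p → proj₂ p ≢ i × proj₂ p ≢ j) A → swap i j σ Extends A
  extends-swap i j σ [] [] = []
  extends-swap i j σ (refl ∷ ext) ((≢i , ≢j) ∷ h) =
    trans (lookup-swap i j σ _) (transpose-other i j ≢i ≢j) ∷ extends-swap i j σ ext h

  -- Moving the value of u from u′ to u″ cannot create an event compatible with (u , u′).
  extends-swap⁻ : ∀ σ {u u′ u″ B} → Inj σ → lookup σ u ≡ u′ → ¬ Any (Clash (u , u′)) B →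
    swap u′ u″ σ Extends B → σ Extends B
  extends-swap⁻ σ inj eq ¬clash [] = []
  extends-swap⁻ σ {u} {u′} {u″} {(a , a′) ∷ B} inj eq ¬clash (e ∷ ext) =
    head ∷ extends-swap⁻ σ inj eq (¬clash ∘ there) ext
    where
    e′ : transpose u′ u″ (lookup σ a) ≡ a′
    e′ = trans (sym (lookup-swap u′ u″ σ a)) e
    head : lookup σ a ≡ a′
    -- Without a clash, `(a , a′)` either equals `(u , u′)` or differs from it in both coordinates.
    -- In the second case `σ a` is not `u′` by injectivity, and not `u″`, since the swap would turn
    -- it into `u′ ≢ a′`; so the swap left it alone.
    head with u Fin.≟ a | u′ Fin.≟ a′
    ... | yes u≡a | no u′≢a′ = contradiction (here (inj₁ (u≡a , u′≢a′))) ¬clash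
    ... | no u≢a | yes u′≡a′ = contradiction (here (inj₂ (u≢a , u′≡a′))) ¬clash
    ... | yes refl | yes u′≡a′ = trans eq u′≡a′
    ... | no u≢a | no u′≢a′ with lookup σ a Fin.≟ u′
    ... | yes σa≡u′ = contradiction (inj u a (trans eq (sym σa≡u′))) u≢a
    ... | no σa≢u′ with lookup σ a Fin.≟ u″
    ... | yes σa≡u″ = contradiction
            (trans (sym (transpose-right u′ u″)) (trans (cong (transpose u′ u″) (sym σa≡u″)) e′)) u′≢a′
    ... | no σa≢u″ = trans (sym (transpose-other u′ u″ σa≢u′ σa≢u″)) e′

  module _ {M : ℕ} (room : M + (4 + length pinned) ≤ n) where

    -- Double counting. For each free value `v`, exchanging the values `u′` and `v` sends the points
    -- with `u ↦ u′` injectively to points with `u ↦ v`, keeping `A`, the pinned pairs and the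
    -- avoidance of `S`. Targets for different `v` are disjoint, and there are at least `M` choices
    -- of `v`.
    #hit-cons-≤ : ∀ {u u′ A S} → Valid ((u , u′) ∷ A) → All (λ B → ¬ Any (Clash (u , u′)) B) S →
      M * #hit ((u , u′) ∷ A) S ≤ #hit A S
    #hit-cons-≤ {u} {u′} {A} {S} ((u′∉ ∷ _) , (distinct ∷ _) , len) ¬clash = begin
      M * #hit ((u , u′) ∷ A) S                     ≤⟨ *-monoˡ-≤ _ M≤ ⟩
      length free * #hit ((u , u′) ∷ A) S           ≡⟨ ∑-const free _ ⟨
      (∑[ v ∈ free ] #hit ((u , u′) ∷ A) S)         ≤⟨ ∑-mono-∈ free moved ⟩
      (∑[ v ∈ free ] ∑[ σ ∈ allVecs n ] (𝟙 (v Fin.≟ lookup σ u) * g σ))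
                                                    ≡⟨ ∑-swap free (allVecs n) _ ⟩
      (∑[ σ ∈ allVecs n ] ∑[ v ∈ free ] (𝟙 (v Fin.≟ lookup σ u) * g σ))
        ≤⟨ ∑-mono (allVecs n) (λ σ → ≤-trans
             (≤-trans (≤-reflexive (∑-filter free? (allFin n) _))
                      (∑-mono (allFin n) λ v → 𝟙*≤ (free? v) _))
             (∑-δ-≤ Fin._≟_ (allFin⁺ n) (lookup σ u) (λ _ → g σ))) ⟩
      ∑ (allVecs n) g                               ≡⟨ ∑-filter admissible? (allVecs n) _ ⟨
      #hit A S                                      ∎
      where
      open ≤-Reasoning
      taken = map proj₂ (A ++ pinned)
      free? = λ v → ¬? (v ∈? taken)
      free = filter free? (allFin n)
      g : Vec (Fin n) n → ℕ
      g σ = 𝟙 (admissible? σ) * (𝟙 (extends? A σ) * 𝟙 (avoid? S σ))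
      M≤ : M ≤ length free
      -- Only the tail `A`, of length at most 3, and `pinned` block values: the choice `v = u′` is
      -- permitted and gives the identity.
      M≤ = +-cancelʳ-≤ (3 + length pinned) M (length free) (begin
        M + (3 + length pinned)            ≤⟨ +-monoʳ-≤ M (n≤1+n _) ⟩
        M + (4 + length pinned)            ≤⟨ room ⟩
        n                                  ≤⟨ length-avoiding taken ⟩
        length free + length taken         ≡⟨ cong (length free +_)
                                               (trans (length-map proj₂ (A ++ pinned)) (length-++ A)) ⟩
        length free + (length A + length pinned)
                                           ≤⟨ +-monoʳ-≤ (length free) (+-monoˡ-≤ (length pinned) (≤-pred len)) ⟩
        length free + (3 + length pinned)  ∎)
      moved : ∀ v → v ∈ free →
        #hit ((u , u′) ∷ A) S ≤ (∑[ σ ∈ allVecs n ] (𝟙 (v Fin.≟ lookup σ u) * g σ))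
      moved v v∈ = ≤-trans (≤-reflexive (∑-filter admissible? (allVecs n) _))
        (≤-trans (∑-mono (allVecs n) pointwise) (∑-map-transpose-≤ u′ v n _))
        where
        v∉ : v ∉ taken
        v∉ = proj₂ (∈-filter⁻ free? {xs = allFin n} v∈)
        ≢v : ∀ {p} → p ∈ A ++ pinned → proj₂ p ≢ v
        ≢v m refl = v∉ (∈-map⁺ proj₂ m)
        pointwise : ∀ σ →
          𝟙 (admissible? σ) * (𝟙 (extends? ((u , u′) ∷ A) σ) * 𝟙 (avoid? S σ))
          ≤ 𝟙 (v Fin.≟ lookup (swap u′ v σ) u) * g (swap u′ v σ)
        pointwise σ = 𝟙-≤₃ (admissible? σ) (extends? ((u , u′) ∷ A) σ) (avoid? S σ)
          λ { (inj , ext₀) (eq ∷ ext) av →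
              𝟙-yes (v Fin.≟ _) (sym (trans (lookup-swap u′ v σ u)
                (trans (cong (transpose u′ v) eq) (transpose-left u′ v))))
              ⊗ 𝟙-yes (admissible? (swap u′ v σ)) (inj-swap u′ v σ inj ,
                  extends-swap u′ v σ ext₀ (All.tabulate λ m →
                    (λ { refl → u′∉ (∈-map⁺ proj₂ m) }) , ≢v (∈-++⁺ʳ A m)))
              ⊗ 𝟙-yes (extends? A (swap u′ v σ)) (extends-swap u′ v σ ext (All.tabulate λ m →
                    (λ e → proj₂ (All.lookup distinct m) (sym e)) , ≢v (∈-++⁺ˡ m)))
              ⊗ 𝟙-yes (avoid? S (swap u′ v σ)) (All.tabulate λ m →
                    All.lookup av m ∘ extends-swap⁻ σ inj eq (All.lookup ¬clash m)) }

    #hit-≤ : ∀ {A S} → Valid A → All (λ B → ¬ Conf A B) S → M ^ length A * #hit A S ≤ #avoid S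
    #hit-≤ {[]} {S} _ _ = ≤-reflexive (trans (+-identityʳ _) (∑-cong points λ σ → +-identityʳ _))
    #hit-≤ {(u , u′) ∷ A} {S} v@((_ ∷ images) , (_ ∷ distinct) , len) ¬conf = begin
      M * M ^ length A * #hit ((u , u′) ∷ A) S     ≡⟨ shuffle M (M ^ length A) _ ⟩
      M ^ length A * (M * #hit ((u , u′) ∷ A) S)   ≤⟨ *-monoʳ-≤ (M ^ length A)
                                                       (#hit-cons-≤ v (All.map (_∘ here) ¬conf)) ⟩
      M ^ length A * #hit A S                      ≤⟨ #hit-≤ (images , distinct , <⇒≤ len) (All.map (_∘ there) ¬conf) ⟩
      #avoid S                                     ∎
      where
      open ≤-Reasoning
      shuffle : ∀ p q o → p * q * o ≡ q * (p * o)
      shuffle = solve-∀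

  -- Starts from the identity and corrects one pair at a time by a swap of values. Earlier pairs
  -- survive, as their images are neither the old value of `x`, by injectivity, nor `x′`, by
  -- uniqueness.
  extension : (A : Event) → Unique (map proj₁ A) → Unique (map proj₂ A) → ∃ λ σ → Inj σ × σ Extends A
  extension [] _ _ = tabulate (λ i → i) ,
    (λ i j eq → trans (sym (lookup∘tabulate (λ i → i) i)) (trans eq (lookup∘tabulate (λ i → i) j))) , []
  extension ((x , x′) ∷ A) (x∉ ∷ uniq) (x′∉ ∷ uniq′) with extension A uniq uniq′
  ... | σ , inj , ext = swap (lookup σ x) x′ σ , inj-swap _ _ σ inj ,
        trans (lookup-swap (lookup σ x) x′ σ x) (transpose-left (lookup σ x) x′) ∷
        extends-swap _ _ σ ext (All.tabulate λ {p} m →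
          (λ e → All.lookup x∉ (∈-map⁺ proj₁ m) (inj _ _ (trans (sym e) (sym (All.lookup ext m))))) ,
          λ e → All.lookup x′∉ (∈-map⁺ proj₂ m) (sym e))

  points-nonempty : Unique (map proj₁ pinned) → Unique (map proj₂ pinned) → 1 ≤ length points
  points-nonempty uniq uniq′ with extension pinned uniq uniq′
  ... | σ , adm = nonempty (∈-filter⁺ admissible? (∈-allVecs σ) adm)
    where
    nonempty : ∀ {xs : List (Vec (Fin n) n)} {x} → x ∈ xs → 1 ≤ length xs
    nonempty (here _) = s≤s z≤n
    nonempty (there _) = s≤s z≤n

hitDom hitIm : ∀ {n} → Fin n → Fin n × Fin n → ℕ
hitDom u p = 𝟙 (proj₁ p Fin.≟ u)
hitIm u′ p = 𝟙 (proj₂ p Fin.≟ u′)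

-- n⁴ times the probability of the event B, up to lower-order terms
weight : ∀ {n} → List (Fin n × Fin n) → ℕ
weight {n} B = n ^ (4 ∸ length B)

-- With `h` equal to `hitDom u` or `hitIm u′`, this is the total weight of the events through the
-- vertex `u` or the image `u′`. A clash shares one of the two, so such loads control every
-- neighbourhood.
load : ∀ {n} → (Fin n × Fin n → ℕ) → List (List (Fin n × Fin n)) → ℕ
load h 𝓑 = ∑[ B ∈ 𝓑 ] (weight B * ∑ B h)

module _ {n : ℕ} (pinned : List (Fin n × Fin n)) where
  open Bijections pinned

  -- The factor 16 is 4 from the local lemma times 4 assignments of an event, each conflicting with
  -- weight at most `D + I`. The condition `2 * n ^ 3 < M ^ 4` makes single events improbable, as a
  -- nonempty event weighs at most `n ^ 3`.
  bijection-avoiding : ∀ {M} → M + (4 + length pinned) ≤ n →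
    Unique (map proj₁ pinned) → Unique (map proj₂ pinned) →
    ∀ 𝓑 → All (λ B → Valid B × 1 ≤ length B) 𝓑 → ∀ D I →
    (∀ u → load (hitDom u) 𝓑 ≤ D) → (∀ u′ → load (hitIm u′) 𝓑 ≤ I) →
    16 * (D + I) ≤ M ^ 4 → 2 * n ^ 3 < M ^ 4 →
    ∃ λ σ → Admissible σ × Avoid 𝓑 σ
  bijection-avoiding {M} room uniq uniq′ 𝓑 valid D I loadD loadI small tiny =
    extract (∑-∃-pos points (λ σ → 𝟙 (avoid? 𝓑 σ)) positive)
    where
    open ≤-Reasoning
    Proper : Event → Set
    Proper B = Valid B × 1 ≤ length B

    M≤n : M ≤ n
    M≤n = ≤-trans (m≤m+n M _) room

    n≥1 : 1 ≤ n
    n≥1 = ≤-trans (s≤s z≤n) (≤-trans (m≤n+m (4 + length pinned) M) room)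

    -- Swaps account for the exponent `length A`; the remaining powers of `M` are filled up to the
    -- common denominator and compared with powers of `n`.
    lopsided : ∀ {A S} → Proper A → All (λ B → ¬ Conf A B) S → M ^ 4 * #hit A S ≤ weight A * #avoid S
    lopsided {A} {S} (vA@(_ , _ , len) , _) ¬conf = begin
      M ^ 4 * #hit A S
        ≡⟨ cong (λ e → M ^ e * #hit A S) (m∸n+n≡m len) ⟨
      M ^ (4 ∸ length A + length A) * #hit A S
        ≡⟨ cong (_* #hit A S) (^-distribˡ-+-* M (4 ∸ length A) (length A)) ⟩
      M ^ (4 ∸ length A) * M ^ length A * #hit A S
        ≡⟨ *-assoc (M ^ (4 ∸ length A)) _ _ ⟩
      M ^ (4 ∸ length A) * (M ^ length A * #hit A S)
        ≤⟨ *-mono-≤ (^-monoˡ-≤ (4 ∸ length A) M≤n) (#hit-≤ room vA ¬conf) ⟩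
      weight A * #avoid S ∎

    conf-≤ : ∀ A B → 𝟙 (conf? A B) ≤ (∑[ p ∈ A ] (∑ B (hitDom (proj₁ p)) + ∑ B (hitIm (proj₂ p))))
    conf-≤ A B = 𝟙-≤ (conf? A B) bound
      where
      bound : Conf A B → 1 ≤ (∑[ p ∈ A ] (∑ B (hitDom (proj₁ p)) + ∑ B (hitIm (proj₂ p))))
      bound conf with find conf
      ... | (u , u′) , m , clash with find clash
      ... | (a , a′) , m′ , c = ≤-trans (share c)
              (∈-∑ (λ p → ∑ B (hitDom (proj₁ p)) + ∑ B (hitIm (proj₂ p))) m)
        where
        share : Clash (u , u′) (a , a′) → 1 ≤ ∑ B (hitDom u) + ∑ B (hitIm u′)
        share (inj₁ (u≡a , _)) =
          ≤-trans (≤-trans (𝟙-yes (a Fin.≟ u) (sym u≡a)) (∈-∑ (hitDom u) m′)) (m≤m+n _ _)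
        share (inj₂ (_ , u′≡a′)) =
          ≤-trans (≤-trans (𝟙-yes (a′ Fin.≟ u′) (sym u′≡a′)) (∈-∑ (hitIm u′) m′)) (m≤n+m _ _)

    neighbourhood : ∀ A → Proper A → 4 * (∑[ B ∈ 𝓑 ] (𝟙 (conf? A B) * weight B)) ≤ M ^ 4
    neighbourhood A ((_ , _ , len) , _) = begin
      4 * (∑[ B ∈ 𝓑 ] (𝟙 (conf? A B) * weight B))
        ≤⟨ *-monoʳ-≤ 4 (∑-mono 𝓑 λ B → ≤-trans (*-monoˡ-≤ (weight B) (conf-≤ A B))
             (≤-reflexive (sym (∑-*ʳ A _ (weight B))))) ⟩
      4 * (∑[ B ∈ 𝓑 ] ∑[ p ∈ A ] ((∑ B (hitDom (proj₁ p)) + ∑ B (hitIm (proj₂ p))) * weight B))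
        ≡⟨ cong (4 *_) (∑-swap 𝓑 A _) ⟩
      4 * (∑[ p ∈ A ] ∑[ B ∈ 𝓑 ] ((∑ B (hitDom (proj₁ p)) + ∑ B (hitIm (proj₂ p))) * weight B))
        ≤⟨ *-monoʳ-≤ 4 (∑-≤-const A len each) ⟩
      4 * (4 * (D + I))
        ≡⟨ *-assoc 4 4 (D + I) ⟨
      16 * (D + I)
        ≤⟨ small ⟩
      M ^ 4 ∎
      where
      expand : ∀ x y z → (x + y) * z ≡ z * x + z * y
      expand = solve-∀
      each : ∀ p → (∑[ B ∈ 𝓑 ] ((∑ B (hitDom (proj₁ p)) + ∑ B (hitIm (proj₂ p))) * weight B)) ≤ D + I
      each (u , u′) = begin
        (∑[ B ∈ 𝓑 ] ((∑ B (hitDom u) + ∑ B (hitIm u′)) * weight B))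
          ≡⟨ ∑-cong 𝓑 (λ B → expand (∑ B (hitDom u)) (∑ B (hitIm u′)) (weight B)) ⟩
        (∑[ B ∈ 𝓑 ] (weight B * ∑ B (hitDom u) + weight B * ∑ B (hitIm u′)))
          ≡⟨ ∑-+ 𝓑 _ _ ⟩
        load (hitDom u) 𝓑 + load (hitIm u′) 𝓑
          ≤⟨ +-mono-≤ (loadD u) (loadI u′) ⟩
        D + I ∎

    light : ∀ A → Proper A → 2 * weight A < M ^ 4
    light A (_ , 1≤len) =
      ≤-<-trans (*-monoʳ-≤ 2 (^-monoʳ-≤ n {{>-nonZero n≥1}} (∸-monoʳ-≤ 4 1≤len))) tiny

    positive : 1 ≤ #avoid 𝓑
    positive = avoidable Conf conf? weight (M ^ 4) (≤-trans (s≤s z≤n) tiny) Proper lopsided light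
      (points-nonempty uniq uniq′) 𝓑 (valid , neighbourhood)

    extract : (∃ λ σ → σ ∈ points × 1 ≤ 𝟙 (avoid? 𝓑 σ)) → ∃ λ σ → Admissible σ × Avoid 𝓑 σ
    extract (σ , m , pos) with avoid? 𝓑 σ
    ... | yes av = σ , proj₂ (∈-filter⁻ admissible? {xs = allVecs n} m) , av

-- Degrees, cherries and colour classes

length-allFin : ∀ n → length (allFin n) ≤ n
length-allFin n = ≤-reflexive (length-tabulate (λ i → i))

module Degrees {n : ℕ} (G : Graph n) where

  V : List (Fin n)
  V = allFin n

  Edge : Fin n → Fin n → Set
  Edge a b = T (adj G a b)

  edge? : ∀ a b → Dec (Edge a b)
  edge? a b = T? (adj G a b)

  edge-sym : ∀ {a b} → Edge a b → Edge b a
  edge-sym {a} {b} = subst T (Graph.sym G a b)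

  edge-irrefl : ∀ {a b} → Edge a b → a ≢ b
  edge-irrefl {a} e refl = subst T (irrefl G a) e

  g : Fin n → Fin n → ℕ
  g a b = 𝟙 (edge? a b)

  g-sym : ∀ a b → g a b ≤ g b a
  g-sym a b = 𝟙-mono (edge? a b) (edge? b a) edge-sym

  deg : Fin n → ℕ
  deg a = ∑[ b ∈ V ] g a b

  #arcs : ℕ
  #arcs = ∑[ a ∈ V ] deg a

  in-degree-≤ : ∀ b → (∑[ a ∈ V ] g a b) ≤ deg b
  in-degree-≤ b = ∑-mono V λ a → g-sym a b

  -- This is `deg a` times `deg a` minus 1, the number of ordered cherries with centre `a`, written
  -- without truncated subtraction.
  centred : Fin n → ℕ
  centred a = ∑[ b ∈ V ] ∑[ d ∈ V ] (𝟙 (¬? (b Fin.≟ d)) * (g a b * g a d))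

  deg*deg≤ : ∀ a → deg a * deg a ≤ deg a + centred a
  deg*deg≤ a = begin
    deg a * deg a                              ≡⟨ ∑-*ʳ V (g a) (deg a) ⟨
    (∑[ b ∈ V ] (g a b * deg a))               ≤⟨ ∑-mono V each ⟩
    (∑[ b ∈ V ] (g a b + rest b))              ≡⟨ ∑-+ V (g a) rest ⟩
    deg a + centred a                          ∎
    where
    open ≤-Reasoning
    rest : Fin n → ℕ
    rest b = ∑[ d ∈ V ] (𝟙 (¬? (b Fin.≟ d)) * (g a b * g a d))
    split : ∀ b d → g a b * g a d ≤ 𝟙 (d Fin.≟ b) * g a b + 𝟙 (¬? (b Fin.≟ d)) * (g a b * g a d)
    split b d with b Fin.≟ d
    ... | no _ = ≤-trans (≤-reflexive (sym (+-identityʳ _))) (m≤n+m _ (𝟙 (d Fin.≟ b) * g a b))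
    ... | yes refl = ≤-trans (≤-trans (*-monoʳ-≤ (g a b) (𝟙≤1 (edge? a b)))
                       (≤-trans (≤-reflexive (*-comm (g a b) 1)) (*-monoˡ-≤ (g a b) (𝟙-yes (b Fin.≟ b) refl)))) (m≤m+n _ _)
    each : ∀ b → g a b * deg a ≤ g a b + rest b
    each b = begin
      g a b * deg a                            ≡⟨ ∑-*ˡ V (g a b) (g a) ⟨
      (∑[ d ∈ V ] (g a b * g a d))             ≤⟨ ∑-mono V (split b) ⟩
      (∑[ d ∈ V ] (𝟙 (d Fin.≟ b) * g a b + 𝟙 (¬? (b Fin.≟ d)) * (g a b * g a d)))
                                               ≡⟨ ∑-+ V _ _ ⟩
      (∑[ d ∈ V ] (𝟙 (d Fin.≟ b) * g a b)) + rest b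
        ≤⟨ +-monoˡ-≤ (rest b) (∑-δ-≤ Fin._≟_ (allFin⁺ n) b (λ _ → g a b)) ⟩
      g a b + rest b                           ∎

  -- Exactly one of the two orientations of a cherry has its ends in the order `u < w` counted by
  -- `cherries`.
  ∑centred≤ : (∑[ a ∈ V ] centred a) ≤ 2 * cherries G
  ∑centred≤ = begin
    (∑[ a ∈ V ] centred a)
      ≤⟨ ∑-mono V (λ a → ∑-mono V λ b → ∑-mono V λ d → split a b d) ⟩
    (∑[ a ∈ V ] ∑[ b ∈ V ] ∑[ d ∈ V ] (ch b a d + ch d a b))
      ≡⟨ ∑-cong V (λ a → trans (∑-cong V λ b → ∑-+ V _ _) (∑-+ V _ _)) ⟩
    (∑[ a ∈ V ] ((∑[ b ∈ V ] ∑[ d ∈ V ] ch b a d) + (∑[ b ∈ V ] ∑[ d ∈ V ] ch d a b)))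
      ≡⟨ ∑-cong V (λ a → cong ((∑[ b ∈ V ] ∑[ d ∈ V ] ch b a d) +_) (∑-swap V V _)) ⟩
    (∑[ a ∈ V ] ((∑[ b ∈ V ] ∑[ d ∈ V ] ch b a d) + (∑[ b ∈ V ] ∑[ d ∈ V ] ch b a d)))
      ≡⟨ ∑-cong V (λ a → cong ((∑[ b ∈ V ] ∑[ d ∈ V ] ch b a d) +_) (sym (+-identityʳ _))) ⟩
    (∑[ a ∈ V ] (2 * (∑[ b ∈ V ] ∑[ d ∈ V ] ch b a d)))
      ≡⟨ ∑-*ˡ V 2 _ ⟩
    2 * (∑[ a ∈ V ] ∑[ b ∈ V ] ∑[ d ∈ V ] ch b a d)
      ≡⟨ cong (2 *_) (∑-swap V V _) ⟩
    2 * (∑[ b ∈ V ] ∑[ a ∈ V ] ∑[ d ∈ V ] ch b a d)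
      ≡⟨ cong (2 *_) (∑-cong V λ b → ∑-× V V (λ q → ch b (proj₁ q) (proj₂ q))) ⟨
    2 * (∑[ b ∈ V ] ∑[ q ∈ cartesianProduct V V ] ch b (proj₁ q) (proj₂ q))
      ≡⟨ cong (2 *_) (∑-× V (cartesianProduct V V) (λ q → ch (proj₁ q) (proj₁ (proj₂ q)) (proj₂ (proj₂ q)))) ⟨
    2 * (∑[ q ∈ cartesianProduct V (cartesianProduct V V) ] ch (proj₁ q) (proj₁ (proj₂ q)) (proj₂ (proj₂ q)))
      ≡⟨ cong (2 *_) (length-filter-∑ _ (cartesianProduct V (cartesianProduct V V))) ⟨
    2 * cherries G ∎
    where
    open ≤-Reasoning
    ch : Fin n → Fin n → Fin n → ℕ
    ch u v w = 𝟙 (T? (⌊ u Fin.<? w ⌋ ∧ adj G u v ∧ adj G v w))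
    ch≥ : ∀ {u v w} → u Fin.< w → Edge u v → Edge v w → 1 ≤ ch u v w
    ch≥ {u} {v} {w} lt e f = 𝟙-yes (T? (⌊ u Fin.<? w ⌋ ∧ adj G u v ∧ adj G v w))
      (Equivalence.from T-∧ (fromWitness {a? = u Fin.<? w} lt , Equivalence.from T-∧ (e , f)))
    split : ∀ a b d → 𝟙 (¬? (b Fin.≟ d)) * (g a b * g a d) ≤ ch b a d + ch d a b
    split a b d = 𝟙-≤₃ (¬? (b Fin.≟ d)) (edge? a b) (edge? a d) bound
      where
      bound : b ≢ d → Edge a b → Edge a d → 1 ≤ ch b a d + ch d a b
      bound b≢d e f with Fin.<-cmp b d
      ... | tri< lt _ _ = ≤-trans (ch≥ lt (edge-sym e) f) (m≤m+n _ _)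
      ... | tri≈ _ eq _ = contradiction eq b≢d
      ... | tri> _ _ gt = ≤-trans (ch≥ gt (edge-sym f) e) (m≤n+m _ _)

  other-edges : ∀ {a b} → Edge a b → (∑[ d ∈ V ] (𝟙 (¬? (a Fin.≟ d)) * g b d)) + 1 ≤ deg b
  other-edges {a} {b} e = begin
    (∑[ d ∈ V ] (𝟙 (¬? (a Fin.≟ d)) * g b d)) + 1
      ≤⟨ +-monoʳ-≤ _ (≤-trans (𝟙-yes (a Fin.≟ a) refl ⊗ 𝟙-yes (edge? b a) (edge-sym e))
           (∈-∑ (λ d → 𝟙 (a Fin.≟ d) * g b d) (∈-allFin a))) ⟩
    (∑[ d ∈ V ] (𝟙 (¬? (a Fin.≟ d)) * g b d)) + (∑[ d ∈ V ] (𝟙 (a Fin.≟ d) * g b d))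
      ≡⟨ ∑-+ V _ _ ⟨
    (∑[ d ∈ V ] (𝟙 (¬? (a Fin.≟ d)) * g b d + 𝟙 (a Fin.≟ d) * g b d))
      ≤⟨ ∑-mono V join ⟩
    deg b ∎
    where
    open ≤-Reasoning
    join : ∀ d → 𝟙 (¬? (a Fin.≟ d)) * g b d + 𝟙 (a Fin.≟ d) * g b d ≤ g b d
    join d with a Fin.≟ d
    ... | yes _ = ≤-reflexive (+-identityʳ _)
    ... | no _ = ≤-reflexive (trans (+-identityʳ _) (+-identityʳ _))

module Colours {n : ℕ} (c : Coloring n) (c-sym : IsSymmetric c) where

  private
    V : List (Fin n)
    V = allFin n

  -- Excludes the diagonal, where a colouring may take arbitrary values.
  Coloured : ℕ → Fin n → Fin n → Set
  Coloured α a b = a ≢ b × c a b ≡ α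

  coloured? : ∀ α a b → Dec (Coloured α a b)
  coloured? α a b = ¬? (a Fin.≟ b) ×-dec (c a b ≟ α)

  K : ℕ → Fin n → Fin n → ℕ
  K α a b = 𝟙 (coloured? α a b)

  private
    e : ℕ → Fin n → Fin n → ℕ
    e α a b = 𝟙 (a Fin.<? b) * 𝟙 (c a b ≟ α)

    colorCount-∑ : ∀ α → colorCount c α ≡ (∑[ a ∈ V ] ∑[ b ∈ V ] e α a b)
    colorCount-∑ α = trans (length-filter-∑ (λ p → c (proj₁ p) (proj₂ p) ≟ α) (edgesK n))
      (trans (∑-filter (λ p → proj₁ p Fin.<? proj₂ p) (cartesianProduct V V) _) (∑-× V V _))

    diagonal : ∀ {α} a → e α a a ≡ 0
    diagonal {α} a = cong (_* 𝟙 (c a a ≟ α))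
      (n≤0⇒n≡0 (𝟙-≤ (a Fin.<? a) λ lt → contradiction lt (Fin.<-irrefl refl)))

    K≤ : ∀ α a b → K α a b ≤ e α a b + e α b a
    K≤ α a b = 𝟙-≤ (coloured? α a b) bound
      where
      bound : Coloured α a b → 1 ≤ e α a b + e α b a
      bound (a≢b , eq) with Fin.<-cmp a b
      ... | tri< lt _ _ = ≤-trans (𝟙-yes (a Fin.<? b) lt ⊗ 𝟙-yes (c a b ≟ α) eq) (m≤m+n _ _)
      ... | tri≈ _ a≡b _ = contradiction a≡b a≢b
      ... | tri> _ _ gt = ≤-trans (𝟙-yes (b Fin.<? a) gt ⊗ 𝟙-yes (c b a ≟ α) (trans (c-sym b a) eq)) (m≤n+m _ _)

  K-total : ∀ α → (∑[ a ∈ V ] ∑[ b ∈ V ] K α a b) ≤ 2 * colorCount c α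
  K-total α = begin
    (∑[ a ∈ V ] ∑[ b ∈ V ] K α a b)
      ≤⟨ ∑-mono V (λ a → ∑-mono V λ b → K≤ α a b) ⟩
    (∑[ a ∈ V ] ∑[ b ∈ V ] (e α a b + e α b a))
      ≡⟨ trans (∑-cong V λ a → ∑-+ V _ _) (∑-+ V _ _) ⟩
    N + (∑[ a ∈ V ] ∑[ b ∈ V ] e α b a)
      ≡⟨ cong (N +_) (trans (∑-swap V V _) (sym (+-identityʳ N))) ⟩
    2 * N
      ≡⟨ cong (2 *_) (colorCount-∑ α) ⟨
    2 * colorCount c α ∎
    where
    open ≤-Reasoning
    N = ∑[ a ∈ V ] ∑[ b ∈ V ] e α a b

  -- No factor 2 as in `K-total`: each edge at `a` is counted once. Row and column `a` of the upper
  -- triangle `e` meet only on the diagonal, where `e` vanishes.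
  K-row : ∀ α a → (∑[ b ∈ V ] K α a b) ≤ colorCount c α
  K-row α a = begin
    (∑[ b ∈ V ] K α a b)
      ≤⟨ ∑-mono V (K≤ α a) ⟩
    (∑[ b ∈ V ] (e α a b + e α b a))
      ≡⟨ ∑-+ V _ _ ⟩
    (∑[ b ∈ V ] e α a b) + (∑[ x ∈ V ] e α x a)
      ≤⟨ +-mono-≤ rows (∑-mono V cols) ⟩
    (∑[ x ∈ V ] ∑[ y ∈ V ] (𝟙 (x Fin.≟ a) * e α x y)) + (∑[ x ∈ V ] ∑[ y ∈ V ] (𝟙 (y Fin.≟ a) * e α x y))
      ≡⟨ trans (∑-cong V λ x → ∑-+ V _ _) (∑-+ V _ _) ⟨
    (∑[ x ∈ V ] ∑[ y ∈ V ] (𝟙 (x Fin.≟ a) * e α x y + 𝟙 (y Fin.≟ a) * e α x y))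
      ≤⟨ ∑-mono V (λ x → ∑-mono V (once x)) ⟩
    (∑[ x ∈ V ] ∑[ y ∈ V ] e α x y)
      ≡⟨ colorCount-∑ α ⟨
    colorCount c α ∎
    where
    open ≤-Reasoning
    at : ∀ m → m ≤ 𝟙 (a Fin.≟ a) * m
    at m = ≤-trans (≤-reflexive (sym (*-identityˡ m))) (*-monoˡ-≤ m (𝟙-yes (a Fin.≟ a) refl))
    rows : (∑[ b ∈ V ] e α a b) ≤ (∑[ x ∈ V ] ∑[ y ∈ V ] (𝟙 (x Fin.≟ a) * e α x y))
    rows = ≤-trans (∑-mono V λ y → at (e α a y))
      (∈-∑ (λ x → ∑[ y ∈ V ] (𝟙 (x Fin.≟ a) * e α x y)) (∈-allFin a))
    cols : ∀ x → e α x a ≤ (∑[ y ∈ V ] (𝟙 (y Fin.≟ a) * e α x y))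
    cols x = ≤-trans (at (e α x a)) (∈-∑ (λ y → 𝟙 (y Fin.≟ a) * e α x y) (∈-allFin a))
    once : ∀ x y → 𝟙 (x Fin.≟ a) * e α x y + 𝟙 (y Fin.≟ a) * e α x y ≤ e α x y
    once x y with x Fin.≟ a | y Fin.≟ a
    ... | no _ | no _ = z≤n
    ... | no _ | yes _ = ≤-reflexive (+-identityʳ _)
    ... | yes _ | no _ = ≤-reflexive (trans (+-identityʳ _) (+-identityʳ _))
    ... | yes refl | yes refl rewrite diagonal {α} x = z≤n

  Twin : Fin n → Fin n → Fin n → Set
  Twin v w a = a ≢ v × a ≢ w × c a v ≡ c a w

  twin? : ∀ v w a → Dec (Twin v w a)
  twin? v w a = ¬? (a Fin.≟ v) ×-dec ¬? (a Fin.≟ w) ×-dec (c a v ≟ c a w)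

  codeg : Fin n → Fin n → ℕ
  codeg v w = ∑[ a ∈ V ] 𝟙 (twin? v w a)

  codeg-sym : ∀ v w → codeg v w ≤ codeg w v
  codeg-sym v w = ∑-mono V λ a → 𝟙-mono (twin? v w a) (twin? w v a)
    λ (≢v , ≢w , eq) → ≢w , ≢v , sym eq

-- Greedy choice of the images of the high-degree vertices

∑≡0⇒≡0 : ∀ {a} {A : Set a} {xs : List A} {x} f → x ∈ xs → ∑ xs f ≡ 0 → f x ≡ 0
∑≡0⇒≡0 f m eq = n≤0⇒n≡0 (≤-trans (∈-∑ f m) (≤-reflexive eq))

module Greedy {n : ℕ} (c : Coloring n) (c-sym : IsSymmetric c)
  (k t : ℕ) (k≥1 : 1 ≤ k) (t≥1 : 1 ≤ t) (bounded : ∀ α → colorCount c α ≤ k) where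

  open Colours c c-sym

  private
    V : List (Fin n)
    V = allFin n

  -- The codegree bound serves twice: it keeps `paired` small in the next greedy step, and it bounds
  -- the load of the events `F₈`.
  record Spread (L : List (Fin n)) : Set where
    field
      unique : Unique L
      few-twins : ∀ {v w} → v ∈ L → w ∈ L → v ≢ w → codeg v w ≤ 4 * (k * t)
      rainbow : ∀ {p q y z} → p ∈ L → q ∈ L → y ∈ L → z ∈ L → p ≢ q → y ≢ z →
        c p q ≡ c y z → (p ≡ y × q ≡ z) ⊎ (p ≡ z × q ≡ y)

  open Spread

  -- Averaged over `v`, codegrees with a fixed `w` are at most `k`: from each `a`, at most `k` edges
  -- have the colour of the edge to `w`.
  ∑codeg≤ : ∀ w → (∑[ v ∈ V ] codeg v w) ≤ n * k
  ∑codeg≤ w = ≤-trans (≤-reflexive (∑-swap V V _)) (∑-≤-const V (length-allFin n) each)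
    where
    each : ∀ a → (∑[ v ∈ V ] 𝟙 (twin? v w a)) ≤ k
    each a = ≤-trans (∑-mono V λ v → 𝟙-mono (twin? v w a) (coloured? (c a w) a v) λ (≢v , _ , eq) → ≢v , eq)
      (≤-trans (K-row (c a w) a) (bounded _))

  module _ (L : List (Fin n)) where

    -- The four ways in which `v` can fail as next image: it is taken, has a large codegree with an
    -- old image, repeats the colour of an old edge, or has two equally coloured edges to old
    -- images. As counts they can be averaged over `v`, and a total below `n` yields a `v` with no
    -- failure.
    repeats twinned mixed paired clash : Fin n → ℕ
    repeats v = ∑[ w ∈ L ] (𝟙 (v Fin.≟ w) * 1)
    twinned v = ∑[ w ∈ L ] 𝟙 (4 * (k * t) <? codeg v w)
    mixed v = ∑[ y ∈ L ] ∑[ z ∈ L ] ∑[ w ∈ L ] K (c y z) w v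
    paired v = ∑[ w ∈ L ] ∑[ w′ ∈ L ] (𝟙 (¬? (w Fin.≟ w′)) * 𝟙 (twin? w w′ v))
    clash v = repeats v + (twinned v + (mixed v + paired v))

    extend : ∀ {v} → Spread L → clash v ≡ 0 → Spread (v ∷ L)
    extend {v} s eq = record { unique = All.tabulate v∉ ∷ unique s ; few-twins = twins ; rainbow = rain }
      where
      eq₁ = m+n≡0⇒n≡0 (repeats v) eq
      eq₂ = m+n≡0⇒n≡0 (twinned v) eq₁
      v∉ : ∀ {w} → w ∈ L → v ≢ w
      v∉ {w} m = 𝟙≡0⇒¬ (v Fin.≟ w)
        (trans (sym (*-identityʳ _)) (∑≡0⇒≡0 (λ w → 𝟙 (v Fin.≟ w) * 1) m (m+n≡0⇒m≡0 _ eq)))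
      codeg≤ : ∀ {w} → w ∈ L → codeg v w ≤ 4 * (k * t)
      codeg≤ {w} m = ≮⇒≥ (𝟙≡0⇒¬ (4 * (k * t) <? codeg v w)
        (∑≡0⇒≡0 (λ w → 𝟙 (4 * (k * t) <? codeg v w)) m (m+n≡0⇒m≡0 _ eq₁)))
      new-old : ∀ {w y z} → w ∈ L → y ∈ L → z ∈ L → c w v ≢ c y z
      new-old {w} {y} {z} mw my mz e = 𝟙≡0⇒¬ (coloured? (c y z) w v)
        (∑≡0⇒≡0 (λ w → K (c y z) w v) mw
          (∑≡0⇒≡0 (λ z → ∑[ w ∈ L ] K (c y z) w v) mz
            (∑≡0⇒≡0 (λ y → ∑[ z ∈ L ] ∑[ w ∈ L ] K (c y z) w v) my (m+n≡0⇒m≡0 _ eq₂))))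
        ((λ w≡v → v∉ mw (sym w≡v)) , e)
      new-new : ∀ {w w′} → w ∈ L → w′ ∈ L → c v w ≡ c v w′ → w ≡ w′
      new-new {w} {w′} m m′ e with w Fin.≟ w′
        | ∑≡0⇒≡0 (λ w′ → 𝟙 (¬? (w Fin.≟ w′)) * 𝟙 (twin? w w′ v)) m′
          (∑≡0⇒≡0 (λ w → ∑[ w′ ∈ L ] (𝟙 (¬? (w Fin.≟ w′)) * 𝟙 (twin? w w′ v))) m
            (m+n≡0⇒n≡0 (mixed v) eq₂))
      ... | yes w≡w′ | _ = w≡w′
      ... | no _ | zero′ = contradiction (v∉ m , v∉ m′ , e)
              (𝟙≡0⇒¬ (twin? w w′ v) (trans (sym (*-identityˡ _)) zero′))
      twins : ∀ {x w} → x ∈ v ∷ L → w ∈ v ∷ L → x ≢ w → codeg x w ≤ 4 * (k * t)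
      twins (here refl) (here refl) ≢ = contradiction refl ≢
      twins (here refl) (there m) _ = codeg≤ m
      twins {x} {w} (there m) (here refl) _ = ≤-trans (codeg-sym x w) (codeg≤ m)
      twins (there m) (there m′) = few-twins s m m′
      rain : ∀ {p q y z} → p ∈ v ∷ L → q ∈ v ∷ L → y ∈ v ∷ L → z ∈ v ∷ L → p ≢ q → y ≢ z →
        c p q ≡ c y z → (p ≡ y × q ≡ z) ⊎ (p ≡ z × q ≡ y)
      rain (here refl) (here refl) _ _ ≢ _ _ = contradiction refl ≢
      rain _ _ (here refl) (here refl) _ ≢ _ = contradiction refl ≢
      rain (here refl) (there q) (here refl) (there z) _ _ e = inj₁ (refl , new-new q z e)
      rain (here refl) (there q) (there y) (here refl) _ _ e = inj₂ (refl , new-new q y (trans e (c-sym _ _)))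
      rain (there p) (here refl) (here refl) (there z) _ _ e = inj₂ (new-new p z (trans (c-sym _ _) e) , refl)
      rain (there p) (here refl) (there y) (here refl) _ _ e =
        inj₁ (new-new p y (trans (c-sym _ _) (trans e (c-sym _ _))) , refl)
      rain (here refl) (there q) (there y) (there z) _ _ e = contradiction (trans (c-sym _ _) e) (new-old q y z)
      rain (there p) (here refl) (there y) (there z) _ _ e = contradiction e (new-old p y z)
      rain (there p) (there q) (here refl) (there z) _ _ e = contradiction (trans (c-sym _ _) (sym e)) (new-old z p q)
      rain (there p) (there q) (there y) (here refl) _ _ e = contradiction (sym e) (new-old y p q)
      rain (there p) (there q) (there y) (there z) = rainbow s p q y z

  module _ (room : 4 * (t + (t * (t * (t * k)) + t * (t * (4 * (k * t))))) + n < 4 * n) where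

    choose : ∀ L → length L ≤ t → Spread L → ∃ λ v → Spread (v ∷ L)
    choose L len s = proj₁ found , extend L s (proj₂ (proj₂ found))
      where
      open ≤-Reasoning
      markov : ∀ w → suc (4 * (k * t)) * (∑[ v ∈ V ] 𝟙 (4 * (k * t) <? codeg v w)) ≤ n * k
      markov w = ≤-trans (*-∑-≤ V (suc (4 * (k * t))) λ v _ → each v) (∑codeg≤ w)
        where
        each : ∀ v → suc (4 * (k * t)) * 𝟙 (4 * (k * t) <? codeg v w) ≤ codeg v w
        each v = *-𝟙-≤ (4 * (k * t) <? codeg v w) λ lt → lt
      bound₁ : ∑ V (repeats L) ≤ t
      bound₁ = begin
        ∑ V (repeats L)                              ≡⟨ ∑-swap V L _ ⟩
        (∑[ w ∈ L ] ∑[ v ∈ V ] (𝟙 (v Fin.≟ w) * 1))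
          ≤⟨ ∑-≤-const L len (λ w → ∑-δ-≤ Fin._≟_ (allFin⁺ n) w (λ _ → 1)) ⟩
        t * 1                                        ≡⟨ *-identityʳ t ⟩
        t                                            ∎
      bound₂ : 4 * ∑ V (twinned L) ≤ n
      -- Markov's inequality: for each old image fewer than n / (4 t) vertices exceed the threshold
      -- `4 * (k * t)`, so at most a quarter of all vertices is lost to at most `t` old images.
      bound₂ = *-cancelˡ-≤ (k * t) {{>-nonZero (k≥1 ⊗ t≥1)}} (begin
        k * t * (4 * ∑ V (twinned L))         ≡⟨ shuffle (k * t) (∑ V (twinned L)) ⟩
        4 * (k * t) * ∑ V (twinned L)         ≤⟨ *-monoˡ-≤ (∑ V (twinned L)) (n≤1+n (4 * (k * t))) ⟩
        suc (4 * (k * t)) * ∑ V (twinned L)   ≡⟨ cong (suc (4 * (k * t)) *_) (∑-swap V L _) ⟩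
        suc (4 * (k * t)) * (∑[ w ∈ L ] ∑[ v ∈ V ] 𝟙 (4 * (k * t) <? codeg v w))
          ≤⟨ *-∑-≤ L (suc (4 * (k * t))) (λ w _ → markov w) ⟩
        (∑[ _ ∈ L ] (n * k))                         ≤⟨ ∑-≤-const L len (λ _ → ≤-refl) ⟩
        t * (n * k)                                  ≡⟨ shuffle′ t n k ⟩
        k * t * n                                    ∎)
        where
        shuffle : ∀ p q → p * (4 * q) ≡ 4 * p * q
        shuffle = solve-∀
        shuffle′ : ∀ p q o → p * (q * o) ≡ o * p * q
        shuffle′ = solve-∀
      bound₃ : ∑ V (mixed L) ≤ t * (t * (t * k))
      bound₃ = begin
        ∑ V (mixed L)
          ≡⟨ trans (∑-swap V L _) (∑-cong L λ y → trans (∑-swap V L _) (∑-cong L λ z → ∑-swap V L _)) ⟩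
        (∑[ y ∈ L ] ∑[ z ∈ L ] ∑[ w ∈ L ] ∑[ v ∈ V ] K (c y z) w v)
          ≤⟨ ∑-≤-const L len (λ y → ∑-≤-const L len λ z → ∑-≤-const L len λ w →
               ≤-trans (K-row (c y z) w) (bounded (c y z))) ⟩
        t * (t * (t * k)) ∎
      bound₄ : ∑ V (paired L) ≤ t * (t * (4 * (k * t)))
      bound₄ = begin
        ∑ V (paired L)
          ≡⟨ trans (∑-swap V L _) (∑-cong L λ w → ∑-swap V L _) ⟩
        (∑[ w ∈ L ] ∑[ w′ ∈ L ] ∑[ v ∈ V ] (𝟙 (¬? (w Fin.≟ w′)) * 𝟙 (twin? w w′ v)))
          ≤⟨ ∑-mono-∈ L (λ w m → ∑-mono-∈ L (λ w′ m′ → pair w w′ m m′)) ⟩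
        (∑[ w ∈ L ] ∑[ w′ ∈ L ] (4 * (k * t)))
          ≤⟨ ∑-≤-const L len (λ w → ∑-≤-const L len λ w′ → ≤-refl) ⟩
        t * (t * (4 * (k * t))) ∎
        where
        pair : ∀ w w′ → w ∈ L → w′ ∈ L →
          (∑[ v ∈ V ] (𝟙 (¬? (w Fin.≟ w′)) * 𝟙 (twin? w w′ v))) ≤ 4 * (k * t)
        pair w w′ m m′ with w Fin.≟ w′
        ... | yes _ = ≤-trans (≤-reflexive (∑-0 V)) z≤n
        -- The invariant of the previous steps is used here: the vertices seeing two old images in
        -- one colour are few.
        ... | no w≢w′ = ≤-trans (≤-reflexive (∑-cong V λ _ → +-identityʳ _)) (few-twins s m m′ w≢w′)
      few : ∑ V (clash L) < length V
      few = subst (∑ V (clash L) <_) (sym (length-tabulate (λ i → i))) (*-cancelˡ-< 4 (∑ V (clash L)) n (begin-strict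
        4 * ∑ V (clash L)
          ≡⟨ cong (4 *_) (trans (∑-+ V (repeats L) _) (cong (∑ V (repeats L) +_)
               (trans (∑-+ V (twinned L) _) (cong (∑ V (twinned L) +_) (∑-+ V (mixed L) (paired L)))))) ⟩
        4 * (∑ V (repeats L) + (∑ V (twinned L) + (∑ V (mixed L) + ∑ V (paired L))))
          ≡⟨ regroup (∑ V (repeats L)) (∑ V (twinned L)) (∑ V (mixed L)) (∑ V (paired L)) ⟩
        4 * (∑ V (repeats L) + (∑ V (mixed L) + ∑ V (paired L))) + 4 * ∑ V (twinned L)
          ≤⟨ +-mono-≤ (*-monoʳ-≤ 4 (+-mono-≤ bound₁ (+-mono-≤ bound₃ bound₄))) bound₂ ⟩
        4 * (t + (t * (t * (t * k)) + t * (t * (4 * (k * t))))) + n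
          <⟨ room ⟩
        4 * n ∎))
        where
        regroup : ∀ p q o m → 4 * (p + (q + (o + m))) ≡ 4 * (p + (o + m)) + 4 * q
        regroup = solve-∀
      found = ∑-∃-zero V (clash L) few

    spread-images : ∀ X → length X ≤ t →
      ∃ λ (pinned : List (Fin n × Fin n)) → map proj₁ pinned ≡ X × Spread (map proj₂ pinned)
    spread-images [] _ = [] , refl , record { unique = [] ; few-twins = λ () ; rainbow = λ () }
    spread-images (x ∷ X) len = prepend (spread-images X (<⇒≤ len))
      where
      prepend : (∃ λ (pinned : List (Fin n × Fin n)) → map proj₁ pinned ≡ X × Spread (map proj₂ pinned)) →
        ∃ λ (pinned : List (Fin n × Fin n)) → map proj₁ pinned ≡ x ∷ X × Spread (map proj₂ pinned)
      prepend (pinned , eq , s) = (x , proj₁ next) ∷ pinned , cong (x ∷_) eq , proj₂ next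
        where
        next = choose (map proj₂ pinned) (≤-trans (≤-reflexive (trans (length-map proj₂ pinned)
          (trans (sym (length-map proj₁ pinned)) (cong length eq)))) (<⇒≤ len)) s

-- Bad events and their loads

-- One summand for each of `F₁`, ..., `F₈`, in this order. The power of `n` is the weight of the
-- family's events; the other factor bounds how many of them pass through a given vertex.
domainLoad : (n t Δ k A E : ℕ) → ℕ
domainLoad n t Δ k A E =
  n ^ 0 * (4 * (n * (Δ * n * (A * (2 * k)))))
  + (n ^ 1 * (t * (n * (A * (2 * k))) + 2 * (t * (Δ * n * (Δ * (2 * k)))))
  + (n ^ 2 * (2 * (t * (n * (Δ * (2 * k)))))
  + (n ^ 2 * (2 * (Δ * (t * (t * (2 * k)))))
  + (n ^ 3 * (t * (t * (t * k)))
  + (n ^ 1 * (n * (suc E * n * (E * k)) + 2 * (n * (suc E * n * (E * k))))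
  + (n ^ 2 * (t * (n * (Δ * k)) + t * (Δ * n * k))
  + n ^ 3 * (t * (t * (4 * (k * t))))))))))

-- The same for a given image. The vertex that carries it is not fixed, so the cherry total `m` and
-- the number `w` of two-step walks replace local degree bounds in `F₆` and `F₇`.
imageLoad : (n t Δ k A m w : ℕ) → ℕ
imageLoad n t Δ k A m w =
  n ^ 0 * (4 * (A * (n * (A * (2 * k)))))
  + (n ^ 1 * (t * (Δ * (A * (2 * k))) + 2 * (A * (n * (Δ * (2 * k)))))
  + (n ^ 2 * (2 * (t * (Δ * (Δ * (2 * k)))))
  + (n ^ 2 * (2 * (A * (t * (t * k))))
  + (n ^ 3 * (t * (Δ * 1))
  + (n ^ 1 * (m * n * k + 2 * (m * n * k))
  + (n ^ 2 * (t * (Δ * (Δ * k)) + w * (n * k))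
  + n ^ 3 * (t * (Δ * k))))))))

module Families {n : ℕ} (G : Graph n) (c : Coloring n) (c-sym : IsSymmetric c)
  (E : ℕ) (pinned : List (Fin n × Fin n)) where

  open Degrees G
  open Colours c c-sym

  -- A vertex of G together with its image.
  Place : Set
  Place = Fin n × Fin n

  VV : List Place
  VV = cartesianProduct V V

  Link : Place → Place → Set
  Link p q = Edge (proj₁ p) (proj₁ q)

  link? : ∀ p q → Dec (Link p q)
  link? p q = edge? (proj₁ p) (proj₁ q)

  ℓ : Place → Place → ℕ
  ℓ p q = g (proj₁ p) (proj₁ q)

  Match : Place → Place → Place → Place → Set
  Match p q y z = proj₂ p ≢ proj₂ q × Coloured (c (proj₂ p) (proj₂ q)) (proj₂ y) (proj₂ z)

  match? : ∀ p q y z → Dec (Match p q y z)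
  match? p q y z = ¬? (proj₂ p Fin.≟ proj₂ q) ×-dec coloured? (c (proj₂ p) (proj₂ q)) (proj₂ y) (proj₂ z)

  match-sym : ∀ p q y z → Match p q y z → Match y z p q
  match-sym p q y z (p≢q , y≢z , eq) = y≢z , p≢q , sym eq

  Taken : ℕ → Set
  Taken α = Any (λ y → Any (λ z → Coloured α (proj₂ y) (proj₂ z)) pinned) pinned

  taken? : ∀ α → Dec (Taken α)
  taken? α = Any.any? (λ y → Any.any? (λ z → coloured? α (proj₂ y) (proj₂ z)) pinned) pinned

  -- The degree bound satisfied by free vertices. It is built into `F₆`, the family in which a
  -- product of two degrees at one vertex would otherwise be too large.
  Low : Place → Set
  Low p = deg (proj₁ p) ≤ suc E

  low? : ∀ p → Dec (Low p)
  low? p = deg (proj₁ p) ≤? suc E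

  Bad₁ : (Place × Place) × (Place × Place) → Set
  Bad₁ ((p , q) , (y , z)) = Link p q × Link y z × Match p q y z

  bad₁? : ∀ i → Dec (Bad₁ i)
  bad₁? ((p , q) , (y , z)) = link? p q ×-dec link? y z ×-dec match? p q y z

  Bad₄ : Place × Place → Set
  Bad₄ (p , q) = Link p q × proj₂ p ≢ proj₂ q × Taken (c (proj₂ p) (proj₂ q))

  bad₄? : ∀ i → Dec (Bad₄ i)
  bad₄? (p , q) = link? p q ×-dec ¬? (proj₂ p Fin.≟ proj₂ q) ×-dec taken? (c (proj₂ p) (proj₂ q))

  Bad₆ : Place × (Place × Place) → Set
  Bad₆ (q , (p , z)) = proj₁ p ≢ proj₁ z × (Low p × Low q × Low z) × Bad₁ ((q , p) , (q , z))

  bad₆? : ∀ i → Dec (Bad₆ i)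
  bad₆? (q , (p , z)) =
    ¬? (proj₁ p Fin.≟ proj₁ z) ×-dec (low? p ×-dec low? q ×-dec low? z) ×-dec bad₁? ((q , p) , (q , z))

  Bad₇ : Place × (Place × Place) → Set
  Bad₇ (x , (p , q)) = Bad₁ ((x , p) , (p , q))

  bad₇? : ∀ i → Dec (Bad₇ i)
  bad₇? (x , (p , q)) = bad₁? ((x , p) , (p , q))

  Bad₈ : (Place × Place) × Place → Set
  Bad₈ ((x , y) , p) = Link x p × Link y p × proj₂ x ≢ proj₂ y × Twin (proj₂ x) (proj₂ y) (proj₂ p)

  bad₈? : ∀ i → Dec (Bad₈ i)
  bad₈? ((x , y) , p) =
    link? x p ×-dec link? y p ×-dec ¬? (proj₂ x Fin.≟ proj₂ y) ×-dec twin? (proj₂ x) (proj₂ y) (proj₂ p)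

  VVVV XV : List (Place × Place)
  VVVV = cartesianProduct VV VV
  XV = cartesianProduct pinned VV

  ev₁ : (Place × Place) × (Place × Place) → List Place
  ev₁ ((p , q) , (y , z)) = p ∷ q ∷ y ∷ z ∷ []

  ev₂ : (Place × Place) × (Place × Place) → List Place
  ev₂ ((x , p) , (q , z)) = p ∷ q ∷ z ∷ []

  ev₃ : (Place × Place) × (Place × Place) → List Place
  ev₃ ((x , p) , (y , q)) = p ∷ q ∷ []

  ev₄ : Place × Place → List Place
  ev₄ (p , q) = p ∷ q ∷ []

  ev₅ : Place × Place → List Place
  ev₅ (x , p) = p ∷ []

  ev₆ : Place × (Place × Place) → List Place
  ev₆ (q , (p , z)) = q ∷ p ∷ z ∷ []

  ev₇ : Place × (Place × Place) → List Place
  ev₇ (x , (p , q)) = p ∷ q ∷ []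

  ev₈ : (Place × Place) × Place → List Place
  ev₈ ((x , y) , p) = p ∷ []

  -- The indices do not ask that the remaining places be free or distinct. Improper events only
  -- enlarge the loads and are removed afterwards by `proper?`.
  I₁ I₂ I₃ : List ((Place × Place) × (Place × Place))
  I₁ = cartesianProduct VVVV VVVV
  I₂ = cartesianProduct XV VVVV
  I₃ = cartesianProduct XV XV

  I₆ I₇ : List (Place × (Place × Place))
  I₆ = cartesianProduct VV VVVV
  I₇ = cartesianProduct pinned VVVV

  I₈ : List ((Place × Place) × Place)
  I₈ = cartesianProduct (cartesianProduct pinned pinned) VV

  -- With x, y pinned and a, b, d, e free, the equally coloured pairs of edges are: ab and de in F₁; xa and bd in F₂;
  -- xa and yb in F₃; ab or xa and an edge between pinned vertices in F₄ or F₅; ba and bd in F₆; xa and ab in F₇;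
  -- xa and ya in F₈.
  F₁ F₂ F₃ F₄ F₅ F₆ F₇ F₈ 𝓑 : List (List Place)
  F₁ = map ev₁ (filter bad₁? I₁)
  F₂ = map ev₂ (filter bad₁? I₂)
  F₃ = map ev₃ (filter bad₁? I₃)
  F₄ = map ev₄ (filter bad₄? VVVV)
  F₅ = map ev₅ (filter bad₄? XV)
  F₆ = map ev₆ (filter bad₆? I₆)
  F₇ = map ev₇ (filter bad₇? I₇)
  F₈ = map ev₈ (filter bad₈? I₈)
  𝓑 = F₁ ++ F₂ ++ F₃ ++ F₄ ++ F₅ ++ F₆ ++ F₇ ++ F₈

  hits : ∀ {I : Set} {P : I → Set} → (Place → ℕ) → List I → (∀ i → Dec (P i)) → (I → List Place) → ℕ
  hits h L P? ev = ∑[ i ∈ L ] (𝟙 (P? i) * ∑ (ev i) h)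

  load-family : ∀ {I : Set} {P : I → Set} h L (P? : ∀ i → Dec (P i)) ev l → (∀ i → length (ev i) ≡ l) →
    load h (map ev (filter P? L)) ≤ n ^ (4 ∸ l) * hits h L P? ev
  load-family h L P? ev l len = begin
    load h (map ev (filter P? L))
      ≡⟨ ∑-map ev (filter P? L) _ ⟩
    (∑[ i ∈ filter P? L ] (weight (ev i) * ∑ (ev i) h))
      ≡⟨ ∑-filter P? L _ ⟩
    (∑[ i ∈ L ] (𝟙 (P? i) * (weight (ev i) * ∑ (ev i) h)))
      ≤⟨ ∑-pull L (n ^ (4 ∸ l)) (λ i → ≤-reflexive (trans
           (cong (λ e → 𝟙 (P? i) * (n ^ (4 ∸ e) * ∑ (ev i) h)) (len i))
           (shuffle (𝟙 (P? i)) (n ^ (4 ∸ l)) (∑ (ev i) h)))) ≤-refl ⟩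
    n ^ (4 ∸ l) * hits h L P? ev ∎
    where
    open ≤-Reasoning
    shuffle : ∀ p q o → p * (q * o) ≡ q * (p * o)
    shuffle = solve-∀

  load-𝓑 : ∀ h → load h 𝓑 ≡ load h F₁ + (load h F₂ + (load h F₃ + (load h F₄ +
    (load h F₅ + (load h F₆ + (load h F₇ + load h F₈))))))
  load-𝓑 h =
    trans (∑-++ F₁ _ _) (cong (load h F₁ +_) (trans (∑-++ F₂ _ _) (cong (load h F₂ +_)
    (trans (∑-++ F₃ _ _) (cong (load h F₃ +_) (trans (∑-++ F₄ _ _) (cong (load h F₄ +_)
    (trans (∑-++ F₅ _ _) (cong (load h F₅ +_) (trans (∑-++ F₆ _ _) (cong (load h F₆ +_)
    (∑-++ F₇ F₈ _))))))))))))

  dom-eval : ∀ u (f : Place → ℕ) → (∑[ p ∈ VV ] (hitDom u p * f p)) ≤ (∑[ a′ ∈ V ] f (u , a′))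
  dom-eval u f = begin
    (∑[ p ∈ VV ] (hitDom u p * f p))                       ≡⟨ ∑-× V V _ ⟩
    (∑[ a ∈ V ] ∑[ a′ ∈ V ] (𝟙 (a Fin.≟ u) * f (a , a′)))  ≡⟨ ∑-cong V (λ a → ∑-*ˡ V (𝟙 (a Fin.≟ u)) _) ⟩
    (∑[ a ∈ V ] (𝟙 (a Fin.≟ u) * (∑[ a′ ∈ V ] f (a , a′))))
      ≤⟨ ∑-δ-≤ Fin._≟_ (allFin⁺ n) u (λ a → ∑[ a′ ∈ V ] f (a , a′)) ⟩
    (∑[ a′ ∈ V ] f (u , a′)) ∎
    where open ≤-Reasoning

  im-eval : ∀ u′ (f : Place → ℕ) → (∑[ p ∈ VV ] (hitIm u′ p * f p)) ≤ (∑[ a ∈ V ] f (a , u′))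
  im-eval u′ f = ≤-trans (≤-reflexive (∑-× V V _))
    (∑-mono V λ a → ∑-δ-≤ Fin._≟_ (allFin⁺ n) u′ (λ a′ → f (a , a′)))

  ∑VV-dom : ∀ (f : Fin n → ℕ) {B} → ∑ V f ≤ B → (∑[ q ∈ VV ] f (proj₁ q)) ≤ B * n
  ∑VV-dom f le = ∑-×-≤ V V {h = λ _ → 1} (λ a _ → ≤-reflexive (sym (*-identityʳ (f a)))) le
    (≤-trans (≤-reflexive (trans (∑-const V 1) (*-identityʳ _))) (length-allFin n))

  -- Counting the bad events through a fixed vertex or a fixed image.

  module Bounds {k t Δ w m : ℕ} (bounded : ∀ α → colorCount c α ≤ k) (deg≤ : ∀ a → deg a ≤ Δ)
    (two-step : ∀ x → (∑[ a ∈ V ] (g x a * deg a)) ≤ w)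
    (cherries≤ : (∑[ a ∈ V ] centred a) ≤ m)
    (#pinned : length pinned ≤ t) (images-unique : Unique (map proj₂ pinned))
    (few-twins : ∀ {x y} → x ∈ pinned → y ∈ pinned → proj₂ x ≢ proj₂ y →
      codeg (proj₂ x) (proj₂ y) ≤ 4 * (k * t)) where

    open ≤-Reasoning

    row : ∀ α a → ∑ V (K α a) ≤ k
    row α a = ≤-trans (K-row α a) (bounded α)

    total : ∀ α → (∑[ a ∈ V ] ∑ V (K α a)) ≤ 2 * k
    total α = ≤-trans (K-total α) (*-monoʳ-≤ 2 (bounded α))

    pinned-≤ : ∀ (f : Fin n → ℕ) → (∑[ x ∈ pinned ] f (proj₂ x)) ≤ ∑ V f
    pinned-≤ f = ≤-trans (≤-reflexive (sym (∑-map proj₂ pinned f)))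
      (∑-⊆ V f images-unique λ v _ → ∈-allFin v)

    arcs-coloured : ∀ α → (∑[ q ∈ VVVV ] (ℓ (proj₁ q) (proj₂ q) * K α (proj₂ (proj₁ q)) (proj₂ (proj₂ q))))
      ≤ #arcs * (2 * k)
    arcs-coloured α = ≤-trans (≤-reflexive (∑-× VV VV _))
      (∑-×-≤ V V (λ y y′ → ∑-×-≤ V V (λ _ _ → ≤-refl) ≤-refl ≤-refl) ≤-refl (total α))

    -- No factor `t`: the pinned images are distinct, so the ordered pairs of colour `α` starting at
    -- them number at most `2 * k` altogether. The vertex at the other end has at most `Δ` choices.
    pinned-coloured : ∀ α → (∑[ i ∈ XV ] (ℓ (proj₁ i) (proj₂ i) * K α (proj₂ (proj₁ i)) (proj₂ (proj₂ i))))
      ≤ Δ * (2 * k)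
    pinned-coloured α = ≤-trans (≤-reflexive (∑-× pinned VV _))
      (∑-pull pinned Δ (λ x → ∑-×-≤ V V (λ _ _ → ≤-refl) (deg≤ (proj₁ x)) ≤-refl)
        (≤-trans (pinned-≤ λ x′ → ∑ V (K α x′)) (total α)))

    spoke-dom : ∀ u B → (∑[ i ∈ XV ] (hitDom u (proj₂ i) * (ℓ (proj₁ i) (proj₂ i) * B))) ≤ t * (n * B)
    spoke-dom u B = ≤-trans (≤-reflexive (∑-× pinned VV _)) (∑-≤-const pinned #pinned λ x →
      ≤-trans (dom-eval u _) (∑-≤-const V (length-allFin n) λ _ → 𝟙*≤ (edge? (proj₁ x) u) B))

    spoke-im : ∀ u′ B → (∑[ i ∈ XV ] (hitIm u′ (proj₂ i) * (ℓ (proj₁ i) (proj₂ i) * B))) ≤ t * (Δ * B)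
    spoke-im u′ B = ≤-trans (≤-reflexive (∑-× pinned VV _)) (∑-≤-const pinned #pinned λ x →
      ≤-trans (im-eval u′ _) (∑-≤ V (λ _ → ≤-refl) (deg≤ (proj₁ x))))

    R₁ : Place → ℕ
    R₁ p = ∑[ q ∈ VV ] ∑[ e ∈ VVVV ] 𝟙 (bad₁? ((p , q) , e))

    -- All four places of the event play the same role: exchanging the two edges and reversing one
    -- edge each cost a factor 2.
    hits₁ : ∀ h → hits h I₁ bad₁? ev₁ ≤ 4 * (∑[ p ∈ VV ] (h p * R₁ p))
    hits₁ h = begin
      hits h I₁ bad₁? ev₁
        ≡⟨ ∑-× VVVV VVVV _ ⟩
      (∑[ d ∈ VVVV ] ∑[ e ∈ VVVV ] (𝟙 (bad₁? (d , e)) * ∑ (ev₁ (d , e)) h))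
        ≡⟨ ∑-cong VVVV (λ d → ∑-cong VVVV λ e → cong (𝟙 (bad₁? (d , e)) *_)
             (regroup (h (proj₁ d)) (h (proj₂ d)) (h (proj₁ e)) (h (proj₂ e)))) ⟩
      (∑[ d ∈ VVVV ] ∑[ e ∈ VVVV ] (𝟙 (bad₁? (d , e)) * (H d + H e)))
        ≤⟨ ∑-symmetric-≤ VVVV (λ d e → 𝟙 (bad₁? (d , e))) H (λ d e → 𝟙-mono (bad₁? (d , e)) (bad₁? (e , d))
             λ (l , l′ , mt) → l′ , l , match-sym (proj₁ d) (proj₂ d) (proj₁ e) (proj₂ e) mt) ⟩
      2 * (∑[ d ∈ VVVV ] (H d * (∑[ e ∈ VVVV ] 𝟙 (bad₁? (d , e)))))
        ≡⟨ cong (2 *_) (trans (∑-cong VVVV λ d → *-comm (H d) _) (∑-× VV VV _)) ⟩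
      2 * (∑[ p ∈ VV ] ∑[ q ∈ VV ] ((∑[ e ∈ VVVV ] 𝟙 (bad₁? ((p , q) , e))) * (h p + h q)))
        ≤⟨ *-monoʳ-≤ 2 (∑-symmetric-≤ VV (λ p q → ∑[ e ∈ VVVV ] 𝟙 (bad₁? ((p , q) , e))) h
             λ p q → ∑-mono VVVV λ e → 𝟙-mono (bad₁? ((p , q) , e)) (bad₁? ((q , p) , e))
               λ (l , l′ , p≢q , y≢z , eq) → edge-sym l , l′ , (λ e → p≢q (sym e)) , y≢z , trans eq (c-sym _ _)) ⟩
      2 * (2 * (∑[ p ∈ VV ] (h p * R₁ p)))
        ≡⟨ *-assoc 2 2 (∑[ p ∈ VV ] (h p * R₁ p)) ⟨
      4 * (∑[ p ∈ VV ] (h p * R₁ p)) ∎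
      where
      H : Place × Place → ℕ
      H (p , q) = h p + h q
      regroup : ∀ p q y z → p + (q + (y + (z + 0))) ≡ p + q + (y + z)
      regroup = solve-∀

    -- A neighbour of the first vertex and its image determine a colour; the second arc then lands
    -- on one of at most `2 * k` ordered pairs.
    R₁≤ : ∀ p → R₁ p ≤ deg (proj₁ p) * n * (#arcs * (2 * k))
    R₁≤ p = ∑-≤ VV (λ q → ∑-pull VVVV (ℓ p q) (λ e → bound q e) (arcs-coloured (c (proj₂ p) (proj₂ q))))
      (∑VV-dom (g (proj₁ p)) ≤-refl)
      where
      bound : ∀ q e → 𝟙 (bad₁? ((p , q) , e)) ≤
        ℓ p q * (ℓ (proj₁ e) (proj₂ e) * K (c (proj₂ p) (proj₂ q)) (proj₂ (proj₁ e)) (proj₂ (proj₂ e)))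
      bound q (y , z) = 𝟙-≤ (bad₁? ((p , q) , (y , z))) λ (l , l′ , _ , mt) →
        𝟙-yes (link? p q) l ⊗ 𝟙-yes (link? y z) l′ ⊗ 𝟙-yes (coloured? (c (proj₂ p) (proj₂ q)) (proj₂ y) (proj₂ z)) mt

    F₁-dom : ∀ u → hits (hitDom u) I₁ bad₁? ev₁ ≤ 4 * (n * (Δ * n * (#arcs * (2 * k))))
    F₁-dom u = ≤-trans (hits₁ (hitDom u)) (*-monoʳ-≤ 4 (≤-trans (dom-eval u R₁)
      (∑-≤-const V (length-allFin n) λ a′ → ≤-trans (R₁≤ (u , a′))
        (*-monoˡ-≤ (#arcs * (2 * k)) (*-monoˡ-≤ n (deg≤ u))))))

    F₁-im : ∀ u′ → hits (hitIm u′) I₁ bad₁? ev₁ ≤ 4 * (#arcs * (n * (#arcs * (2 * k))))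
    F₁-im u′ = ≤-trans (hits₁ (hitIm u′)) (*-monoʳ-≤ 4 (≤-trans (im-eval u′ R₁)
      (∑-≤ V (λ a → ≤-trans (R₁≤ (a , u′)) (≤-reflexive (*-assoc (deg a) n _))) ≤-refl)))

    R₂ : Place → ℕ
    R₂ q = ∑[ i ∈ XV ] ∑[ z ∈ VV ] 𝟙 (bad₁? (i , (q , z)))

    -- The free end of the spoke is counted by itself; the two ends of the free edge are
    -- interchangeable.
    hits₂ : ∀ h → hits h I₂ bad₁? ev₂ ≤
      (∑[ i ∈ XV ] (h (proj₂ i) * (ℓ (proj₁ i) (proj₂ i) * (#arcs * (2 * k)))))
      + 2 * (∑[ q ∈ VV ] (h q * R₂ q))
    hits₂ h = begin
      hits h I₂ bad₁? ev₂
        ≡⟨ ∑-× XV VVVV _ ⟩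
      (∑[ i ∈ XV ] ∑[ e ∈ VVVV ] (𝟙 (bad₁? (i , e)) * ∑ (ev₂ (i , e)) h))
        ≡⟨ ∑-cong XV (λ i → trans (∑-cong VVVV λ e → regroup (𝟙 (bad₁? (i , e))) (h (proj₂ i)) (h (proj₁ e)) (h (proj₂ e)))
             (∑-+ VVVV _ _)) ⟩
      (∑[ i ∈ XV ] ((∑[ e ∈ VVVV ] (h (proj₂ i) * 𝟙 (bad₁? (i , e)))) + (∑[ e ∈ VVVV ] (𝟙 (bad₁? (i , e)) * H e))))
        ≡⟨ ∑-+ XV _ _ ⟩
      (∑[ i ∈ XV ] ∑[ e ∈ VVVV ] (h (proj₂ i) * 𝟙 (bad₁? (i , e)))) + (∑[ i ∈ XV ] ∑[ e ∈ VVVV ] (𝟙 (bad₁? (i , e)) * H e))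
        ≤⟨ +-mono-≤ (∑-mono XV λ i → ∑-pull VVVV (h (proj₂ i)) (λ _ → ≤-refl)
             (∑-pull VVVV (ℓ (proj₁ i) (proj₂ i)) (bound i) (arcs-coloured (col i)))) second ⟩
      (∑[ i ∈ XV ] (h (proj₂ i) * (ℓ (proj₁ i) (proj₂ i) * (#arcs * (2 * k)))))
        + 2 * (∑[ q ∈ VV ] (h q * R₂ q)) ∎
      where
      H : Place × Place → ℕ
      H (q , z) = h q + h z
      regroup : ∀ o p q z → o * (p + (q + (z + 0))) ≡ p * o + o * (q + z)
      regroup = solve-∀
      col : Place × Place → ℕ
      col (x , p) = c (proj₂ x) (proj₂ p)
      bound : ∀ i e → 𝟙 (bad₁? (i , e)) ≤
        ℓ (proj₁ i) (proj₂ i) * (ℓ (proj₁ e) (proj₂ e) * K (col i) (proj₂ (proj₁ e)) (proj₂ (proj₂ e)))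
      bound (x , p) (y , z) = 𝟙-≤ (bad₁? ((x , p) , (y , z))) λ (l , l′ , _ , mt) →
        𝟙-yes (link? x p) l ⊗ 𝟙-yes (link? y z) l′ ⊗ 𝟙-yes (coloured? (c (proj₂ x) (proj₂ p)) (proj₂ y) (proj₂ z)) mt
      second : (∑[ i ∈ XV ] ∑[ e ∈ VVVV ] (𝟙 (bad₁? (i , e)) * H e)) ≤ 2 * (∑[ q ∈ VV ] (h q * R₂ q))
      second = begin
        (∑[ i ∈ XV ] ∑[ e ∈ VVVV ] (𝟙 (bad₁? (i , e)) * H e))
          ≤⟨ ∑-mono XV (λ i → ≤-trans (≤-reflexive (∑-× VV VV _))
               (∑-symmetric-≤ VV (λ q z → 𝟙 (bad₁? (i , (q , z)))) h λ q z →
                 𝟙-mono (bad₁? (i , (q , z))) (bad₁? (i , (z , q)))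
                   λ (l , l′ , x≢p , q≢z , eq) → l , edge-sym l′ , x≢p , (λ e → q≢z (sym e)) , trans (c-sym _ _) eq)) ⟩
        (∑[ i ∈ XV ] (2 * (∑[ q ∈ VV ] (h q * (∑[ z ∈ VV ] 𝟙 (bad₁? (i , (q , z))))))))
          ≡⟨ trans (∑-*ˡ XV 2 _) (cong (2 *_) (∑-swap XV VV _)) ⟩
        2 * (∑[ q ∈ VV ] ∑[ i ∈ XV ] (h q * (∑[ z ∈ VV ] 𝟙 (bad₁? (i , (q , z))))))
          ≡⟨ cong (2 *_) (∑-cong VV λ q → ∑-*ˡ XV (h q) _) ⟩
        2 * (∑[ q ∈ VV ] (h q * R₂ q)) ∎

    F₂-dom : ∀ u → hits (hitDom u) I₂ bad₁? ev₂ ≤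
      t * (n * (#arcs * (2 * k))) + 2 * (t * (Δ * n * (Δ * (2 * k))))
    F₂-dom u = ≤-trans (hits₂ (hitDom u)) (+-mono-≤ (spoke-dom u _) (*-monoʳ-≤ 2 (begin
      (∑[ q ∈ VV ] (hitDom u q * R₂ q))
        ≤⟨ dom-eval u R₂ ⟩
      (∑[ b′ ∈ V ] R₂ (u , b′))
        ≡⟨ trans (∑-swap V XV _) (∑-× pinned VV _) ⟩
      (∑[ x ∈ pinned ] ∑[ p ∈ VV ] ∑[ b′ ∈ V ] ∑[ z ∈ VV ] 𝟙 (bad₁? ((x , p) , ((u , b′) , z))))
        ≤⟨ ∑-≤-const pinned #pinned (λ x → ∑-≤ VV (λ p → inner x p) (∑VV-dom (g (proj₁ x)) (deg≤ (proj₁ x)))) ⟩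
      t * (Δ * n * (Δ * (2 * k))) ∎)))
      where
      inner : ∀ x p → (∑[ b′ ∈ V ] ∑[ z ∈ VV ] 𝟙 (bad₁? ((x , p) , ((u , b′) , z)))) ≤ ℓ x p * (Δ * (2 * k))
      inner x p = ∑-pull V (ℓ x p) (λ b′ → ∑-pull VV (ℓ x p) (bound b′) (∑-×-≤ V V (λ _ _ → ≤-refl) (deg≤ u) ≤-refl))
        (≤-trans (≤-reflexive (∑-*ˡ V Δ _)) (*-monoʳ-≤ Δ (total (c (proj₂ x) (proj₂ p)))))
        where
        bound : ∀ b′ z → 𝟙 (bad₁? ((x , p) , ((u , b′) , z))) ≤
          ℓ x p * (g u (proj₁ z) * K (c (proj₂ x) (proj₂ p)) b′ (proj₂ z))
        bound b′ z = 𝟙-≤ (bad₁? ((x , p) , ((u , b′) , z))) λ (l , l′ , _ , mt) →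
          𝟙-yes (link? x p) l ⊗ 𝟙-yes (edge? u (proj₁ z)) l′
            ⊗ 𝟙-yes (coloured? (c (proj₂ x) (proj₂ p)) b′ (proj₂ z)) mt

    -- For the free edge the order of counting is reversed: its placement fixes the colour, after
    -- which `pinned-coloured` bounds the spokes of that colour.
    F₂-im : ∀ u′ → hits (hitIm u′) I₂ bad₁? ev₂ ≤
      t * (Δ * (#arcs * (2 * k))) + 2 * (#arcs * (n * (Δ * (2 * k))))
    F₂-im u′ = ≤-trans (hits₂ (hitIm u′)) (+-mono-≤ (spoke-im u′ _) (*-monoʳ-≤ 2 (begin
      (∑[ q ∈ VV ] (hitIm u′ q * R₂ q))
        ≤⟨ im-eval u′ R₂ ⟩
      (∑[ b ∈ V ] ∑[ i ∈ XV ] ∑[ z ∈ VV ] 𝟙 (bad₁? (i , ((b , u′) , z))))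
        ≡⟨ ∑-cong V (λ b → ∑-swap XV VV _) ⟩
      (∑[ b ∈ V ] ∑[ z ∈ VV ] ∑[ i ∈ XV ] 𝟙 (bad₁? (i , ((b , u′) , z))))
        ≤⟨ ∑-≤ V (λ b → ≤-trans (∑-≤ VV (λ z → ∑-pull XV (g b (proj₁ z)) (bound b z)
             (pinned-coloured (c u′ (proj₂ z)))) (∑VV-dom (g b) ≤-refl))
             (≤-reflexive (*-assoc (deg b) n _))) ≤-refl ⟩
      #arcs * (n * (Δ * (2 * k))) ∎)))
      where
      bound : ∀ b z i → 𝟙 (bad₁? (i , ((b , u′) , z))) ≤
        g b (proj₁ z) * (ℓ (proj₁ i) (proj₂ i) * K (c u′ (proj₂ z)) (proj₂ (proj₁ i)) (proj₂ (proj₂ i)))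
      bound b z (x , p) = 𝟙-≤ (bad₁? ((x , p) , ((b , u′) , z))) λ (l , l′ , x≢p , _ , eq) →
        𝟙-yes (edge? b (proj₁ z)) l′ ⊗ 𝟙-yes (link? x p) l
          ⊗ 𝟙-yes (coloured? (c u′ (proj₂ z)) (proj₂ x) (proj₂ p)) (x≢p , sym eq)

    hits₃ : ∀ h → hits h I₃ bad₁? ev₃ ≤
      2 * (∑[ i ∈ XV ] (h (proj₂ i) * (ℓ (proj₁ i) (proj₂ i) * (Δ * (2 * k)))))
    hits₃ h = begin
      hits h I₃ bad₁? ev₃
        ≡⟨ ∑-× XV XV _ ⟩
      (∑[ i ∈ XV ] ∑[ j ∈ XV ] (𝟙 (bad₁? (i , j)) * ∑ (ev₃ (i , j)) h))
        ≡⟨ ∑-cong XV (λ i → ∑-cong XV λ j → cong (λ e → 𝟙 (bad₁? (i , j)) * (h (proj₂ i) + e)) (+-identityʳ _)) ⟩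
      (∑[ i ∈ XV ] ∑[ j ∈ XV ] (𝟙 (bad₁? (i , j)) * (h (proj₂ i) + h (proj₂ j))))
        ≤⟨ ∑-symmetric-≤ XV (λ i j → 𝟙 (bad₁? (i , j))) (h ∘ proj₂) (λ i j → 𝟙-mono (bad₁? (i , j)) (bad₁? (j , i))
             λ (l , l′ , mt) → l′ , l , match-sym (proj₁ i) (proj₂ i) (proj₁ j) (proj₂ j) mt) ⟩
      2 * (∑[ i ∈ XV ] (h (proj₂ i) * (∑[ j ∈ XV ] 𝟙 (bad₁? (i , j)))))
        ≤⟨ *-monoʳ-≤ 2 (∑-mono XV λ i → *-monoʳ-≤ (h (proj₂ i)) (∑-pull XV (ℓ (proj₁ i) (proj₂ i)) (bound i)
             (pinned-coloured (c (proj₂ (proj₁ i)) (proj₂ (proj₂ i)))))) ⟩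
      2 * (∑[ i ∈ XV ] (h (proj₂ i) * (ℓ (proj₁ i) (proj₂ i) * (Δ * (2 * k))))) ∎
      where
      bound : ∀ i e → 𝟙 (bad₁? (i , e)) ≤ ℓ (proj₁ i) (proj₂ i) *
        (ℓ (proj₁ e) (proj₂ e) * K (c (proj₂ (proj₁ i)) (proj₂ (proj₂ i))) (proj₂ (proj₁ e)) (proj₂ (proj₂ e)))
      bound (x , p) (y , z) = 𝟙-≤ (bad₁? ((x , p) , (y , z))) λ (l , l′ , _ , mt) →
        𝟙-yes (link? x p) l ⊗ 𝟙-yes (link? y z) l′ ⊗ 𝟙-yes (coloured? (c (proj₂ x) (proj₂ p)) (proj₂ y) (proj₂ z)) mt

    F₃-dom : ∀ u → hits (hitDom u) I₃ bad₁? ev₃ ≤ 2 * (t * (n * (Δ * (2 * k))))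
    F₃-dom u = ≤-trans (hits₃ (hitDom u)) (*-monoʳ-≤ 2 (spoke-dom u _))

    F₃-im : ∀ u′ → hits (hitIm u′) I₃ bad₁? ev₃ ≤ 2 * (t * (Δ * (Δ * (2 * k))))
    F₃-im u′ = ≤-trans (hits₃ (hitIm u′)) (*-monoʳ-≤ 2 (spoke-im u′ _))

    -- Counts the witnesses for `Taken`, which makes the sums over all pairs of that colour
    -- accessible.
    κ : Fin n → Fin n → ℕ
    κ a′ b′ = ∑[ y ∈ pinned ] ∑[ z ∈ pinned ] K (c (proj₂ y) (proj₂ z)) a′ b′

    κ-total : (∑[ a′ ∈ V ] ∑[ b′ ∈ V ] κ a′ b′) ≤ t * (t * (2 * k))
    κ-total = begin
      (∑[ a′ ∈ V ] ∑[ b′ ∈ V ] κ a′ b′)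
        ≡⟨ trans (∑-cong V λ a′ → trans (∑-swap V pinned _) (∑-cong pinned λ y → ∑-swap V pinned _))
             (trans (∑-swap V pinned _) (∑-cong pinned λ y → ∑-swap V pinned _)) ⟩
      (∑[ y ∈ pinned ] ∑[ z ∈ pinned ] ∑[ a′ ∈ V ] ∑[ b′ ∈ V ] K (c (proj₂ y) (proj₂ z)) a′ b′)
        ≤⟨ ∑-≤-const pinned #pinned (λ y → ∑-≤-const pinned #pinned λ z → total _) ⟩
      t * (t * (2 * k)) ∎

    κ-row : ∀ a′ → ∑ V (κ a′) ≤ t * (t * k)
    κ-row a′ = ≤-trans
      (≤-reflexive (trans (∑-swap V pinned _) (∑-cong pinned λ y → ∑-swap V pinned _)))
      (∑-≤-const pinned #pinned λ y → ∑-≤-const pinned #pinned λ z → row _ a′)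

    taken≤κ : ∀ {a′ b′} → a′ ≢ b′ → Taken (c a′ b′) → 1 ≤ κ a′ b′
    taken≤κ {a′} {b′} ne tk with find tk
    ... | y , y∈ , tk′ with find tk′
    ... | z , z∈ , _ , eq = ≤-trans (𝟙-yes (coloured? (c (proj₂ y) (proj₂ z)) a′ b′) (ne , sym eq))
      (≤-trans (∈-∑ (λ z → K (c (proj₂ y) (proj₂ z)) a′ b′) z∈)
               (∈-∑ (λ y → ∑[ z ∈ pinned ] K (c (proj₂ y) (proj₂ z)) a′ b′) y∈))

    bad₄≤ : ∀ p q → 𝟙 (bad₄? (p , q)) ≤ ℓ p q * κ (proj₂ p) (proj₂ q)
    bad₄≤ p q = 𝟙-≤ (bad₄? (p , q)) λ (l , ne , tk) → 𝟙-yes (link? p q) l ⊗ taken≤κ ne tk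

    R₄ : Place → ℕ
    R₄ p = ∑[ q ∈ VV ] 𝟙 (bad₄? (p , q))

    hits₄ : ∀ h → hits h VVVV bad₄? ev₄ ≤ 2 * (∑[ p ∈ VV ] (h p * R₄ p))
    hits₄ h = begin
      hits h VVVV bad₄? ev₄
        ≡⟨ ∑-× VV VV _ ⟩
      (∑[ p ∈ VV ] ∑[ q ∈ VV ] (𝟙 (bad₄? (p , q)) * (h p + (h q + 0))))
        ≡⟨ ∑-cong VV (λ p → ∑-cong VV λ q → cong (λ e → 𝟙 (bad₄? (p , q)) * (h p + e)) (+-identityʳ _)) ⟩
      (∑[ p ∈ VV ] ∑[ q ∈ VV ] (𝟙 (bad₄? (p , q)) * (h p + h q)))
        ≤⟨ ∑-symmetric-≤ VV (λ p q → 𝟙 (bad₄? (p , q))) h (λ p q → 𝟙-mono (bad₄? (p , q)) (bad₄? (q , p))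
             λ (l , ne , tk) → edge-sym l , (λ e → ne (sym e)) , subst Taken (c-sym (proj₂ p) (proj₂ q)) tk) ⟩
      2 * (∑[ p ∈ VV ] (h p * R₄ p)) ∎

    F₄-dom : ∀ u → hits (hitDom u) VVVV bad₄? ev₄ ≤ 2 * (Δ * (t * (t * (2 * k))))
    F₄-dom u = ≤-trans (hits₄ (hitDom u)) (*-monoʳ-≤ 2 (≤-trans (dom-eval u R₄)
      (∑-pull V Δ (λ a′ → ∑-×-≤ V V (λ b b′ → bad₄≤ (u , a′) (b , b′)) (deg≤ u) ≤-refl) κ-total)))

    F₄-im : ∀ u′ → hits (hitIm u′) VVVV bad₄? ev₄ ≤ 2 * (#arcs * (t * (t * k)))
    F₄-im u′ = ≤-trans (hits₄ (hitIm u′)) (*-monoʳ-≤ 2 (≤-trans (im-eval u′ R₄)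
      (∑-≤ V (λ a → ∑-×-≤ V V (λ b b′ → bad₄≤ (a , u′) (b , b′)) ≤-refl (κ-row u′)) ≤-refl)))

    hits₅ : ∀ h → hits h XV bad₄? ev₅ ≡ (∑[ i ∈ XV ] (h (proj₂ i) * 𝟙 (bad₄? i)))
    hits₅ h = ∑-cong XV λ i → trans (cong (𝟙 (bad₄? i) *_) (+-identityʳ _)) (*-comm _ (h (proj₂ i)))

    F₅-dom : ∀ u → hits (hitDom u) XV bad₄? ev₅ ≤ t * (t * (t * k))
    F₅-dom u = ≤-trans (≤-reflexive (trans (hits₅ (hitDom u)) (∑-× pinned VV _)))
      (∑-≤-const pinned #pinned λ x → ≤-trans (dom-eval u λ p → 𝟙 (bad₄? (x , p)))
        (≤-trans (∑-mono V λ a′ → ≤-trans (bad₄≤ x (u , a′)) (𝟙*≤ (edge? (proj₁ x) u) _)) (κ-row (proj₂ x))))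

    -- The colour condition is dropped: once the image is fixed, the pairs of a pinned vertex and a
    -- neighbour already number at most `t * Δ`.
    F₅-im : ∀ u′ → hits (hitIm u′) XV bad₄? ev₅ ≤ t * (Δ * 1)
    F₅-im u′ = ≤-trans (≤-reflexive (hits₅ (hitIm u′))) (≤-trans
      (∑-mono XV λ (x , p) → *-monoʳ-≤ (hitIm u′ p) (𝟙-≤ (bad₄? (x , p)) λ (l , _) → 𝟙-yes (link? x p) l ⊗ ≤-refl))
      (spoke-im u′ 1))

    others : Fin n → Fin n → ℕ
    others a b = ∑[ d ∈ V ] (𝟙 (¬? (a Fin.≟ d)) * g b d)

    -- One of the at most `suc E` neighbours of `q` is `p` itself, hence `E` and not `suc E`.
    spoke-others : ∀ p q → 𝟙 (low? q) * (ℓ q p * others (proj₁ p) (proj₁ q)) ≤ 𝟙 (low? q) * (ℓ q p * E)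
    spoke-others p q = 𝟙-*-≤ (low? q) λ low → 𝟙-*-≤ (link? q p) λ l → +-cancelʳ-≤ 1 _ E
      (≤-trans (other-edges (edge-sym l)) (≤-trans low (≤-reflexive (+-comm 1 E))))

    low-degree : ∀ p → 𝟙 (low? p) * deg (proj₁ p) ≤ suc E
    low-degree p = ≤-trans (𝟙-*-≤ (low? p) λ low → low) (𝟙*≤ (low? p) (suc E))

    R₆ : Place → Place → ℕ
    R₆ q p = ∑[ z ∈ VV ] 𝟙 (bad₆? (q , (p , z)))

    R₆≤ : ∀ q p → R₆ q p ≤ 𝟙 (low? p) * (𝟙 (low? q) * (ℓ q p * others (proj₁ p) (proj₁ q))) * k
    R₆≤ q p = begin
      R₆ q p
        ≤⟨ ∑-×-≤ V V (λ d d′ → 𝟙-≤ (bad₆? (q , (p , (d , d′))))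
             λ (p≢z , (lp , lq , _) , (l , l′ , _ , mt)) →
               (𝟙-yes (low? p) lp ⊗ 𝟙-yes (low? q) lq ⊗ 𝟙-yes (link? q p) l
                  ⊗ 𝟙-yes (¬? (proj₁ p Fin.≟ d)) p≢z ⊗ 𝟙-yes (edge? (proj₁ q) d) l′)
               ⊗ 𝟙-yes (coloured? (c (proj₂ q) (proj₂ p)) (proj₂ q) d′) mt) ≤-refl (row _ (proj₂ q)) ⟩
      (∑[ d ∈ V ] (𝟙 (low? p) * (𝟙 (low? q) * (ℓ q p * (𝟙 (¬? (proj₁ p Fin.≟ d)) * g (proj₁ q) d))))) * k
        ≡⟨ cong (_* k) (trans (∑-*ˡ V (𝟙 (low? p)) _) (cong (𝟙 (low? p) *_)
             (trans (∑-*ˡ V (𝟙 (low? q)) _) (cong (𝟙 (low? q) *_) (∑-*ˡ V (ℓ q p) _))))) ⟩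
      𝟙 (low? p) * (𝟙 (low? q) * (ℓ q p * others (proj₁ p) (proj₁ q))) * k ∎

    -- Two forms of one estimate, keeping the degree restriction at the vertex over whose neighbours
    -- the sum is taken next: the centre `q` or the end `p`.
    R₆-local : ∀ q p → R₆ q p ≤ 𝟙 (low? q) * ℓ q p * (E * k) × R₆ q p ≤ 𝟙 (low? p) * ℓ q p * (E * k)
    R₆-local q p =
      ≤-trans base (≤-trans (*-monoˡ-≤ k (𝟙*≤ (low? p) _)) (≤-reflexive (shuffle (𝟙 (low? q)) (ℓ q p) E k))) ,
      ≤-trans base (≤-trans (*-monoˡ-≤ k (*-monoʳ-≤ (𝟙 (low? p)) (𝟙*≤ (low? q) _)))
        (≤-reflexive (shuffle (𝟙 (low? p)) (ℓ q p) E k)))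
      where
      base : R₆ q p ≤ 𝟙 (low? p) * (𝟙 (low? q) * (ℓ q p * E)) * k
      base = ≤-trans (R₆≤ q p) (*-monoˡ-≤ k (*-monoʳ-≤ (𝟙 (low? p)) (spoke-others p q)))
      shuffle : ∀ a b e o → a * (b * e) * o ≡ a * b * (e * o)
      shuffle = solve-∀

    -- For a fixed image all vertices are summed over, and the restriction to low degrees is dropped
    -- in favour of the total number of cherries.
    R₆-global : ∀ q p → R₆ q p ≤ ℓ q p * others (proj₁ p) (proj₁ q) * k
    R₆-global q p = ≤-trans (R₆≤ q p)
      (*-monoˡ-≤ k (≤-trans (𝟙*≤ (low? p) _) (𝟙*≤ (low? q) _)))

    hits₆ : ∀ h → hits h I₆ bad₆? ev₆ ≤
      (∑[ q ∈ VV ] (h q * (∑[ p ∈ VV ] R₆ q p))) + 2 * (∑[ p ∈ VV ] (h p * (∑[ q ∈ VV ] R₆ q p)))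
    hits₆ h = begin
      hits h I₆ bad₆? ev₆
        ≡⟨ trans (∑-× VV VVVV _) (∑-cong VV λ q → ∑-× VV VV _) ⟩
      (∑[ q ∈ VV ] ∑[ p ∈ VV ] ∑[ z ∈ VV ] (𝟙 (bad₆? (q , (p , z))) * (h q + (h p + (h z + 0)))))
        ≡⟨ ∑-cong VV (λ q → trans (∑-cong VV λ p → trans (∑-cong VV λ z →
             regroup (𝟙 (bad₆? (q , (p , z)))) (h q) (h p) (h z)) (∑-+ VV _ _)) (∑-+ VV _ _)) ⟩
      (∑[ q ∈ VV ] ((∑[ p ∈ VV ] ∑[ z ∈ VV ] (h q * 𝟙 (bad₆? (q , (p , z)))))
        + (∑[ p ∈ VV ] ∑[ z ∈ VV ] (𝟙 (bad₆? (q , (p , z))) * (h p + h z)))))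
        ≤⟨ ∑-mono VV (λ q → +-mono-≤
             (∑-pull VV (h q) (λ p → ∑-pull VV (h q) (λ _ → ≤-refl) ≤-refl) ≤-refl)
             (∑-symmetric-≤ VV (λ p z → 𝟙 (bad₆? (q , (p , z)))) h λ p z →
               𝟙-mono (bad₆? (q , (p , z))) (bad₆? (q , (z , p)))
                 λ (ne , (lp , lq , lz) , (l , l′ , mt)) →
                   (λ e → ne (sym e)) , (lz , lq , lp) , (l′ , l , match-sym q p q z mt))) ⟩
      (∑[ q ∈ VV ] (h q * (∑[ p ∈ VV ] R₆ q p) + 2 * (∑[ p ∈ VV ] (h p * R₆ q p))))
        ≡⟨ trans (∑-+ VV _ _) (cong ((∑[ q ∈ VV ] (h q * (∑[ p ∈ VV ] R₆ q p))) +_) (trans (∑-*ˡ VV 2 _)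
             (cong (2 *_) (trans (∑-swap VV VV _) (∑-cong VV λ p → ∑-*ˡ VV (h p) _))))) ⟩
      (∑[ q ∈ VV ] (h q * (∑[ p ∈ VV ] R₆ q p))) + 2 * (∑[ p ∈ VV ] (h p * (∑[ q ∈ VV ] R₆ q p))) ∎
      where
      regroup : ∀ o p q z → o * (p + (q + (z + 0))) ≡ p * o + o * (q + z)
      regroup = solve-∀

    F₆-dom : ∀ u → hits (hitDom u) I₆ bad₆? ev₆ ≤
      n * (suc E * n * (E * k)) + 2 * (n * (suc E * n * (E * k)))
    F₆-dom u = ≤-trans (hits₆ (hitDom u)) (+-mono-≤
      (≤-trans (dom-eval u _) (∑-≤-const V (length-allFin n) λ b′ →
        ∑-≤ VV (λ p → proj₁ (R₆-local (u , b′) p)) (centre b′)))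
      (*-monoʳ-≤ 2 (≤-trans (dom-eval u _) (∑-≤-const V (length-allFin n) λ a′ →
        ∑-≤ VV (λ q → proj₂ (R₆-local q (u , a′))) (end a′)))))
      where
      centre : ∀ b′ → (∑[ p ∈ VV ] (𝟙 (low? (u , b′)) * g u (proj₁ p))) ≤ suc E * n
      centre b′ = ∑VV-dom (λ a → 𝟙 (low? (u , b′)) * g u a)
        (≤-trans (≤-reflexive (∑-*ˡ V (𝟙 (low? (u , b′))) (g u))) (low-degree (u , b′)))
      end : ∀ a′ → (∑[ q ∈ VV ] (𝟙 (low? (u , a′)) * g (proj₁ q) u)) ≤ suc E * n
      end a′ = ∑VV-dom (λ b → 𝟙 (low? (u , a′)) * g b u)
        (≤-trans (≤-trans (≤-reflexive (∑-*ˡ V (𝟙 (low? (u , a′))) (λ b → g b u)))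
          (*-monoʳ-≤ (𝟙 (low? (u , a′))) (in-degree-≤ u))) (low-degree (u , a′)))

    F₆-im : ∀ u′ → hits (hitIm u′) I₆ bad₆? ev₆ ≤ m * n * k + 2 * (m * n * k)
    F₆-im u′ = ≤-trans (hits₆ (hitIm u′)) (+-mono-≤
      (≤-trans (im-eval u′ _) (∑-≤ V (λ b → centre b) m*n))
      (*-monoʳ-≤ 2 (≤-trans (im-eval u′ _) (begin
        (∑[ a ∈ V ] ∑[ q ∈ VV ] R₆ q (a , u′))
          ≡⟨ ∑-swap V VV _ ⟩
        (∑[ q ∈ VV ] ∑[ a ∈ V ] R₆ q (a , u′))
          ≤⟨ ∑-≤ VV (λ q → ∑-≤ V (λ a → R₆-global q (a , u′)) (pairs (proj₁ q))) (∑VV-dom centred cherries≤) ⟩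
        m * n * k ∎))))
      where
      pairs : ∀ b → (∑[ a ∈ V ] (g b a * others a b)) ≤ centred b
      pairs b = ∑-mono V λ a → ≤-reflexive (trans (sym (∑-*ˡ V (g b a) _))
        (∑-cong V λ d → shuffle (g b a) (𝟙 (¬? (a Fin.≟ d))) (g b d)))
        where
        shuffle : ∀ p q o → p * (q * o) ≡ q * (p * o)
        shuffle = solve-∀
      centre : ∀ b → (∑[ p ∈ VV ] R₆ (b , u′) p) ≤ centred b * n * k
      centre b = ∑-≤ VV (λ p → R₆-global (b , u′) p) (∑VV-dom (λ a → g b a * others a b) (pairs b))
      m*n : (∑[ b ∈ V ] (centred b * n)) ≤ m * n
      m*n = ≤-trans (≤-reflexive (∑-*ʳ V centred n)) (*-monoˡ-≤ n cherries≤)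

    S₇ : Place → Place → ℕ
    S₇ x p = ∑[ q ∈ VV ] 𝟙 (bad₇? (x , (p , q)))

    R₇ : Place → ℕ
    R₇ q = ∑[ x ∈ pinned ] ∑[ p ∈ VV ] 𝟙 (bad₇? (x , (p , q)))

    hits₇ : ∀ h → hits h I₇ bad₇? ev₇ ≤
      (∑[ i ∈ XV ] (h (proj₂ i) * (ℓ (proj₁ i) (proj₂ i) * (Δ * k)))) + (∑[ q ∈ VV ] (h q * R₇ q))
    hits₇ h = begin
      hits h I₇ bad₇? ev₇
        ≡⟨ trans (∑-× pinned VVVV _) (∑-cong pinned λ x → ∑-× VV VV _) ⟩
      (∑[ x ∈ pinned ] ∑[ p ∈ VV ] ∑[ q ∈ VV ] (𝟙 (bad₇? (x , (p , q))) * (h p + (h q + 0))))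
        ≡⟨ ∑-cong pinned (λ x → trans (∑-cong VV λ p → trans (∑-cong VV λ q →
             regroup (𝟙 (bad₇? (x , (p , q)))) (h p) (h q)) (∑-+ VV _ _)) (∑-+ VV _ _)) ⟩
      (∑[ x ∈ pinned ] ((∑[ p ∈ VV ] ∑[ q ∈ VV ] (h p * 𝟙 (bad₇? (x , (p , q)))))
        + (∑[ p ∈ VV ] ∑[ q ∈ VV ] (h q * 𝟙 (bad₇? (x , (p , q)))))))
        ≡⟨ ∑-+ pinned _ _ ⟩
      (∑[ x ∈ pinned ] ∑[ p ∈ VV ] ∑[ q ∈ VV ] (h p * 𝟙 (bad₇? (x , (p , q)))))
        + (∑[ x ∈ pinned ] ∑[ p ∈ VV ] ∑[ q ∈ VV ] (h q * 𝟙 (bad₇? (x , (p , q)))))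
        ≤⟨ +-mono-≤
             (≤-trans (∑-mono pinned λ x → ∑-mono VV λ p → ∑-pull VV (h p) (λ _ → ≤-refl) (S₇≤ x p))
               (≤-reflexive (sym (∑-× pinned VV _))))
             (≤-reflexive (trans (∑-cong pinned λ x → ∑-swap VV VV _) (trans (∑-swap pinned VV _)
               (∑-cong VV λ q → trans (∑-cong pinned λ x → ∑-*ˡ VV (h q) _) (∑-*ˡ pinned (h q) _))))) ⟩
      (∑[ i ∈ XV ] (h (proj₂ i) * (ℓ (proj₁ i) (proj₂ i) * (Δ * k)))) + (∑[ q ∈ VV ] (h q * R₇ q)) ∎
      where
      regroup : ∀ o p q → o * (p + (q + 0)) ≡ p * o + q * o
      regroup = solve-∀
      S₇≤ : ∀ x p → S₇ x p ≤ ℓ x p * (Δ * k)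
      S₇≤ x p = ∑-pull VV (ℓ x p) bound (∑-×-≤ V V (λ _ _ → ≤-refl) (deg≤ (proj₁ p)) (row (c (proj₂ x) (proj₂ p)) (proj₂ p)))
        where
        bound : ∀ q → 𝟙 (bad₇? (x , (p , q))) ≤ ℓ x p * (g (proj₁ p) (proj₁ q) * K (c (proj₂ x) (proj₂ p)) (proj₂ p) (proj₂ q))
        bound q = 𝟙-≤ (bad₇? (x , (p , q))) λ (l , l′ , _ , mt) →
          𝟙-yes (link? x p) l ⊗ 𝟙-yes (link? p q) l′ ⊗ 𝟙-yes (coloured? (c (proj₂ x) (proj₂ p)) (proj₂ p) (proj₂ q)) mt

    F₇-dom : ∀ u → hits (hitDom u) I₇ bad₇? ev₇ ≤ t * (n * (Δ * k)) + t * (Δ * n * k)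
    F₇-dom u = ≤-trans (hits₇ (hitDom u)) (+-mono-≤ (spoke-dom u _) (begin
      (∑[ q ∈ VV ] (hitDom u q * R₇ q))
        ≤⟨ dom-eval u R₇ ⟩
      (∑[ b′ ∈ V ] R₇ (u , b′))
        ≡⟨ trans (∑-swap V pinned _) (∑-cong pinned λ x → ∑-swap V VV _) ⟩
      (∑[ x ∈ pinned ] ∑[ p ∈ VV ] ∑[ b′ ∈ V ] 𝟙 (bad₇? (x , (p , (u , b′)))))
        ≤⟨ ∑-≤-const pinned #pinned (λ x → ∑-≤ VV (λ p → ∑-pull V (g (proj₁ p) u) (bound x p) (row _ (proj₂ p)))
             (∑VV-dom (λ a → g a u) (≤-trans (in-degree-≤ u) (deg≤ u)))) ⟩
      t * (Δ * n * k) ∎))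
      where
      bound : ∀ x p b′ → 𝟙 (bad₇? (x , (p , (u , b′)))) ≤ g (proj₁ p) u * K (c (proj₂ x) (proj₂ p)) (proj₂ p) b′
      bound x p b′ = 𝟙-≤ (bad₇? (x , (p , (u , b′)))) λ (_ , l′ , _ , mt) →
        𝟙-yes (edge? (proj₁ p) u) l′ ⊗ 𝟙-yes (coloured? (c (proj₂ x) (proj₂ p)) (proj₂ p) b′) mt

    -- When the image belongs to the far end `b`, the vertices form a walk of length two from the
    -- pinned `x`, giving `w`. For each image `a′` of the middle vertex, at most `k` pinned images
    -- are joined to it in the colour of the edge to `u′`, so summing over `x` costs no factor `t`.
    F₇-im : ∀ u′ → hits (hitIm u′) I₇ bad₇? ev₇ ≤ t * (Δ * (Δ * k)) + w * (n * k)
    F₇-im u′ = ≤-trans (hits₇ (hitIm u′)) (+-mono-≤ (spoke-im u′ _) (begin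
      (∑[ q ∈ VV ] (hitIm u′ q * R₇ q))
        ≤⟨ im-eval u′ R₇ ⟩
      (∑[ b ∈ V ] ∑[ x ∈ pinned ] ∑[ p ∈ VV ] 𝟙 (bad₇? (x , (p , (b , u′)))))
        ≡⟨ trans (∑-swap V pinned _) (∑-cong pinned λ x → ∑-swap V VV _) ⟩
      (∑[ x ∈ pinned ] ∑[ p ∈ VV ] ∑[ b ∈ V ] 𝟙 (bad₇? (x , (p , (b , u′)))))
        ≤⟨ ∑-mono pinned (λ x → ∑-mono VV λ p → ∑-≤ V (bound x p) ≤-refl) ⟩
      (∑[ x ∈ pinned ] ∑[ p ∈ VV ] (deg (proj₁ p) * (ℓ x p * K (c (proj₂ p) u′) (proj₂ p) (proj₂ x))))
        ≤⟨ ∑-pull pinned w (λ x → ∑-×-≤ V V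
             (λ a a′ → ≤-reflexive (shuffle (deg a) (g (proj₁ x) a) (K (c a′ u′) a′ (proj₂ x))))
             (two-step (proj₁ x)) ≤-refl) twin-total ⟩
      w * (n * k) ∎))
      where
      shuffle : ∀ p q o → p * (q * o) ≡ q * p * o
      shuffle = solve-∀
      bound : ∀ x p b → 𝟙 (bad₇? (x , (p , (b , u′)))) ≤
        g (proj₁ p) b * (ℓ x p * K (c (proj₂ p) u′) (proj₂ p) (proj₂ x))
      bound x p b = 𝟙-≤ (bad₇? (x , (p , (b , u′)))) λ (l , l′ , x≢p , _ , eq) →
        𝟙-yes (edge? (proj₁ p) b) l′ ⊗ 𝟙-yes (link? x p) l
          ⊗ 𝟙-yes (coloured? (c (proj₂ p) u′) (proj₂ p) (proj₂ x)) ((λ e → x≢p (sym e)) , trans (c-sym _ _) (sym eq))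
      twin-total : (∑[ x ∈ pinned ] ∑[ a′ ∈ V ] K (c a′ u′) a′ (proj₂ x)) ≤ n * k
      twin-total = ≤-trans (≤-reflexive (∑-swap pinned V _)) (∑-≤-const V (length-allFin n) λ a′ →
        ≤-trans (pinned-≤ (K (c a′ u′) a′)) (row _ a′))

    hits₈ : ∀ h → hits h I₈ bad₈? ev₈ ≡
      (∑[ x ∈ pinned ] ∑[ y ∈ pinned ] ∑[ p ∈ VV ] (h p * 𝟙 (bad₈? ((x , y) , p))))
    hits₈ h = trans (∑-× (cartesianProduct pinned pinned) VV _) (trans (∑-× pinned pinned _)
      (∑-cong pinned λ x → ∑-cong pinned λ y → ∑-cong VV λ p →
        trans (cong (𝟙 (bad₈? ((x , y) , p)) *_) (+-identityʳ _)) (*-comm _ (h p))))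

    F₈-dom : ∀ u → hits (hitDom u) I₈ bad₈? ev₈ ≤
      t * (t * (4 * (k * t)))
    F₈-dom u = ≤-trans (≤-reflexive (hits₈ (hitDom u))) (≤-trans
      (∑-mono-∈ pinned λ x x∈ → ∑-mono-∈ pinned λ y y∈ →
        ≤-trans (dom-eval u λ p → 𝟙 (bad₈? ((x , y) , p))) (few x y x∈ y∈))
      (∑-≤-const pinned #pinned λ x → ∑-≤-const pinned #pinned λ y → ≤-refl))
      where
      few : ∀ x y → x ∈ pinned → y ∈ pinned → (∑[ a′ ∈ V ] 𝟙 (bad₈? ((x , y) , (u , a′)))) ≤ 4 * (k * t)
      few x y x∈ y∈ = split (proj₂ x Fin.≟ proj₂ y)
        where
        split : Dec (proj₂ x ≡ proj₂ y) → (∑[ a′ ∈ V ] 𝟙 (bad₈? ((x , y) , (u , a′)))) ≤ 4 * (k * t)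
        split (yes eq) = ≤-trans (∑-mono V λ a′ → 𝟙-≤ (bad₈? ((x , y) , (u , a′))) λ (_ , _ , ne , _) → contradiction eq ne)
              (≤-trans (≤-reflexive (∑-0 V)) z≤n)
        split (no ne) = ≤-trans (∑-mono V λ a′ → 𝟙-mono (bad₈? ((x , y) , (u , a′))) (twin? (proj₂ x) (proj₂ y) a′)
              λ (_ , _ , _ , tw) → tw) (few-twins x∈ y∈ ne)

    -- Once `x` and the image `u′` are fixed, the colour is known, and at most `k` images `y` are
    -- joined to `u′` in it.
    F₈-im : ∀ u′ → hits (hitIm u′) I₈ bad₈? ev₈ ≤
      t * (Δ * k)
    F₈-im u′ = ≤-trans (≤-reflexive (hits₈ (hitIm u′))) (∑-≤-const pinned #pinned λ x → begin
      (∑[ y ∈ pinned ] ∑[ p ∈ VV ] (hitIm u′ p * 𝟙 (bad₈? ((x , y) , p))))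
        ≤⟨ ∑-mono pinned (λ y → ≤-trans (im-eval u′ λ p → 𝟙 (bad₈? ((x , y) , p))) (∑-≤ V (bound x y) (deg≤ (proj₁ x)))) ⟩
      (∑[ y ∈ pinned ] (Δ * K (c u′ (proj₂ x)) u′ (proj₂ y)))
        ≤⟨ ∑-pull pinned Δ (λ _ → ≤-refl) (≤-trans (pinned-≤ (K (c u′ (proj₂ x)) u′)) (row _ u′)) ⟩
      Δ * k ∎)
      where
      bound : ∀ x y a → 𝟙 (bad₈? ((x , y) , (a , u′))) ≤ g (proj₁ x) a * K (c u′ (proj₂ x)) u′ (proj₂ y)
      bound x y a = 𝟙-≤ (bad₈? ((x , y) , (a , u′))) λ (l , _ , _ , (_ , ≢y , eq)) →
        𝟙-yes (edge? (proj₁ x) a) l ⊗ 𝟙-yes (coloured? (c u′ (proj₂ x)) u′ (proj₂ y)) (≢y , sym eq)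

    load-dom : ∀ u → load (hitDom u) 𝓑 ≤ domainLoad n t Δ k #arcs E
    load-dom u = ≤-trans (≤-reflexive (load-𝓑 (hitDom u)))
      (+-mono-≤ (≤-trans (load-family h I₁ bad₁? ev₁ 4 λ _ → refl) (*-monoʳ-≤ (n ^ 0) (F₁-dom u)))
      (+-mono-≤ (≤-trans (load-family h I₂ bad₁? ev₂ 3 λ _ → refl) (*-monoʳ-≤ (n ^ 1) (F₂-dom u)))
      (+-mono-≤ (≤-trans (load-family h I₃ bad₁? ev₃ 2 λ _ → refl) (*-monoʳ-≤ (n ^ 2) (F₃-dom u)))
      (+-mono-≤ (≤-trans (load-family h VVVV bad₄? ev₄ 2 λ _ → refl) (*-monoʳ-≤ (n ^ 2) (F₄-dom u)))
      (+-mono-≤ (≤-trans (load-family h XV bad₄? ev₅ 1 λ _ → refl) (*-monoʳ-≤ (n ^ 3) (F₅-dom u)))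
      (+-mono-≤ (≤-trans (load-family h I₆ bad₆? ev₆ 3 λ _ → refl) (*-monoʳ-≤ (n ^ 1) (F₆-dom u)))
      (+-mono-≤ (≤-trans (load-family h I₇ bad₇? ev₇ 2 λ _ → refl) (*-monoʳ-≤ (n ^ 2) (F₇-dom u)))
        (≤-trans (load-family h I₈ bad₈? ev₈ 1 λ _ → refl) (*-monoʳ-≤ (n ^ 3) (F₈-dom u))))))))))
      where h = hitDom u

    load-im : ∀ u′ → load (hitIm u′) 𝓑 ≤ imageLoad n t Δ k #arcs m w
    load-im u′ = ≤-trans (≤-reflexive (load-𝓑 h))
      (+-mono-≤ (≤-trans (load-family h I₁ bad₁? ev₁ 4 λ _ → refl) (*-monoʳ-≤ (n ^ 0) (F₁-im u′)))
      (+-mono-≤ (≤-trans (load-family h I₂ bad₁? ev₂ 3 λ _ → refl) (*-monoʳ-≤ (n ^ 1) (F₂-im u′)))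
      (+-mono-≤ (≤-trans (load-family h I₃ bad₁? ev₃ 2 λ _ → refl) (*-monoʳ-≤ (n ^ 2) (F₃-im u′)))
      (+-mono-≤ (≤-trans (load-family h VVVV bad₄? ev₄ 2 λ _ → refl) (*-monoʳ-≤ (n ^ 2) (F₄-im u′)))
      (+-mono-≤ (≤-trans (load-family h XV bad₄? ev₅ 1 λ _ → refl) (*-monoʳ-≤ (n ^ 3) (F₅-im u′)))
      (+-mono-≤ (≤-trans (load-family h I₆ bad₆? ev₆ 3 λ _ → refl) (*-monoʳ-≤ (n ^ 1) (F₆-im u′)))
      (+-mono-≤ (≤-trans (load-family h I₇ bad₇? ev₇ 2 λ _ → refl) (*-monoʳ-≤ (n ^ 2) (F₇-im u′)))
        (≤-trans (load-family h I₈ bad₈? ev₈ 1 λ _ → refl) (*-monoʳ-≤ (n ^ 3) (F₈-im u′))))))))))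
      where h = hitIm u′

-- Bijections avoiding the bad events

module Avoidance {n : ℕ} (G : Graph n) (c : Coloring n) (c-sym : IsSymmetric c)
  (E : ℕ) (pinned : List (Fin n × Fin n)) where

  open Degrees G
  open Colours c c-sym
  open Families G c c-sym E pinned
  open Bijections pinned

  proper? : ∀ B → Dec (Valid B × 1 ≤ length B)
  proper? B = valid? B ×-dec 1 ≤? length B

  𝓟 : List Event
  𝓟 = filter proper? 𝓑

  module _ (σ : Vec (Fin n) n) (admissible : Admissible σ) (avoids : Avoid 𝓟 σ)
    (free-low : ∀ {v} → v ∉ map proj₁ pinned → deg v ≤ suc E)
    (rainbow : ∀ {p q y z} → p ∈ map proj₂ pinned → q ∈ map proj₂ pinned →
      y ∈ map proj₂ pinned → z ∈ map proj₂ pinned → p ≢ q → y ≢ z →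
      c p q ≡ c y z → (p ≡ y × q ≡ z) ⊎ (p ≡ z × q ≡ y)) where

    φ : Fin n → Fin n
    φ = lookup σ

    φ-injective : ∀ {u v} → φ u ≡ φ v → u ≡ v
    φ-injective = proj₁ admissible _ _

    at : Fin n → Place
    at v = v , φ v

    Pinned Free : Fin n → Set
    Pinned v = v ∈ map proj₁ pinned
    Free v = v ∉ map proj₁ pinned

    at-pinned : ∀ {v} → Pinned v → at v ∈ pinned
    at-pinned m with ∈-map⁻ proj₁ m
    ... | p , p∈ , refl = subst (λ e → (proj₁ p , e) ∈ pinned) (sym (All.lookup (proj₂ admissible) p∈)) p∈

    pinned-image : ∀ {v} → Pinned v → φ v ∈ map proj₂ pinned
    pinned-image m = ∈-map⁺ proj₂ (at-pinned m)

    free-image : ∀ {v} → Free v → φ v ∉ map proj₂ pinned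
    free-image free m with ∈-map⁻ proj₂ m
    ... | p , p∈ , eq = free (subst Pinned′ (φ-injective (trans (All.lookup (proj₂ admissible) p∈) (sym eq))) (∈-map⁺ proj₁ p∈))
      where
      Pinned′ : Fin n → Set
      Pinned′ v = v ∈ map proj₁ pinned

    ∈VV : ∀ p → p ∈ VV
    ∈VV p = ∈-cartesianProduct⁺ (∈-allFin (proj₁ p)) (∈-allFin (proj₂ p))

    ∈VVVV : ∀ p q → (p , q) ∈ VVVV
    ∈VVVV p q = ∈-cartesianProduct⁺ (∈VV p) (∈VV q)

    ∈XV : ∀ {x} → Pinned x → ∀ p → (at x , p) ∈ XV
    ∈XV m p = ∈-cartesianProduct⁺ (at-pinned m) (∈VV p)

    -- Placed on distinct free vertices by an injective `φ`, an event is automatically proper, and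
    -- `σ` extends it by definition of `at`.
    no-event : ∀ vs → All Free vs → Unique vs → length vs ≤ 4 → 1 ≤ length vs → ¬ map at vs ∈ 𝓑
    no-event vs free unique ≤4 1≤ m = All.lookup avoids (∈-filter⁺ proper? m (valid , len 1≤)) extends
      where
      images : ∀ {us} → All Free us → All (λ p → proj₂ p ∉ map proj₂ pinned) (map at us)
      images [] = []
      images (f ∷ fs) = free-image f ∷ images fs
      distinct : ∀ {us} → Unique us → AllPairs (λ p q → proj₁ p ≢ proj₁ q × proj₂ p ≢ proj₂ q) (map at us)
      distinct [] = []
      distinct (u≢ ∷ us) = apart u≢ ∷ distinct us
        where
        apart : ∀ {u us} → All (u ≢_) us → All (λ q → u ≢ proj₁ q × φ u ≢ proj₂ q) (map at us)
        apart [] = []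
        apart (ne ∷ nes) = (ne , λ e → ne (φ-injective e)) ∷ apart nes
      len : ∀ {l} → l ≤ length vs → l ≤ length (map at vs)
      len = subst (_ ≤_) (sym (length-map at vs))
      valid : Valid (map at vs)
      valid = images free , distinct unique , subst (_≤ 4) (sym (length-map at vs)) ≤4
      extends : σ Extends map at vs
      extends = All.tabulate λ m → extended (∈-map⁻ at m)
        where
        extended : ∀ {p} → (∃ λ v → v ∈ vs × p ≡ at v) → lookup σ (proj₁ p) ≡ proj₂ p
        extended (v , _ , refl) = refl

    Same : Fin n → Fin n → Fin n → Fin n → Set
    Same p q y z = (p ≡ y × q ≡ z) ⊎ (p ≡ z × q ≡ y)

    flipˡ : ∀ {p q y z} → Same q p y z → Same p q y z
    flipˡ (inj₁ (e , f)) = inj₂ (f , e)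
    flipˡ (inj₂ (e , f)) = inj₁ (f , e)

    flipʳ : ∀ {p q y z} → Same p q z y → Same p q y z
    flipʳ (inj₁ e) = inj₂ e
    flipʳ (inj₂ e) = inj₁ e

    exchange : ∀ {p q y z} → Same y z p q → Same p q y z
    exchange (inj₁ (e , f)) = inj₁ (sym e , sym f)
    exchange (inj₂ (e , f)) = inj₂ (sym f , sym e)

    apart : ∀ {u v} → Edge u v → φ u ≢ φ v
    apart e eq = edge-irrefl e (φ-injective eq)

    swapped : ∀ {u v α} → c (φ u) (φ v) ≡ α → c (φ v) (φ u) ≡ α
    swapped = trans (c-sym _ _)

    in₁ : ∀ {B} → B ∈ F₁ → B ∈ 𝓑
    in₁ m = ∈-++⁺ˡ m
    in₂ : ∀ {B} → B ∈ F₂ → B ∈ 𝓑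
    in₂ m = ∈-++⁺ʳ F₁ (∈-++⁺ˡ m)
    in₃ : ∀ {B} → B ∈ F₃ → B ∈ 𝓑
    in₃ m = ∈-++⁺ʳ F₁ (∈-++⁺ʳ F₂ (∈-++⁺ˡ m))
    in₄ : ∀ {B} → B ∈ F₄ → B ∈ 𝓑
    in₄ m = ∈-++⁺ʳ F₁ (∈-++⁺ʳ F₂ (∈-++⁺ʳ F₃ (∈-++⁺ˡ m)))
    in₅ : ∀ {B} → B ∈ F₅ → B ∈ 𝓑
    in₅ m = ∈-++⁺ʳ F₁ (∈-++⁺ʳ F₂ (∈-++⁺ʳ F₃ (∈-++⁺ʳ F₄ (∈-++⁺ˡ m))))
    in₆ : ∀ {B} → B ∈ F₆ → B ∈ 𝓑
    in₆ m = ∈-++⁺ʳ F₁ (∈-++⁺ʳ F₂ (∈-++⁺ʳ F₃ (∈-++⁺ʳ F₄ (∈-++⁺ʳ F₅ (∈-++⁺ˡ m)))))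
    in₇ : ∀ {B} → B ∈ F₇ → B ∈ 𝓑
    in₇ m = ∈-++⁺ʳ F₁ (∈-++⁺ʳ F₂ (∈-++⁺ʳ F₃ (∈-++⁺ʳ F₄ (∈-++⁺ʳ F₅ (∈-++⁺ʳ F₆ (∈-++⁺ˡ m))))))
    in₈ : ∀ {B} → B ∈ F₈ → B ∈ 𝓑
    in₈ m = ∈-++⁺ʳ F₁ (∈-++⁺ʳ F₂ (∈-++⁺ʳ F₃ (∈-++⁺ʳ F₄ (∈-++⁺ʳ F₅ (∈-++⁺ʳ F₆ (∈-++⁺ʳ F₇ m))))))

    taken : ∀ {u v} → Pinned u → Pinned v → Edge u v → ∀ {α} → c (φ u) (φ v) ≡ α → Taken α
    taken mu mv e eq = lose (at-pinned mu) (lose (at-pinned mv) (apart e , eq))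

    one-pinned : ∀ {u v x a} → Pinned u → Pinned v → Pinned x → Free a → Edge u v → Edge x a →
      c (φ u) (φ v) ≢ c (φ x) (φ a)
    one-pinned {a = a} mu mv mx fa e e′ eq = no-event (a ∷ []) (fa ∷ []) ([] ∷ []) (s≤s z≤n) (s≤s z≤n)
      (in₅ (∈-map⁺ ev₅ (∈-filter⁺ bad₄? (∈XV mx (at a)) (e′ , apart e′ , taken mu mv e eq))))

    none-pinned : ∀ {u v a b} → Pinned u → Pinned v → Free a → Free b → Edge u v → Edge a b →
      c (φ u) (φ v) ≢ c (φ a) (φ b)
    none-pinned {a = a} {b} mu mv fa fb e e′ eq =
      no-event (a ∷ b ∷ []) (fa ∷ fb ∷ []) ((edge-irrefl e′ ∷ []) ∷ [] ∷ []) (s≤s (s≤s z≤n)) (s≤s z≤n)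
        (in₄ (∈-map⁺ ev₄ (∈-filter⁺ bad₄? (∈VVVV (at a) (at b)) (e′ , apart e′ , taken mu mv e eq))))

    -- Different free ends fall under `F₃`, even when the two spokes share their pinned end; a
    -- common free end with different pinned ends falls under `F₈`.
    spokes : ∀ {x a y b} → Pinned x → Free a → Pinned y → Free b → Edge x a → Edge y b →
      c (φ x) (φ a) ≡ c (φ y) (φ b) → Same x a y b
    spokes {x} {a} {y} {b} mx fa my fb e e′ eq with a Fin.≟ b
    ... | no a≢b = ⊥-elim (no-event (a ∷ b ∷ []) (fa ∷ fb ∷ []) ((a≢b ∷ []) ∷ [] ∷ []) (s≤s (s≤s z≤n)) (s≤s z≤n)
      (in₃ (∈-map⁺ ev₃ (∈-filter⁺ bad₁? (∈-cartesianProduct⁺ (∈XV mx (at a)) (∈XV my (at b)))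
        (e , e′ , apart e , apart e′ , sym eq)))))
    ... | yes refl with x Fin.≟ y
    ... | yes refl = inj₁ (refl , refl)
    ... | no x≢y = ⊥-elim (no-event (a ∷ []) (fa ∷ []) ([] ∷ []) (s≤s z≤n) (s≤s z≤n)
      (in₈ (∈-map⁺ ev₈ (∈-filter⁺ bad₈?
        (∈-cartesianProduct⁺ (∈-cartesianProduct⁺ (at-pinned mx) (at-pinned my)) (∈VV (at a)))
        (e , e′ , (λ f → x≢y (φ-injective f)) , apart (edge-sym e) , apart (edge-sym e′) ,
          swapped (trans eq (c-sym _ _)))))))

    spoke-path : ∀ {x a b} → Pinned x → Free a → Free b → Edge x a → Edge a b →
      c (φ x) (φ a) ≢ c (φ a) (φ b)
    spoke-path {x} {a} {b} mx fa fb e e′ eq =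
      no-event (a ∷ b ∷ []) (fa ∷ fb ∷ []) ((edge-irrefl e′ ∷ []) ∷ [] ∷ []) (s≤s (s≤s z≤n)) (s≤s z≤n)
        (in₇ (∈-map⁺ ev₇ (∈-filter⁺ bad₇? (∈-cartesianProduct⁺ (at-pinned mx) (∈VVVV (at a) (at b)))
          (e , e′ , apart e , apart e′ , sym eq))))

    spoke-free : ∀ {x a b d} → Pinned x → Free a → Free b → Free d → Edge x a → Edge b d →
      c (φ x) (φ a) ≢ c (φ b) (φ d)
    spoke-free {x} {a} {b} {d} mx fa fb fd e e′ eq with a Fin.≟ b | a Fin.≟ d
    ... | yes refl | _ = spoke-path mx fa fd e e′ eq
    ... | no _ | yes refl = spoke-path mx fa fb e (edge-sym e′) (trans eq (c-sym _ _))
    ... | no a≢b | no a≢d = no-event (a ∷ b ∷ d ∷ []) (fa ∷ fb ∷ fd ∷ [])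
      ((a≢b ∷ a≢d ∷ []) ∷ (edge-irrefl e′ ∷ []) ∷ [] ∷ []) (s≤s (s≤s (s≤s z≤n))) (s≤s z≤n)
      (in₂ (∈-map⁺ ev₂ (∈-filter⁺ bad₁? (∈-cartesianProduct⁺ (∈XV mx (at a)) (∈VVVV (at b) (at d)))
        (e , e′ , apart e , apart e′ , sym eq))))

    free-path : ∀ {b a d} → Free b → Free a → Free d → Edge b a → Edge b d →
      c (φ b) (φ a) ≡ c (φ b) (φ d) → a ≡ d
    free-path {b} {a} {d} fb fa fd e e′ eq with a Fin.≟ d
    ... | yes a≡d = a≡d
    ... | no a≢d = ⊥-elim (no-event (b ∷ a ∷ d ∷ []) (fb ∷ fa ∷ fd ∷ [])
      ((edge-irrefl e ∷ edge-irrefl e′ ∷ []) ∷ (a≢d ∷ []) ∷ [] ∷ []) (s≤s (s≤s (s≤s z≤n))) (s≤s z≤n)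
      (in₆ (∈-map⁺ ev₆ (∈-filter⁺ bad₆? (∈-cartesianProduct⁺ (∈VV (at b)) (∈VVVV (at a) (at d)))
        (a≢d , (free-low fa , free-low fb , free-low fd) , e , e′ , apart e , apart e′ , sym eq)))))

    -- Two edges sharing a vertex form a cherry, treated by `free-path` after turning both so that
    -- they start at the shared vertex; disjoint ones fall under `F₁`.
    free-free : ∀ {a b d f} → Free a → Free b → Free d → Free f → Edge a b → Edge d f →
      c (φ a) (φ b) ≡ c (φ d) (φ f) → Same a b d f
    free-free {a} {b} {d} {f} fa fb fd ff e e′ eq with a Fin.≟ d | a Fin.≟ f | b Fin.≟ d | b Fin.≟ f
    ... | yes refl | _ | _ | _ = inj₁ (refl , free-path fa fb ff e e′ eq)
    ... | no _ | yes refl | _ | _ = inj₂ (refl , free-path fa fb fd e (edge-sym e′) (trans eq (c-sym _ _)))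
    ... | no _ | no _ | yes refl | _ = inj₂ (free-path fb fa ff (edge-sym e) e′ (swapped eq) , refl)
    ... | no _ | no _ | no _ | yes refl =
      inj₁ (free-path fb fa fd (edge-sym e) (edge-sym e′) (swapped (trans eq (c-sym _ _))) , refl)
    ... | no a≢d | no a≢f | no b≢d | no b≢f = ⊥-elim (no-event (a ∷ b ∷ d ∷ f ∷ []) (fa ∷ fb ∷ fd ∷ ff ∷ [])
      ((edge-irrefl e ∷ a≢d ∷ a≢f ∷ []) ∷ (b≢d ∷ b≢f ∷ []) ∷ (edge-irrefl e′ ∷ []) ∷ [] ∷ [])
      (s≤s (s≤s (s≤s (s≤s z≤n)))) (s≤s z≤n)
      (in₁ (∈-map⁺ ev₁ (∈-filter⁺ bad₁? (∈-cartesianProduct⁺ (∈VVVV (at a) (at b)) (∈VVVV (at d) (at f)))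
        (e , e′ , apart e , apart e′ , sym eq)))))

    pinned-pinned : ∀ {p q y z} → Pinned p → Pinned q → Pinned y → Pinned z → Edge p q → Edge y z →
      c (φ p) (φ q) ≡ c (φ y) (φ z) → Same p q y z
    pinned-pinned mp mq my mz e e′ eq
      with rainbow (pinned-image mp) (pinned-image mq) (pinned-image my) (pinned-image mz) (apart e) (apart e′) eq
    ... | inj₁ (f , f′) = inj₁ (φ-injective f , φ-injective f′)
    ... | inj₂ (f , f′) = inj₂ (φ-injective f , φ-injective f′)

    data Kind (u v : Fin n) : Set where
      both  : Pinned u → Pinned v → Kind u v
      left  : Pinned u → Free v → Kind u v
      right : Free u → Pinned v → Kind u v
      none  : Free u → Free v → Kind u v

    kind : ∀ u v → Kind u v
    kind u v with u ∈? map proj₁ pinned | v ∈? map proj₁ pinned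
    ... | yes mu | yes mv = both mu mv
    ... | yes mu | no fv = left mu fv
    ... | no fu | yes mv = right fu mv
    ... | no fu | no fv = none fu fv

    monochromatic : ∀ {u v x y} → Edge u v → Edge x y → c (φ u) (φ v) ≡ c (φ x) (φ y) → Same u v x y
    monochromatic {u} {v} {x} {y} e e′ eq = cases (kind u v) (kind x y)
      where
      eqʳ : c (φ u) (φ v) ≡ c (φ y) (φ x)
      eqʳ = trans eq (c-sym _ _)
      cases : Kind u v → Kind x y → Same u v x y
      cases (both mu mv) (both mx my) = pinned-pinned mu mv mx my e e′ eq
      cases (both mu mv) (left mx fy) = ⊥-elim (one-pinned mu mv mx fy e e′ eq)
      cases (both mu mv) (right fx my) = ⊥-elim (one-pinned mu mv my fx e (edge-sym e′) eqʳ)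
      cases (both mu mv) (none fx fy) = ⊥-elim (none-pinned mu mv fx fy e e′ eq)
      cases (left mu fv) (both mx my) = ⊥-elim (one-pinned mx my mu fv e′ e (sym eq))
      cases (left mu fv) (left mx fy) = spokes mu fv mx fy e e′ eq
      cases (left mu fv) (right fx my) = flipʳ (spokes mu fv my fx e (edge-sym e′) eqʳ)
      cases (left mu fv) (none fx fy) = ⊥-elim (spoke-free mu fv fx fy e e′ eq)
      cases (right fu mv) (both mx my) = ⊥-elim (one-pinned mx my mv fu e′ (edge-sym e) (sym (swapped eq)))
      cases (right fu mv) (left mx fy) = flipˡ (spokes mv fu mx fy (edge-sym e) e′ (swapped eq))
      cases (right fu mv) (right fx my) = flipˡ (flipʳ (spokes mv fu my fx (edge-sym e) (edge-sym e′) (swapped eqʳ)))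
      cases (right fu mv) (none fx fy) = ⊥-elim (spoke-free mv fu fx fy (edge-sym e) e′ (swapped eq))
      cases (none fu fv) (both mx my) = ⊥-elim (none-pinned mx my fu fv e′ e (sym eq))
      cases (none fu fv) (left mx fy) = ⊥-elim (spoke-free mx fy fu fv e′ e (sym eq))
      cases (none fu fv) (right fx my) = ⊥-elim (spoke-free my fx fu fv (edge-sym e′) e (sym eqʳ))
      cases (none fu fv) (none fx fy) = free-free fu fv fx fy e e′ eq

    φ-rainbow : Rainbow G c
    φ-rainbow = φ , φ-injective , λ u v x y e e′ u<v x<y eq → ordered u<v x<y (monochromatic e e′ eq)
      where
      ordered : ∀ {u v x y} → u Fin.< v → x Fin.< y → Same u v x y → u ≡ x × v ≡ y
      ordered u<v x<y (inj₁ eqs) = eqs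
      ordered u<v x<y (inj₂ (refl , refl)) = contradiction x<y (Fin.<-asym u<v)

-- Arithmetic

last-true : ∀ {p} (P : ℕ → Set p) → (∀ i → Dec (P i)) → P 0 → ∀ N → ¬ P N → ∃ λ i → P i × ¬ P (suc i)
last-true P P? base zero ¬PN = contradiction base ¬PN
last-true P P? base (suc N) ¬PN with P? N
... | yes PN = N , PN , ¬PN
... | no ¬P = last-true P P? base N ¬P

floor : ∀ d .{{_ : NonZero d}} y → ∃ λ q → d * q ≤ y × (∀ x → d * x ≤ y → x ≤ q)
floor d y = y / d , ≤-trans (≤-reflexive (*-comm d (y / d))) (m/n*n≤m y d) ,
  λ x le → ≤-trans (≤-reflexive (sym (m*n/n≡m x d))) (/-monoˡ-≤ d (≤-trans (≤-reflexive (*-comm x d)) le))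

fourth : ℕ → ℕ
fourth x = x * x * (x * x)

fourth-mono : ∀ {x y} → x ≤ y → fourth x ≤ fourth y
fourth-mono le = *-mono-≤ (*-mono-≤ le le) (*-mono-≤ le le)

fourth-cancel : ∀ {x y} → fourth x ≤ fourth y → x ≤ y
fourth-cancel {x} {y} le with x ≤? y
... | yes x≤y = x≤y
... | no x≰y = contradiction le (<⇒≱ (*-mono-< sq sq))
  where sq = *-mono-< (≰⇒> x≰y) (≰⇒> x≰y)

fourth-* : ∀ x y → fourth (x * y) ≡ fourth x * fourth y
fourth-* x y = expanded x y
  where
  expanded : ∀ x y → x * y * (x * y) * (x * y * (x * y)) ≡ x * x * (x * x) * (y * y * (y * y))
  expanded = solve-∀

^4≡fourth : ∀ x → x ^ 4 ≡ fourth x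
^4≡fourth x = expanded x
  where
  expanded : ∀ x → x * (x * (x * (x * 1))) ≡ x * x * (x * x)
  expanded = solve-∀

fourth-cube : ∀ x → fourth (x * x * x) ≡ fourth x * fourth x * fourth x
fourth-cube x = trans (fourth-* (x * x) x) (cong (_* fourth x) (fourth-* x x))

fourth-root : ∀ R → 1 ≤ R → ∃ λ p → fourth p < R × R ≤ fourth (suc p)
fourth-root R R≥1 with last-true (λ p → fourth p < R) (λ p → fourth p <? R) R≥1 R
  (λ lt → <⇒≱ lt (≤-trans (≤-reflexive (sym (*-identityʳ R)))
    (*-mono-≤ (≤-trans (≤-reflexive (sym (*-identityʳ R))) (*-monoʳ-≤ R R≥1)) (R≥1 ⊗ R≥1))))
... | p , lt , ¬lt = p , lt , ≮⇒≥ ¬lt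

-- Rounding the root up costs at most the factor (L + 1) / L: this bounds (p + 1) / p when `L ≤ p`,
-- and for smaller `p` already `suc p ≤ L` suffices because `r ≥ 1`.
fourth-root-upper : ∀ L .{{_ : NonZero L}} r p → 1 ≤ r → fourth p < fourth L * r → fourth (suc p) ≤ fourth (suc L) * r
fourth-root-upper L r p r≥1 lt with L ≤? p
... | no L≰p = begin
  fourth (suc p)          ≤⟨ fourth-mono {suc p} {suc L} (≤-trans (≰⇒> L≰p) (n≤1+n L)) ⟩
  fourth (suc L)          ≡⟨ *-identityʳ _ ⟨
  fourth (suc L) * 1      ≤⟨ *-monoʳ-≤ (fourth (suc L)) r≥1 ⟩
  fourth (suc L) * r      ∎
  where open ≤-Reasoning
... | yes L≤p = *-cancelˡ-≤ (fourth L) {{>-nonZero (pos ⊗ pos)}} (begin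
  fourth L * fourth (suc p)             ≡⟨ fourth-* L (suc p) ⟨
  fourth (L * suc p)                    ≤⟨ fourth-mono {L * suc p} {suc L * p} step ⟩
  fourth (suc L * p)                    ≡⟨ fourth-* (suc L) p ⟩
  fourth (suc L) * fourth p             ≤⟨ *-monoʳ-≤ (fourth (suc L)) (<⇒≤ lt) ⟩
  fourth (suc L) * (fourth L * r)       ≡⟨ shuffle (fourth (suc L)) (fourth L) r ⟩
  fourth L * (fourth (suc L) * r)       ∎)
  where
  open ≤-Reasoning
  L≥1 : 1 ≤ L
  L≥1 = n≢0⇒n>0 (≢-nonZero⁻¹ L)
  pos : 1 ≤ L * L
  pos = L≥1 ⊗ L≥1
  shuffle : ∀ x y z → x * (y * z) ≡ y * (x * z)
  shuffle = solve-∀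
  step : L * suc p ≤ suc L * p
  step = ≤-trans (≤-reflexive (*-suc L p)) (+-monoˡ-≤ (L * p) L≤p)

-- The product of y r^{3/4} ≤ n and s³ ≤ B³ r^{3/4}, carried out on fourth powers to stay in ℕ.
root-free-bound : ∀ y s B r n → y ^ 4 * r ^ 3 ≤ n ^ 4 → fourth s ≤ fourth B * r →
  y * (s * s * s) ≤ B * B * B * n
root-free-bound y s B r n h h′ = fourth-cancel (begin
  fourth (y * (s * s * s))
    ≡⟨ trans (fourth-* y (s * s * s)) (cong (fourth y *_) (fourth-cube s)) ⟩
  fourth y * (fourth s * fourth s * fourth s)
    ≤⟨ *-monoʳ-≤ (fourth y) (*-mono-≤ (*-mono-≤ h′ h′) h′) ⟩
  fourth y * (fourth B * r * (fourth B * r) * (fourth B * r))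
    ≡⟨ mid (fourth y) (fourth B) r ⟩
  fourth B * fourth B * fourth B * (fourth y * r ^ 3)
    ≡⟨ cong (λ z → fourth B * fourth B * fourth B * (z * r ^ 3)) (^4≡fourth y) ⟨
  fourth B * fourth B * fourth B * (y ^ 4 * r ^ 3)
    ≤⟨ *-monoʳ-≤ (fourth B * fourth B * fourth B) h ⟩
  fourth B * fourth B * fourth B * n ^ 4
    ≡⟨ cong₂ _*_ (sym (fourth-cube B)) (^4≡fourth n) ⟩
  fourth (B * B * B) * fourth n
    ≡⟨ fourth-* (B * B * B) n ⟨
  fourth (B * B * B * n) ∎)
  where
  open ≤-Reasoning
  mid : ∀ y B r → y * (B * r * (B * r) * (B * r)) ≡ B * B * B * (y * (r * (r * (r * 1))))
  mid = solve-∀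

-- Chains x ≤ (a / L) y with y ≤ (L / C) n. In most uses y is `s * s * s * k` and the second
-- inequality is `key`.
scale : ∀ {C L a y n} x .{{_ : NonZero L}} → C * y ≤ L * n → L * x ≤ a * y → C * x ≤ a * n
scale {C} {L} {a} {y} {n} x key le = *-cancelˡ-≤ L (begin
  L * (C * x)      ≡⟨ shuffle L C x ⟩
  C * (L * x)      ≤⟨ *-monoʳ-≤ C le ⟩
  C * (a * y)      ≡⟨ shuffle C a y ⟩
  a * (C * y)      ≤⟨ *-monoʳ-≤ a key ⟩
  a * (L * n)      ≡⟨ shuffle a L n ⟩
  L * (a * n)      ∎)
  where
  open ≤-Reasoning
  shuffle : ∀ x y z → x * (y * z) ≡ y * (x * z)
  shuffle = solve-∀

arcs-squared : ∀ C L D A s n k .{{_ : NonZero (L * L * L)}} → C * (L * A) ≤ D * (s * n) → L ≤ s →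
  C * (s * s * s * k) ≤ L * L * L * n → C * C * C * (A * (A * k)) ≤ D * D * (n * (n * n))
arcs-squared C L D A s n k arcs L≤s key = begin
  C * C * C * (A * (A * k))         ≡⟨ shuffle₁ C (A * (A * k)) ⟩
  C * (C * (C * (A * (A * k))))     ≤⟨ scale {C} {L * L * L} {D * D * (n * n)} {s * s * s * k} {n}
                                         (C * (C * (A * (A * k)))) key product ⟩
  D * D * (n * n) * n               ≡⟨ shuffle₂ D n ⟩
  D * D * (n * (n * n))             ∎
  where
  open ≤-Reasoning
  shuffle₁ : ∀ C x → C * C * C * x ≡ C * (C * (C * x))
  shuffle₁ = solve-∀
  shuffle₂ : ∀ D n → D * D * (n * n) * n ≡ D * D * (n * (n * n))
  shuffle₂ = solve-∀
  shuffle₃ : ∀ L C A k → L * L * L * (C * (C * (A * (A * k)))) ≡ C * (L * A) * (C * (L * A)) * (L * k)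
  shuffle₃ = solve-∀
  shuffle₄ : ∀ D s n k → D * (s * n) * (D * (s * n)) * (s * k) ≡ D * D * (n * n) * (s * s * s * k)
  shuffle₄ = solve-∀
  product : L * L * L * (C * (C * (A * (A * k)))) ≤ D * D * (n * n) * (s * s * s * k)
  product = begin
    L * L * L * (C * (C * (A * (A * k))))         ≡⟨ shuffle₃ L C A k ⟩
    -- Two factors `A` supply only s²; the missing third `s` for `key` comes from `L ≤ s`.
    C * (L * A) * (C * (L * A)) * (L * k)         ≤⟨ *-mono-≤ (*-mono-≤ arcs arcs) (*-monoˡ-≤ k L≤s) ⟩
    D * (s * n) * (D * (s * n)) * (s * k)         ≡⟨ shuffle₄ D s n k ⟩
    D * D * (n * n) * (s * s * s * k)             ∎

shrink : ∀ N x y {z} → x ≤ y → N * y ≤ z → N * x ≤ z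
shrink N x y le h = ≤-trans (*-monoʳ-≤ N le) h

coarsen : ∀ {p q} x {y} c d .{{_ : NonZero p}} → p * x ≤ q * y → c * q ≤ p * d → c * x ≤ d * y
coarsen {p} {q} x {y} c d h le = *-cancelˡ-≤ p (begin
  p * (c * x)      ≡⟨ shuffle p c x ⟩
  c * (p * x)      ≤⟨ *-monoʳ-≤ c h ⟩
  c * (q * y)      ≡⟨ *-assoc c q y ⟨
  c * q * y        ≤⟨ *-monoˡ-≤ y le ⟩
  p * d * y        ≡⟨ *-assoc p d y ⟩
  p * (d * y)      ∎)
  where
  open ≤-Reasoning
  shuffle : ∀ x y z → x * (y * z) ≡ y * (x * z)
  shuffle = solve-∀

-- If h d > z, then 4 r < d², and doubling d² ≤ d + 2 r gives d² < 2 d. So d ≤ 1, and `2 * h ≤ z`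
-- contradicts the assumption.
degree-≤ : ∀ d h r z → d * d ≤ d + 2 * r → 4 * (h * h) * r ≤ z * z → 2 * h ≤ z → 1 ≤ h → h * d ≤ z
degree-≤ d h r z sq small 2h≤z h≥1 with h * d ≤? z
... | yes le = le
... | no ¬le = contradiction (≤-trans (*-monoʳ-≤ h d≤1) (≤-trans (≤-reflexive (*-comm h 1))
                 (≤-trans (*-monoˡ-≤ h (≤ᵇ⇒≤ 1 2 _)) 2h≤z))) ¬le
  where
  open ≤-Reasoning
  4r<dd : 4 * r < d * d
  4r<dd = *-cancelˡ-< (h * h) (4 * r) (d * d) (begin-strict
    h * h * (4 * r)      ≡⟨ shuffle (h * h) r ⟩
    4 * (h * h) * r      ≤⟨ small ⟩
    z * z                <⟨ *-mono-< (≰⇒> ¬le) (≰⇒> ¬le) ⟩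
    h * d * (h * d)      ≡⟨ square h d ⟩
    h * h * (d * d)      ∎)
    where
    shuffle : ∀ x y → x * (4 * y) ≡ 4 * x * y
    shuffle = solve-∀
    square : ∀ x y → x * y * (x * y) ≡ x * x * (y * y)
    square = solve-∀
  dd<2d : d * d < d * 2
  dd<2d = +-cancelʳ-< (d * d) (d * d) (d * 2) (begin-strict
    d * d + d * d            ≤⟨ +-mono-≤ sq sq ⟩
    d + 2 * r + (d + 2 * r)  ≡⟨ collect d r ⟩
    d * 2 + 4 * r            <⟨ +-monoʳ-< (d * 2) 4r<dd ⟩
    d * 2 + d * d            ∎)
    where
    collect : ∀ d r → d + 2 * r + (d + 2 * r) ≡ d * 2 + 4 * r
    collect = solve-∀
  d≤1 : d ≤ 1
  d≤1 = ≤-pred (*-cancelˡ-< d d 2 dd<2d)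

*-AM-GM : ∀ x y → x * y ≤ x * x + y * y
*-AM-GM x y with ≤-total x y
... | inj₁ x≤y = ≤-trans (*-monoˡ-≤ y x≤y) (m≤n+m (y * y) (x * x))
... | inj₂ y≤x = ≤-trans (*-monoʳ-≤ x y≤x) (m≤m+n (x * x) (y * y))

-- Here N = 27400 is 20 · 1370, so a product of size a ρ³ k has coefficient 20 a. The values 41 and
-- 21 instead of 40 and 20 absorb the small excess of the number of arcs over ρ n.
module LoadBounds (N n T Δ k A m e w : ℕ)
  (h₁ : N * (T * (T * (T * k))) ≤ 20 * n) (h₂ : N * (T * (Δ * k)) ≤ 40 * n)
  (h₃ : N * (suc e * (e * k)) ≤ 40 * n) (h₄ : N * (w * k) ≤ 120 * n)
  (h₅ : N * (A * (Δ * k)) ≤ 41 * (n * n)) (h₆ : N * (A * (T * k)) ≤ 21 * (n * n))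
  (h₇ : N * (A * (T * (T * k))) ≤ 21 * (n * n)) (h₈ : N * (A * (A * k)) ≤ 21 * (n * (n * n)))
  (h₉ : N * (T * Δ) ≤ 40 * n) (h₁₀ : 8 * Δ ≤ n) (h₁₁ : 8 * T ≤ n) (h₁₂ : N * (m * k) ≤ 6 * (n * n)) where

  private
    Q : ℕ
    Q = n * n * (n * n)

    infixr 5 _⊕_
    infix 4 _≲_

    -- A record rather than a plain inequality, so that `x` and `a` can be inferred when the
    -- summands are combined by `_⊕_`.
    record _≲_ (x a : ℕ) : Set where
      constructor ⟨_⟩
      field bound : N * x ≤ a * Q

    open _≲_

    _⊕_ : ∀ {x y a b} → x ≲ a → y ≲ b → x + y ≲ a + b
    _⊕_ {x} {y} {a} {b} ⟨ p ⟩ ⟨ q ⟩ = ⟨ ≤-trans (≤-reflexive (*-distribˡ-+ N x y))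
      (≤-trans (+-mono-≤ p q) (≤-reflexive (sym (*-distribʳ-+ Q a b)))) ⟩

    cap : ∀ {x b a} j q → x ≡ q * b → N * b ≤ a → q * a ≤ j * Q → x ≲ j
    cap {x} {b} {a} j q eq h le = ⟨ ≤-trans (≤-reflexive (trans (cong (N *_) eq) (shuffle N q b)))
      (≤-trans (*-monoʳ-≤ q h) le) ⟩
      where
      shuffle : ∀ p q o → p * (q * o) ≡ q * (p * o)
      shuffle = solve-∀

    ≲-resp : ∀ {x y a} → x ≡ y → y ≲ a → x ≲ a
    ≲-resp refl h = h

    -- Absorbs a lower-order factor `z`, either `T` or `Δ`, into a power of `n` at the price 1/8.
    slack : ∀ z {x} j → x ≡ j * (n * (n * n)) * (8 * z) → 8 * z ≤ n → x ≤ j * Q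
    slack z j refl h = ≤-trans (*-monoʳ-≤ (j * (n * (n * n))) h) (≤-reflexive (shuffle j n))
      where
      shuffle : ∀ j n → j * (n * (n * n)) * n ≡ j * (n * n * (n * n))
      shuffle = solve-∀

  domain-total : N * domainLoad n T Δ k A e ≤ 870 * Q
  domain-total = bound (
    cap 328 (8 * (n * n)) (e₁ n Δ A k) h₅ (≤-reflexive (f₁ n))
    ⊕ ≲-resp (e₂ n T A Δ k)
        (cap 42 (2 * (n * n)) refl h₆ (≤-reflexive (f₂ n))
          ⊕ cap 20 (4 * (n * n) * Δ) refl h₂ (slack Δ 20 (f₃ n Δ) h₁₀))
    ⊕ cap 160 (4 * (n * (n * n))) (e₃ n T Δ k) h₂ (≤-reflexive (f₄ n))
    ⊕ cap 20 (4 * (n * n) * T) (e₄ n T Δ k) h₂ (slack T 20 (f₃ n T) h₁₁)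
    ⊕ cap 20 (n * (n * n)) (e₅ n T k) h₁ (≤-reflexive (f₅ n))
    ⊕ cap 120 (3 * (n * (n * n))) (e₆ n e (suc e) k) h₃ (≤-reflexive (f₆ n))
    ⊕ cap 80 (2 * (n * (n * n))) (e₇ n T Δ k) h₂ (≤-reflexive (f₇ n))
    ⊕ cap 80 (4 * (n * (n * n))) (e₈ n T k) h₁ (≤-reflexive (f₈ n)))
    where
    e₁ : ∀ n Δ A k → 1 * (4 * (n * (Δ * n * (A * (2 * k))))) ≡ 8 * (n * n) * (A * (Δ * k))
    e₁ = solve-∀
    f₁ : ∀ n → 8 * (n * n) * (41 * (n * n)) ≡ 328 * (n * n * (n * n))
    f₁ = solve-∀
    e₂ : ∀ n T A Δ k → (n * 1) * (T * (n * (A * (2 * k))) + 2 * (T * (Δ * n * (Δ * (2 * k)))))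
      ≡ 2 * (n * n) * (A * (T * k)) + 4 * (n * n) * Δ * (T * (Δ * k))
    e₂ = solve-∀
    f₂ : ∀ n → 2 * (n * n) * (21 * (n * n)) ≡ 42 * (n * n * (n * n))
    f₂ = solve-∀
    f₃ : ∀ n z → 4 * (n * n) * z * (40 * n) ≡ 20 * (n * (n * n)) * (8 * z)
    f₃ = solve-∀
    e₃ : ∀ n T Δ k → (n * (n * 1)) * (2 * (T * (n * (Δ * (2 * k))))) ≡ 4 * (n * (n * n)) * (T * (Δ * k))
    e₃ = solve-∀
    f₄ : ∀ n → 4 * (n * (n * n)) * (40 * n) ≡ 160 * (n * n * (n * n))
    f₄ = solve-∀
    e₄ : ∀ n T Δ k → (n * (n * 1)) * (2 * (Δ * (T * (T * (2 * k))))) ≡ 4 * (n * n) * T * (T * (Δ * k))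
    e₄ = solve-∀
    e₅ : ∀ n T k → (n * (n * (n * 1))) * (T * (T * (T * k))) ≡ n * (n * n) * (T * (T * (T * k)))
    e₅ = solve-∀
    f₅ : ∀ n → n * (n * n) * (20 * n) ≡ 20 * (n * n * (n * n))
    f₅ = solve-∀
    e₆ : ∀ n e e′ k → (n * 1) * (n * (e′ * n * (e * k)) + 2 * (n * (e′ * n * (e * k))))
      ≡ 3 * (n * (n * n)) * (e′ * (e * k))
    e₆ = solve-∀
    f₆ : ∀ n → 3 * (n * (n * n)) * (40 * n) ≡ 120 * (n * n * (n * n))
    f₆ = solve-∀
    e₇ : ∀ n T Δ k → (n * (n * 1)) * (T * (n * (Δ * k)) + T * (Δ * n * k)) ≡ 2 * (n * (n * n)) * (T * (Δ * k))
    e₇ = solve-∀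
    f₇ : ∀ n → 2 * (n * (n * n)) * (40 * n) ≡ 80 * (n * n * (n * n))
    f₇ = solve-∀
    e₈ : ∀ n T k → (n * (n * (n * 1))) * (T * (T * (4 * (k * T)))) ≡ 4 * (n * (n * n)) * (T * (T * (T * k)))
    e₈ = solve-∀
    f₈ : ∀ n → 4 * (n * (n * n)) * (20 * n) ≡ 80 * (n * n * (n * n))
    f₈ = solve-∀

  image-total : N * imageLoad n T Δ k A m w ≤ 628 * Q
  image-total = bound (
    cap 168 (8 * n) (e₁ n A k) h₈ (≤-reflexive (f₁ n))
    ⊕ ≲-resp (e₂ n T A Δ k)
        (cap 11 (2 * n * T) refl h₅
            -- The coefficient 82 is raised to 88 = 8 · 11 so that `slack` applies.
            (≤-trans (≤-trans (≤-reflexive (f₂ n T)) (*-monoˡ-≤ (n * (n * n) * T) (≤ᵇ⇒≤ 82 88 _))) (slack T 11 (f₂′ n T) h₁₁))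
          ⊕ cap 164 (4 * (n * n)) refl h₅ (≤-reflexive (f₃ n)))
    ⊕ cap 20 (4 * (n * n) * Δ) (e₃ n T Δ k) h₂ (slack Δ 20 (f₄ n Δ) h₁₀)
    ⊕ cap 42 (2 * (n * n)) (e₄ n A T k) h₇ (≤-reflexive (f₅ n))
    ⊕ cap 40 (n * (n * n)) (e₅ n T Δ) h₉ (≤-reflexive (f₆ n))
    ⊕ cap 18 (3 * (n * n)) (e₆ n m k) h₁₂ (≤-reflexive (f₇ n))
    ⊕ ≲-resp (e₇ n T Δ w k)
        (cap 5 (n * n * Δ) refl h₂ (slack Δ 5 (f₈ n Δ) h₁₀)
          ⊕ cap 120 (n * (n * n)) refl h₄ (≤-reflexive (f₉ n)))
    ⊕ cap 40 (n * (n * n)) (e₈ n T Δ k) h₂ (≤-reflexive (f₆ n)))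
    where
    e₁ : ∀ n A k → 1 * (4 * (A * (n * (A * (2 * k))))) ≡ 8 * n * (A * (A * k))
    e₁ = solve-∀
    f₁ : ∀ n → 8 * n * (21 * (n * (n * n))) ≡ 168 * (n * n * (n * n))
    f₁ = solve-∀
    e₂ : ∀ n T A Δ k → (n * 1) * (T * (Δ * (A * (2 * k))) + 2 * (A * (n * (Δ * (2 * k)))))
      ≡ 2 * n * T * (A * (Δ * k)) + 4 * (n * n) * (A * (Δ * k))
    e₂ = solve-∀
    f₂ : ∀ n T → 2 * n * T * (41 * (n * n)) ≡ 82 * (n * (n * n) * T)
    f₂ = solve-∀
    f₂′ : ∀ n T → 88 * (n * (n * n) * T) ≡ 11 * (n * (n * n)) * (8 * T)
    f₂′ = solve-∀
    f₃ : ∀ n → 4 * (n * n) * (41 * (n * n)) ≡ 164 * (n * n * (n * n))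
    f₃ = solve-∀
    e₃ : ∀ n T Δ k → (n * (n * 1)) * (2 * (T * (Δ * (Δ * (2 * k))))) ≡ 4 * (n * n) * Δ * (T * (Δ * k))
    e₃ = solve-∀
    f₄ : ∀ n z → 4 * (n * n) * z * (40 * n) ≡ 20 * (n * (n * n)) * (8 * z)
    f₄ = solve-∀
    e₄ : ∀ n A T k → (n * (n * 1)) * (2 * (A * (T * (T * k)))) ≡ 2 * (n * n) * (A * (T * (T * k)))
    e₄ = solve-∀
    f₅ : ∀ n → 2 * (n * n) * (21 * (n * n)) ≡ 42 * (n * n * (n * n))
    f₅ = solve-∀
    e₅ : ∀ n T Δ → (n * (n * (n * 1))) * (T * (Δ * 1)) ≡ n * (n * n) * (T * Δ)
    e₅ = solve-∀
    f₆ : ∀ n → n * (n * n) * (40 * n) ≡ 40 * (n * n * (n * n))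
    f₆ = solve-∀
    e₆ : ∀ n m k → (n * 1) * (m * n * k + 2 * (m * n * k)) ≡ 3 * (n * n) * (m * k)
    e₆ = solve-∀
    f₇ : ∀ n → 3 * (n * n) * (6 * (n * n)) ≡ 18 * (n * n * (n * n))
    f₇ = solve-∀
    e₇ : ∀ n T Δ w k → (n * (n * 1)) * (T * (Δ * (Δ * k)) + w * (n * k))
      ≡ n * n * Δ * (T * (Δ * k)) + n * (n * n) * (w * k)
    e₇ = solve-∀
    f₈ : ∀ n z → n * n * z * (40 * n) ≡ 5 * (n * (n * n)) * (8 * z)
    f₈ = solve-∀
    f₉ : ∀ n → n * (n * n) * (120 * n) ≡ 120 * (n * n * (n * n))
    f₉ = solve-∀
    e₈ : ∀ n T Δ k → (n * (n * (n * 1))) * (T * (Δ * k)) ≡ n * (n * n) * (T * (Δ * k))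
    e₈ = solve-∀

final-≤ : ∀ N a b p q x n M .{{_ : NonZero (N * fourth p)}} → N * x ≤ a * fourth n → p * n ≤ q * M →
  b * a * fourth q ≤ N * fourth p → b * x ≤ fourth M
final-≤ N a b p q x n M h h′ num = *-cancelˡ-≤ (N * fourth p) (begin
  N * fourth p * (b * x)               ≡⟨ shuffle₁ N (fourth p) b x ⟩
  fourth p * (b * (N * x))             ≤⟨ *-monoʳ-≤ (fourth p) (*-monoʳ-≤ b h) ⟩
  fourth p * (b * (a * fourth n))      ≡⟨ shuffle₂ (fourth p) b a (fourth n) ⟩
  b * a * (fourth p * fourth n)        ≡⟨ cong (b * a *_) (fourth-* p n) ⟨
  b * a * fourth (p * n)               ≤⟨ *-monoʳ-≤ (b * a) (fourth-mono {p * n} {q * M} h′) ⟩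
  b * a * fourth (q * M)               ≡⟨ cong (b * a *_) (fourth-* q M) ⟩
  b * a * (fourth q * fourth M)        ≡⟨ *-assoc (b * a) _ _ ⟨
  b * a * fourth q * fourth M          ≤⟨ *-monoˡ-≤ (fourth M) num ⟩
  N * fourth p * fourth M              ∎)
  where
  open ≤-Reasoning
  shuffle₁ : ∀ N p b x → N * p * (b * x) ≡ p * (b * (N * x))
  shuffle₁ = solve-∀
  shuffle₂ : ∀ p b a n → p * (b * (a * n)) ≡ b * a * (p * n)
  shuffle₂ = solve-∀

-- Choice of the parameters

-- For L = 32 and h = L² / 2, s is L r^{1/4} rounded up. The vertices of degree at least E + 2 are pinned,
-- t = ⌊s / L⌋ bounds their number, Δ ≈ 2 (s / L)² all degrees, and w ≈ 6 (s / L)³ the number of walks of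
-- length two from a vertex. In key, C = 1370 is what rounding leaves of 1512: C (L + 1)³ ≤ 1512 L³.
record Parameters (C L h : ℕ) {n : ℕ} (r : ℕ) (G : Graph n) (c : Coloring n) (s k t Δ E w : ℕ) : Set where
  field
    few-cherries : cherries G ≤ r
    bounded      : ∀ α → colorCount c α ≤ k
    k≥1          : 1 ≤ k
    s≥L          : L ≤ s
    s-root       : L * L * (L * L) * r ≤ s * s * (s * s)
    key          : C * (s * s * s * k) ≤ L * L * L * n
    t-floor      : L * t ≤ s
    t-max        : ∀ x → L * x ≤ s → x ≤ t
    Δ-floor      : h * Δ ≤ s * s
    Δ-max        : ∀ x → h * x ≤ s * s → x ≤ Δ
    E-ok         : L * L * L * (suc E * E) ≤ 2 * (s * s * s)
    E-max        : ¬ L * L * L * (suc (suc E) * suc E) ≤ 2 * (s * s * s)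
    w-floor      : L * L * L * w ≤ 6 * (s * s * s)
    w-max        : ∀ x → L * L * L * x ≤ 6 * (s * s * s) → x ≤ w

-- Degree, walk and arc estimates, and the numerical conditions they imply.

module Consequences {n r : ℕ} {G : Graph n} {c : Coloring n} {s k t Δ E w : ℕ}
  (P : Parameters 1370 32 512 r G c s k t Δ E w) where

  open Parameters P renaming (s≥L to s≥32)
  open Degrees G
  open ≤-Reasoning

  private
    instance
      s-nonZero : NonZero s
      s-nonZero = >-nonZero (≤-trans (s≤s z≤n) s≥32)
      k-nonZero : NonZero k
      k-nonZero = >-nonZero k≥1

    assoc₃ : ∀ x y z → x * (y * z) ≡ y * (x * z)
    assoc₃ = solve-∀

  s²≥ : 1024 ≤ s * s
  s²≥ = *-mono-≤ s≥32 s≥32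

  ∑centred≤2r : (∑[ a ∈ V ] centred a) ≤ 2 * r
  ∑centred≤2r = ≤-trans ∑centred≤ (*-monoʳ-≤ 2 few-cherries)

  centred≤ : ∀ a → centred a ≤ 2 * r
  centred≤ a = ≤-trans (∈-∑ centred (∈-allFin a)) ∑centred≤2r

  deg≤ : ∀ a → deg a ≤ Δ
  deg≤ a = Δ-max (deg a) (degree-≤ (deg a) 512 r (s * s)
    (≤-trans (deg*deg≤ a) (+-monoʳ-≤ (deg a) (centred≤ a))) s-root s²≥ (s≤s z≤n))

  pred*deg≤ : ∀ a e → deg a ≡ suc e → e * suc e ≤ centred a
  pred*deg≤ a e eq = +-cancelˡ-≤ (suc e) (e * suc e) (centred a)
    (subst (λ d → d * d ≤ d + centred a) eq (deg*deg≤ a))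

  big : List (Fin n)
  big = filter (λ v → suc (suc E) ≤? deg v) V

  big-centred : ∀ v → suc (suc E) ≤ deg v → suc (suc E) * suc E ≤ centred v
  big-centred v le = ≤-trans (≤-trans (≤-reflexive (*-comm (suc (suc E)) (suc E)))
      (*-mono-≤ {suc E} {deg v ∸ 1} (∸-monoˡ-≤ 1 le) (≤-trans le (≤-reflexive pos))))
    (pred*deg≤ v (deg v ∸ 1) pos)
    where
    pos : deg v ≡ suc (deg v ∸ 1)
    pos = sym (m+[n∸m]≡n {1} (≤-trans (s≤s z≤n) le))

  -- By `E-max` a vertex of degree at least E + 2 is the centre of more than 2 (s / 32)³ ordered
  -- cherries, while there are at most 2 r ≤ 2 (s / 32)⁴ in all. The quotient is s / 32.
  #big≤ : length big ≤ t
  #big≤ = t-max (length big) (*-cancelˡ-≤ (2 * (s * s * s)) {{nz}} (begin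
    2 * (s * s * s) * (32 * length big)            ≡⟨ shuffle (2 * (s * s * s)) 32 (length big) ⟩
    32 * (length big * (2 * (s * s * s)))          ≡⟨ cong (32 *_) (∑-const big _) ⟨
    32 * (∑[ _ ∈ big ] (2 * (s * s * s)))          ≤⟨ *-monoʳ-≤ 32 (∑-mono-∈ big λ v m → each v m) ⟩
    32 * (∑[ v ∈ big ] (32768 * centred v))        ≡⟨ cong (32 *_) (∑-*ˡ big 32768 centred) ⟩
    32 * (32768 * ∑ big centred)                   ≤⟨ *-monoʳ-≤ 32 (*-monoʳ-≤ 32768
                                                        (≤-trans (∑-filter-≤ _ V centred) ∑centred≤2r)) ⟩
    32 * (32768 * (2 * r))                         ≡⟨ regroup 32 32768 2 r ⟩
    2 * (32 * 32768 * r)                           ≤⟨ *-monoʳ-≤ 2 s-root ⟩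
    2 * (s * s * (s * s))                          ≡⟨ cube s ⟩
    2 * (s * s * s) * s                            ∎))
    where
    nz : NonZero (2 * (s * s * s))
    nz = m*n≢0 2 (s * s * s) {{_}} {{m*n≢0 (s * s) s {{m*n≢0 s s}}}}
    shuffle : ∀ x y z → x * (y * z) ≡ y * (z * x)
    shuffle = solve-∀
    regroup : ∀ x y z o → x * (y * (z * o)) ≡ z * (x * y * o)
    regroup = solve-∀
    cube : ∀ s → 2 * (s * s * (s * s)) ≡ 2 * (s * s * s) * s
    cube = solve-∀
    each : ∀ v → v ∈ big → 2 * (s * s * s) ≤ 32768 * centred v
    each v m = ≤-trans (<⇒≤ (≰⇒> E-max))
      (*-monoʳ-≤ 32768 (big-centred v (proj₂ (∈-filter⁻ (λ v → suc (suc E) ≤? deg v) {xs = V} m))))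

  small-degree : ∀ {v} → v ∉ big → deg v ≤ suc E
  small-degree {v} v∉ = ≤-pred (≰⇒> λ le → v∉ (∈-filter⁺ (λ v → suc (suc E) ≤? deg v) (∈-allFin v) le))

  -- With ρ = s / 32 and d the degree this reads ρ d ≤ 2 ρ² + d (d - 1). It is linear in d on the
  -- left, which allows summation over neighbours; it follows from ρ (d - 1) ≤ ρ² + (d - 1)².
  vertex-≤ : ∀ a → 32 * s * deg a ≤ 2 * (s * s) + 32 * 32 * centred a
  vertex-≤ a = subst (λ d → 32 * s * d ≤ 2 * (s * s) + 32 * 32 * centred a) refl (split (deg a) refl)
    where
    split : ∀ d → deg a ≡ d → 32 * s * d ≤ 2 * (s * s) + 32 * 32 * centred a
    split zero _ = ≤-trans (≤-reflexive (*-zeroʳ (32 * s))) z≤n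
    split (suc e) eq = begin
      32 * s * suc e                              ≡⟨ expand 32 s e ⟩
      32 * s + s * (32 * e)                       ≤⟨ +-mono-≤ (*-monoˡ-≤ s s≥32) (*-AM-GM s (32 * e)) ⟩
      s * s + (s * s + 32 * e * (32 * e))         ≡⟨ regroup 32 s e ⟩
      2 * (s * s) + 32 * 32 * (e * e)             ≤⟨ +-monoʳ-≤ (2 * (s * s)) (*-monoʳ-≤ (32 * 32)
                                                       (≤-trans (*-monoʳ-≤ e (n≤1+n e)) (pred*deg≤ a e eq))) ⟩
      2 * (s * s) + 32 * 32 * centred a           ∎
      where
      expand : ∀ L s e → L * s * suc e ≡ L * s + s * (L * e)
      expand L s e = trans (*-suc (L * s) e) (cong (L * s +_) (shuffle L s e))
        where
        shuffle : ∀ L s e → L * s * e ≡ s * (L * e)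
        shuffle = solve-∀
      regroup : ∀ L s e → s * s + (s * s + L * e * (L * e)) ≡ 2 * (s * s) + L * L * (e * e)
      regroup = solve-∀

  -- Summing `vertex-≤` over the neighbours of `x` gives at most 2 ρ² · 2 ρ² + 2 ρ⁴ = 6 ρ⁴, where ρ
  -- = s / 32; division by ρ yields the 6 in `w`.
  two-step : ∀ x → (∑[ a ∈ V ] (g x a * deg a)) ≤ w
  two-step x = w-max W (*-cancelˡ-≤ s (begin
    s * (32768 * W)                                  ≡⟨ regroup₁ s 32 1024 W ⟩
    1024 * (32 * s * W)                              ≤⟨ *-monoʳ-≤ 1024 sum ⟩
    1024 * (deg x * (2 * (s * s)) + 1024 * (2 * r))  ≡⟨ regroup₂ 512 1024 (deg x) (2 * (s * s)) r ⟩
    2 * (512 * deg x) * (2 * (s * s)) + 2 * (1048576 * r)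
      ≤⟨ +-mono-≤ (*-monoˡ-≤ (2 * (s * s)) (*-monoʳ-≤ 2 (≤-trans (*-monoʳ-≤ 512 (deg≤ x)) Δ-floor))) (*-monoʳ-≤ 2 s-root) ⟩
    2 * (s * s) * (2 * (s * s)) + 2 * (s * s * (s * s))
                                                     ≡⟨ collect s ⟩
    s * (6 * (s * s * s))                            ∎))
    where
    W = ∑[ a ∈ V ] (g x a * deg a)
    regroup₁ : ∀ s L L² W → s * (L * L² * W) ≡ L² * (L * s * W)
    regroup₁ = solve-∀
    regroup₂ : ∀ h L² d q r → 2 * h * (d * q + L² * (2 * r)) ≡ 2 * (h * d) * q + 2 * (2 * h * L² * r)
    regroup₂ = solve-∀
    collect : ∀ s → 2 * (s * s) * (2 * (s * s)) + 2 * (s * s * (s * s)) ≡ s * (6 * (s * s * s))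
    collect = solve-∀
    term : ∀ a → 32 * s * (g x a * deg a) ≤ g x a * (2 * (s * s)) + 1024 * centred a
    term a = begin
      32 * s * (g x a * deg a)                                 ≡⟨ assoc₃ (32 * s) (g x a) (deg a) ⟩
      g x a * (32 * s * deg a)                                 ≤⟨ *-monoʳ-≤ (g x a) (vertex-≤ a) ⟩
      g x a * (2 * (s * s) + 1024 * centred a)                 ≡⟨ *-distribˡ-+ (g x a) _ _ ⟩
      g x a * (2 * (s * s)) + g x a * (1024 * centred a)       ≤⟨ +-monoʳ-≤ _ (𝟙*≤ (edge? x a) _) ⟩
      g x a * (2 * (s * s)) + 1024 * centred a                 ∎
    sum : 32 * s * W ≤ deg x * (2 * (s * s)) + 1024 * (2 * r)
    sum = begin
      32 * s * W                                               ≤⟨ *-∑-≤ V (32 * s) (λ a _ → term a) ⟩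
      (∑[ a ∈ V ] (g x a * (2 * (s * s)) + 1024 * centred a))  ≡⟨ ∑-+ V _ _ ⟩
      (∑[ a ∈ V ] (g x a * (2 * (s * s)))) + (∑[ a ∈ V ] (1024 * centred a))
        ≡⟨ cong₂ _+_ (∑-*ʳ V (g x) _) (∑-*ˡ V 1024 centred) ⟩
      deg x * (2 * (s * s)) + 1024 * (∑[ a ∈ V ] centred a)
        ≤⟨ +-monoʳ-≤ (deg x * (2 * (s * s))) (*-monoʳ-≤ 1024 ∑centred≤2r) ⟩
      deg x * (2 * (s * s)) + 1024 * (2 * r)                   ∎

  -- Uses d ≤ 1 + d (d - 1) at every vertex.
  #arcs≤ : #arcs ≤ n + 2 * r
  #arcs≤ = begin
    #arcs                                   ≤⟨ ∑-mono V (λ a → each a (deg a) refl) ⟩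
    (∑[ a ∈ V ] (1 + centred a))            ≡⟨ ∑-+ V _ _ ⟩
    (∑[ _ ∈ V ] 1) + (∑[ a ∈ V ] centred a) ≤⟨ +-mono-≤ (≤-trans (≤-reflexive (trans (∑-const V 1) (*-identityʳ _)))
                                                 (length-allFin n)) ∑centred≤2r ⟩
    n + 2 * r                               ∎
    where
    each : ∀ a d → deg a ≡ d → deg a ≤ 1 + centred a
    each a zero eq = ≤-trans (≤-reflexive eq) z≤n
    each a (suc e) eq = ≤-trans (≤-reflexive eq) (s≤s (≤-trans (m≤m*n e (suc e)) (pred*deg≤ a e eq)))

  cube≤ : 1370 * (s * s * s) ≤ 32768 * n
  cube≤ = shrink 1370 (s * s * s) (s * s * s * k) (m≤m*n (s * s * s) k) key

  -- With ρ = s / 32, the term n is at most ρ n, and 2 r ≤ 2 ρ · ρ³ is at most 2 ρ n / 1370 by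
  -- `cube≤`; hence 1372.
  arcs-scaled : 1370 * (32 * #arcs) ≤ 1372 * (s * n)
  arcs-scaled = begin
    1370 * (32 * #arcs)                           ≤⟨ *-monoʳ-≤ 1370 (*-monoʳ-≤ 32 #arcs≤) ⟩
    1370 * (32 * (n + 2 * r))                     ≡⟨ expand 1370 32 n r ⟩
    1370 * (32 * n) + 1370 * (32 * (2 * r))       ≤⟨ +-mono-≤ (*-monoʳ-≤ 1370 (*-monoˡ-≤ n s≥32))
                                                       (scale {1370} {32768} {2 * s} {s * s * s} {n} (32 * (2 * r)) cube≤ quartic) ⟩
    1370 * (s * n) + 2 * s * n                    ≡⟨ collect 1370 s n ⟩
    1372 * (s * n)                                ∎
    where
    expand : ∀ C L n r → C * (L * (n + 2 * r)) ≡ C * (L * n) + C * (L * (2 * r))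
    expand = solve-∀
    collect : ∀ C s n → C * (s * n) + 2 * s * n ≡ (C + 2) * (s * n)
    collect = solve-∀
    quartic : 32768 * (32 * (2 * r)) ≤ 2 * s * (s * s * s)
    quartic = begin
      32768 * (32 * (2 * r))      ≡⟨ shuffle 32768 32 r ⟩
      2 * (32768 * 32 * r)        ≤⟨ *-monoʳ-≤ 2 s-root ⟩
      2 * (s * s * (s * s))       ≡⟨ cube s ⟩
      2 * s * (s * s * s)         ∎
      where
      shuffle : ∀ x y r → x * (y * (2 * r)) ≡ 2 * (x * y * r)
      shuffle = solve-∀
      cube : ∀ s → 2 * (s * s * (s * s)) ≡ 2 * s * (s * s * s)
      cube = solve-∀

  t≥1 : 1 ≤ t
  t≥1 = t-max 1 s≥32

  scale-key : ∀ a x → 32768 * x ≤ a * (s * s * s * k) → 1370 * x ≤ a * n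
  scale-key a x = scale {1370} {32768} {a} {s * s * s * k} {n} x key

  scaled : ∀ a x → 32768 * x ≤ a * (s * s * s * k) → 27400 * x ≤ 20 * a * n
  scaled a x le = begin
    27400 * x            ≡⟨ *-assoc 20 1370 x ⟩
    20 * (1370 * x)      ≤⟨ *-monoʳ-≤ 20 (scale-key a x le) ⟩
    20 * (a * n)         ≡⟨ *-assoc 20 a n ⟨
    20 * a * n           ∎

  -- The arcs contribute ρ n and `U` contributes q ρ², where ρ = s / 32, so `key` applies to their
  -- product with `k`. The numerical comparison is an implicit argument settled by evaluation.
  arcs-times : ∀ U q j {_ : T (20 * (q * 1372) ≤ᵇ 1370 * j)} → 1024 * U ≤ q * (s * s) →
    27400 * (#arcs * (U * k)) ≤ j * (n * n)
  arcs-times U q j {num} le = ≤-trans (≤-reflexive (sym (*-identityˡ _))) (coarsen {1370} {20 * (q * 1372)} (27400 * (#arcs * (U * k))) {n * n} 1 j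
      (begin
        1370 * (27400 * (#arcs * (U * k)))        ≡⟨ shuffle₁ 1370 20 (#arcs * (U * k)) ⟩
        20 * (1370 * (1370 * (#arcs * (U * k))))  ≤⟨ *-monoʳ-≤ 20 (scale-key (q * 1372 * n) (1370 * (#arcs * (U * k))) product) ⟩
        20 * (q * 1372 * n * n)                   ≡⟨ shuffle₂ 20 (q * 1372) n ⟩
        20 * (q * 1372) * (n * n)                 ∎)
      (≤-trans (≤-reflexive (*-identityˡ (20 * (q * 1372)))) (≤ᵇ⇒≤ (20 * (q * 1372)) (1370 * j) num)))
    where
    shuffle₁ : ∀ C q x → C * (q * C * x) ≡ q * (C * (C * x))
    shuffle₁ = solve-∀
    shuffle₂ : ∀ a b n → a * (b * n * n) ≡ a * b * (n * n)
    shuffle₂ = solve-∀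
    shuffle₃ : ∀ L L² C A U k → L * L² * (C * (A * (U * k))) ≡ C * (L * A) * (L² * U) * k
    shuffle₃ = solve-∀
    shuffle₄ : ∀ D q s n k → D * (s * n) * (q * (s * s)) * k ≡ q * D * n * (s * s * s * k)
    shuffle₄ = solve-∀
    product : 32768 * (1370 * (#arcs * (U * k))) ≤ q * 1372 * n * (s * s * s * k)
    product = begin
      32768 * (1370 * (#arcs * (U * k)))          ≡⟨ shuffle₃ 32 1024 1370 #arcs U k ⟩
      1370 * (32 * #arcs) * (1024 * U) * k        ≤⟨ *-monoˡ-≤ k (*-mono-≤ arcs-scaled le) ⟩
      1372 * (s * n) * (q * (s * s)) * k          ≡⟨ shuffle₄ 1372 q s n k ⟩
      q * 1372 * n * (s * s * s * k)              ∎

  h₁ : 27400 * (t * (t * (t * k))) ≤ 20 * n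
  h₁ = scaled 1 (t * (t * (t * k))) (begin
    32768 * (t * (t * (t * k)))                ≡⟨ shuffle 32 t k ⟩
    32 * t * (32 * t) * (32 * t) * k           ≤⟨ *-monoˡ-≤ k (*-mono-≤ (*-mono-≤ t-floor t-floor) t-floor) ⟩
    s * s * s * k                              ≡⟨ *-identityˡ (s * s * s * k) ⟨
    1 * (s * s * s * k)                        ∎)
    where
    shuffle : ∀ L t k → L * L * L * (t * (t * (t * k))) ≡ L * t * (L * t) * (L * t) * k
    shuffle = solve-∀

  h₂ : 27400 * (t * (Δ * k)) ≤ 40 * n
  h₂ = scaled 2 (t * (Δ * k)) (begin
    32768 * (t * (Δ * k))                      ≡⟨ shuffle 32 512 t Δ k ⟩
    2 * (32 * t * (512 * Δ) * k)               ≤⟨ *-monoʳ-≤ 2 (*-monoˡ-≤ k (*-mono-≤ t-floor Δ-floor)) ⟩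
    2 * (s * (s * s) * k)                      ≡⟨ cong (λ z → 2 * (z * k)) (*-assoc s s s) ⟨
    2 * (s * s * s * k)                        ∎)
    where
    shuffle : ∀ L h t Δ k → 2 * (L * h) * (t * (Δ * k)) ≡ 2 * (L * t * (h * Δ) * k)
    shuffle = solve-∀

  h₃ : 27400 * (suc E * (E * k)) ≤ 40 * n
  h₃ = scaled 2 (suc E * (E * k)) (times-k E-ok)
    where
    times-k : 32768 * (suc E * E) ≤ 2 * (s * s * s) → 32768 * (suc E * (E * k)) ≤ 2 * (s * s * s * k)
    times-k le = subst₂ _≤_ (shuffle 32768 (suc E) E k) (*-assoc 2 (s * s * s) k) (*-monoˡ-≤ k le)
      where
      shuffle : ∀ L e′ e k → L * (e′ * e) * k ≡ L * (e′ * (e * k))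
      shuffle = solve-∀

  h₄ : 27400 * (w * k) ≤ 120 * n
  h₄ = scaled 6 (w * k) (subst₂ _≤_ (*-assoc 32768 w k) (*-assoc 6 (s * s * s) k) (*-monoˡ-≤ k w-floor))

  h₅ : 27400 * (#arcs * (Δ * k)) ≤ 41 * (n * n)
  h₅ = arcs-times Δ 2 41 (≤-trans (≤-reflexive (*-assoc 2 512 Δ)) (*-monoʳ-≤ 2 Δ-floor))

  t²≤ : 1024 * (t * t) ≤ s * s
  t²≤ = ≤-trans (≤-reflexive (shuffle 32 t)) (*-mono-≤ t-floor t-floor)
    where
    shuffle : ∀ L t → L * L * (t * t) ≡ L * t * (L * t)
    shuffle = solve-∀

  t≤t² : t ≤ t * t
  t≤t² = m≤m*n t t {{>-nonZero t≥1}}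

  h₆ : 27400 * (#arcs * (t * k)) ≤ 21 * (n * n)
  h₆ = arcs-times t 1 21 (shrink 1024 t (t * t) t≤t² (≤-trans t²≤ (≤-reflexive (sym (*-identityˡ (s * s))))))

  h₇ : 27400 * (#arcs * (t * (t * k))) ≤ 21 * (n * n)
  h₇ = subst (λ z → 27400 * (#arcs * z) ≤ 21 * (n * n)) (*-assoc t t k)
    (arcs-times (t * t) 1 21 (≤-trans t²≤ (≤-reflexive (sym (*-identityˡ (s * s))))))

  h₈ : 27400 * (#arcs * (#arcs * k)) ≤ 21 * (n * (n * n))
  h₈ = coarsen {1370 * 1370 * 1370} {1372 * 1372} (#arcs * (#arcs * k)) {n * (n * n)} 27400 21
    (arcs-squared 1370 32 1372 #arcs s n k arcs-scaled s≥32 key)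
    (≤ᵇ⇒≤ (27400 * (1372 * 1372)) (1370 * 1370 * 1370 * 21) _)

  h₉ : 27400 * (t * Δ) ≤ 40 * n
  h₉ = shrink 27400 (t * Δ) (t * (Δ * k)) (*-monoʳ-≤ t (m≤m*n Δ k)) h₂

  h₁₀ : 8 * Δ ≤ n
  h₁₀ = ≤-trans (coarsen {27400} {40} Δ {n} 8 1
    (shrink 27400 Δ (t * Δ) (m≤n*m Δ t {{>-nonZero t≥1}}) h₉) (≤ᵇ⇒≤ 320 27400 _)) (≤-reflexive (*-identityˡ n))

  t-scaled : 27400 * t ≤ 20 * n
  t-scaled = shrink 27400 t (t * (t * (t * k)))
    (≤-trans t≤t² (*-monoʳ-≤ t (m≤m*n t (t * k) {{m*n≢0 t k {{>-nonZero t≥1}}}}))) h₁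

  h₁₁ : 8 * t ≤ n
  h₁₁ = ≤-trans (coarsen {27400} {20} t {n} 8 1 t-scaled (≤ᵇ⇒≤ 160 27400 _)) (≤-reflexive (*-identityˡ n))

  -- A lower-order term: r k is at most ρ · ρ³ k with ρ = s / 32, and both ρ and ρ³ k are at most n
  -- / 1370. The coefficient 6 is generous.
  h₁₂ : 27400 * (2 * r * k) ≤ 6 * (n * n)
  h₁₂ = coarsen {1370 * (1370 * 32)} {2 * 32} (2 * r * k) {n * n} 27400 6
    (begin
      1370 * (1370 * 32) * (2 * r * k)        ≡⟨ shuffle₁ 1370 32 r k ⟩
      2 * (1370 * (1370 * (32 * (r * k))))    ≤⟨ *-monoʳ-≤ 2 (*-monoʳ-≤ 1370 (scale-key s (32 * (r * k)) product)) ⟩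
      2 * (1370 * (s * n))                    ≡⟨ cong (2 *_) (*-assoc 1370 s n) ⟨
      2 * (1370 * s * n)                      ≤⟨ *-monoʳ-≤ 2 (*-monoˡ-≤ n s-small) ⟩
      2 * (32 * n * n)                        ≡⟨ shuffle₂ 2 32 n ⟩
      2 * 32 * (n * n)                        ∎)
    (≤ᵇ⇒≤ (27400 * (2 * 32)) (1370 * (1370 * 32) * 6) _)
    where
    shuffle₁ : ∀ C L r k → C * (C * L) * (2 * r * k) ≡ 2 * (C * (C * (L * (r * k))))
    shuffle₁ = solve-∀
    shuffle₂ : ∀ a b n → a * (b * n * n) ≡ a * b * (n * n)
    shuffle₂ = solve-∀
    shuffle₃ : ∀ a b r k → a * (b * (r * k)) ≡ a * b * r * k
    shuffle₃ = solve-∀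
    shuffle₄ : ∀ s k → s * s * (s * s) * k ≡ s * (s * s * s * k)
    shuffle₄ = solve-∀
    product : 32768 * (32 * (r * k)) ≤ s * (s * s * s * k)
    product = begin
      32768 * (32 * (r * k))     ≡⟨ shuffle₃ 32768 32 r k ⟩
      1048576 * r * k            ≤⟨ *-monoˡ-≤ k s-root ⟩
      s * s * (s * s) * k        ≡⟨ shuffle₄ s k ⟩
      s * (s * s * s * k)        ∎
    s-small : 1370 * s ≤ 32 * n
    s-small = *-cancelˡ-≤ 1024 (begin
      1024 * (1370 * s)          ≡⟨ assoc₃ 1024 1370 s ⟩
      1370 * (1024 * s)          ≤⟨ *-monoʳ-≤ 1370 (*-monoˡ-≤ s s²≥) ⟩
      1370 * (s * s * s)         ≤⟨ cube≤ ⟩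
      32768 * n                  ≡⟨ *-assoc 1024 32 n ⟩
      1024 * (32 * n)            ∎)

  greedy-room : 1 ≤ n → 4 * (t + (t * (t * (t * k)) + t * (t * (4 * (k * t))))) + n < 4 * n
  greedy-room n≥1 = begin-strict
    4 * (t + (t * (t * (t * k)) + t * (t * (4 * (k * t))))) + n      ≡⟨ cong (_+ n) (shuffle t k) ⟩
    4 * t + 20 * (t * (t * (t * k))) + n                             ≤⟨ +-monoˡ-≤ n (+-mono-≤
      (coarsen {27400} {20} t {n} 4 1 t-scaled (≤ᵇ⇒≤ 80 27400 _))
      (coarsen {27400} {20} (t * (t * (t * k))) {n} 20 1 h₁ (≤ᵇ⇒≤ 400 27400 _))) ⟩
    1 * n + 1 * n + n                                                ≡⟨ collect n ⟩
    n + 2 * n                                                        <⟨ m<m+n (n + 2 * n) n≥1 ⟩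
    n + 2 * n + n                                                    ≡⟨ collect′ n ⟩
    4 * n                                                            ∎
    where
    shuffle : ∀ t k → 4 * (t + (t * (t * (t * k)) + t * (t * (4 * (k * t))))) ≡ 4 * t + 20 * (t * (t * (t * k)))
    shuffle = solve-∀
    collect : ∀ n → 1 * n + 1 * n + n ≡ n + 2 * n
    collect = solve-∀
    collect′ : ∀ n → n + 2 * n + n ≡ 4 * n
    collect′ = solve-∀

  margin : 100 * (4 + t) ≤ n
  margin = begin
    100 * (4 + t)                    ≤⟨ *-monoʳ-≤ 100 4+t≤5t ⟩
    100 * (5 * t)                    ≡⟨ *-assoc 100 5 t ⟨
    500 * t                          ≤⟨ coarsen {27400} {20} t {n} 500 1 t-scaled (≤ᵇ⇒≤ 10000 27400 _) ⟩
    1 * n                            ≡⟨ *-identityˡ n ⟩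
    n                                ∎
    where
    4+t≤5t : 4 + t ≤ 5 * t
    4+t≤5t = ≤-trans (≤-reflexive (+-comm 4 t)) (+-monoʳ-≤ t (*-monoʳ-≤ 4 t≥1))

  M : ℕ
  M = n ∸ (4 + t)

  4+t≤n : 4 + t ≤ n
  4+t≤n = ≤-trans (m≤n*m (4 + t) 100) margin

  M-large : 99 * n ≤ 100 * M
  M-large = +-cancelʳ-≤ n (99 * n) (100 * M) (begin
    99 * n + n                       ≡⟨ +-comm (99 * n) n ⟩
    100 * n                          ≡⟨ cong (100 *_) (m∸n+n≡m 4+t≤n) ⟨
    100 * (M + (4 + t))              ≡⟨ *-distribˡ-+ 100 M (4 + t) ⟩
    100 * M + 100 * (4 + t)          ≤⟨ +-monoʳ-≤ (100 * M) margin ⟩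
    100 * M + n                      ∎)

  open LoadBounds 27400 n t Δ k #arcs (2 * r) E w h₁ h₂ h₃ h₄ h₅ h₆ h₇ h₈ h₉ h₁₀ h₁₁ h₁₂

  loads-fit : 16 * (domainLoad n t Δ k #arcs E + imageLoad n t Δ k #arcs (2 * r) w) ≤ M ^ 4
  loads-fit = ≤-trans
    -- Here 1498 = 870 + 628, and the evaluated inequality is 16 · 1498 · 100⁴ ≤ 27400 · 99⁴.
    (final-≤ 27400 1498 16 99 100 (D + I) n M
      (≤-trans (≤-reflexive (*-distribˡ-+ 27400 D I)) (≤-trans (+-mono-≤ domain-total image-total)
        (≤-reflexive (sym (*-distribʳ-+ (n * n * (n * n)) 870 628)))))
      M-large (≤ᵇ⇒≤ (16 * 1498 * fourth 100) (27400 * fourth 99) _))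
    (≤-reflexive (sym (^4≡fourth M)))
    where
    D I : ℕ
    D = domainLoad n t Δ k #arcs E
    I = imageLoad n t Δ k #arcs (2 * r) w

  light : 2 * n ^ 3 < M ^ 4
  -- Strictness comes from proving the bound with 3 in place of 2; `n` is at least 8 because
  -- `8 * t ≤ n` and `t ≥ 1`.
  light = ≤-trans (*-monoˡ-< (n ^ 3) {{m^n≢0 n 3 {{>-nonZero n≥1}}}} (≤ᵇ⇒≤ 3 3 _)) (≤-trans
    (final-≤ 8 1 3 99 100 (n ^ 3) n M eighth M-large (≤ᵇ⇒≤ (3 * 1 * fourth 100) (8 * fourth 99) _))
    (≤-reflexive (sym (^4≡fourth M))))
    where
    n≥1 : 1 ≤ n
    n≥1 = ≤-trans (s≤s z≤n) 4+t≤n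
    eighth : 8 * n ^ 3 ≤ 1 * fourth n
    eighth = begin
      8 * n ^ 3                     ≤⟨ *-monoˡ-≤ (n ^ 3) (≤-trans (*-monoʳ-≤ 8 t≥1) h₁₁) ⟩
      n ^ 4                         ≡⟨ ^4≡fourth n ⟩
      fourth n                      ≡⟨ *-identityˡ (fourth n) ⟨
      1 * fourth n                  ∎

-- Existence of the parameters and assembly of the theorem.

colour-used : ∀ {n} (c : Coloring (suc (suc n))) → 1 ≤ colorCount c (c Fin.zero (Fin.suc Fin.zero))
colour-used {n} c = inhabited (∈-filter⁺ (λ p → c (proj₁ p) (proj₂ p) ≟ c Fin.zero (Fin.suc Fin.zero))
  (∈-filter⁺ (λ p → proj₁ p Fin.<? proj₂ p)
    (∈-cartesianProduct⁺ (∈-allFin Fin.zero) (∈-allFin (Fin.suc Fin.zero))) (s≤s z≤n)) refl)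
  where
  inhabited : ∀ {A : Set} {x : A} {xs} → x ∈ xs → 1 ≤ length xs
  inhabited (here _) = s≤s z≤n
  inhabited (there _) = s≤s z≤n

-- Provides the upper end of the search that defines `E`.
no-consecutive-root : ∀ L N → 1 ≤ L → 1 ≤ N → ¬ L * (suc N * N) ≤ N
no-consecutive-root L N L≥1 N≥1 le = <⇒≱ (m<m+n N (N≥1 ⊗ N≥1))
  (≤-trans (m≤n*m (suc N * N) L {{>-nonZero L≥1}}) le)

-- The value `k` is 33³ n / (1512 s³) rounded down. Since s is at most 33 r^{1/4}, it still bounds
-- every colour class, and a colour in use makes it positive.
parameters : ∀ {n} r (G : Graph n) (c : Coloring n) → cherries G ≤ r → GloballyBounded n r c →
  ∀ α → 1 ≤ colorCount c α →
  ∀ s → 32 ≤ s → fourth 32 * r ≤ fourth s → fourth s ≤ fourth 33 * r →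
  ∃ λ k → ∃ λ t → ∃ λ Δ → ∃ λ E → ∃ λ w → Parameters 1370 32 512 r G c s k t Δ E w
parameters {n} r G c few gb α used s s≥32 lower upper =
  k , proj₁ t-spec , proj₁ Δ-spec , proj₁ E-spec , proj₁ w-spec , record
    { few-cherries = few
    ; bounded      = bounded
    ; k≥1          = ≤-trans used (bounded α)
    ; s≥L          = s≥32
    ; s-root       = lower
    ; key          = coarsen {1512} {33 * 33 * 33} (s * s * s * k) {n} 1370 (32 * 32 * 32)
                       (≤-trans (≤-reflexive (sym (*-assoc 1512 (s * s * s) k))) (proj₁ (proj₂ k-spec)))
                       (≤ᵇ⇒≤ (1370 * (33 * 33 * 33)) (1512 * (32 * 32 * 32)) _)
    ; t-floor      = proj₁ (proj₂ t-spec)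
    ; t-max        = proj₂ (proj₂ t-spec)
    ; Δ-floor      = proj₁ (proj₂ Δ-spec)
    ; Δ-max        = proj₂ (proj₂ Δ-spec)
    ; E-ok         = proj₁ (proj₂ E-spec)
    ; E-max        = proj₂ (proj₂ E-spec)
    ; w-floor      = proj₁ (proj₂ w-spec)
    ; w-max        = proj₂ (proj₂ w-spec)
    }
  where
  s≥1 : 1 ≤ s
  s≥1 = ≤-trans (s≤s z≤n) s≥32
  cube≥1 : 1 ≤ s * s * s
  cube≥1 = (s≥1 ⊗ s≥1) ⊗ s≥1
  k-spec : ∃ λ q → 1512 * (s * s * s) * q ≤ 33 * 33 * 33 * n
                 × (∀ x → 1512 * (s * s * s) * x ≤ 33 * 33 * 33 * n → x ≤ q)
  k-spec = floor (1512 * (s * s * s)) {{>-nonZero (≤ᵇ⇒≤ 1 1512 _ ⊗ cube≥1)}} (33 * 33 * 33 * n)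
  k : ℕ
  k = proj₁ k-spec
  bounded : ∀ β → colorCount c β ≤ k
  bounded β = proj₂ (proj₂ k-spec) (colorCount c β) (≤-trans (≤-reflexive (shuffle 1512 (s * s * s) (colorCount c β)))
    (root-free-bound (1512 * colorCount c β) s 33 r n (gb β) upper))
    where
    shuffle : ∀ x y z → x * y * z ≡ x * z * y
    shuffle = solve-∀
  t-spec : ∃ λ q → 32 * q ≤ s × (∀ x → 32 * x ≤ s → x ≤ q)
  t-spec = floor 32 s
  Δ-spec : ∃ λ q → 512 * q ≤ s * s × (∀ x → 512 * x ≤ s * s → x ≤ q)
  Δ-spec = floor 512 (s * s)
  w-spec : ∃ λ q → 32 * 32 * 32 * q ≤ 6 * (s * s * s) × (∀ x → 32 * 32 * 32 * x ≤ 6 * (s * s * s) → x ≤ q)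
  w-spec = floor (32 * 32 * 32) (6 * (s * s * s))
  E-spec : ∃ λ e → 32 * 32 * 32 * (suc e * e) ≤ 2 * (s * s * s) × ¬ 32 * 32 * 32 * (suc (suc e) * suc e) ≤ 2 * (s * s * s)
  E-spec = last-true (λ e → 32 * 32 * 32 * (suc e * e) ≤ 2 * (s * s * s)) (λ e → 32 * 32 * 32 * (suc e * e) ≤? 2 * (s * s * s))
    z≤n (2 * (s * s * s)) (no-consecutive-root (32 * 32 * 32) (2 * (s * s * s)) (≤ᵇ⇒≤ 1 (32 * 32 * 32) _) (≤ᵇ⇒≤ 1 2 _ ⊗ cube≥1))

module _ {n r : ℕ} {G : Graph n} {c : Coloring n} (c-sym : IsSymmetric c) (n≥1 : 1 ≤ n)
  {s k t Δ E w : ℕ} (P : Parameters 1370 32 512 r G c s k t Δ E w) where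

  open Parameters P
  open Consequences P

  rainbow-copy : Rainbow G c
  rainbow-copy = place (Greedy.spread-images c c-sym k t k≥1 t≥1 bounded (greedy-room n≥1) big #big≤)
    where
    place : (∃ λ pinned → map proj₁ pinned ≡ big × Greedy.Spread c c-sym k t k≥1 t≥1 bounded (map proj₂ pinned)) →
      Rainbow G c
    -- The local lemma is applied to the proper events `𝓟`, whose loads are bounded by those of the
    -- larger list `𝓑`.
    place (pinned , doms , spread) = conclude (bijection-avoiding pinned room uniqueDoms unique 𝓟
        (all-filter proper? 𝓑)
        (domainLoad n t Δ k (Degrees.#arcs G) E) (imageLoad n t Δ k (Degrees.#arcs G) (2 * r) w)
        (λ u → ≤-trans (∑-filter-≤ proper? 𝓑 _) (load-dom u)) (λ u′ → ≤-trans (∑-filter-≤ proper? 𝓑 _) (load-im u′))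
        loads-fit light)
      where
      open Greedy.Spread spread
      open Families G c c-sym E pinned
      open Avoidance G c c-sym E pinned
      open Bijections pinned
      #pinned : length pinned ≤ t
      #pinned = ≤-trans (≤-reflexive (trans (sym (length-map proj₁ pinned)) (cong length doms))) #big≤
      open Bounds bounded deg≤ two-step ∑centred≤2r #pinned unique
        (λ x∈ y∈ → few-twins (∈-map⁺ proj₂ x∈) (∈-map⁺ proj₂ y∈))
      room : M + (4 + length pinned) ≤ n
      room = ≤-trans (+-monoʳ-≤ M (+-monoʳ-≤ 4 #pinned)) (≤-reflexive (m∸n+n≡m 4+t≤n))
      uniqueDoms : Unique (map proj₁ pinned)
      uniqueDoms = subst Unique (sym doms) (Unique.filter⁺ (λ v → suc (suc E) ≤? Degrees.deg G v) (allFin⁺ n))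
      conclude : (∃ λ σ → Admissible σ × Avoid 𝓟 σ) → Rainbow G c
      conclude (σ , admissible , avoids) = φ-rainbow σ admissible avoids
        (λ v∉ → small-degree (λ v∈ → v∉ (subst (_ ∈_) (sym doms) v∈))) rainbow

theorem1p7 : (n r : ℕ) → 1 ≤ n → 1 ≤ r → (G : Graph n) → cherries G ≤ r →
    (c : Coloring n) → IsSymmetric c → GloballyBounded n r c → Rainbow G c
-- A single vertex spans no edge, so no colour occurs and `k ≥ 1` could not be obtained; the
-- identity is rainbow trivially.
theorem1p7 (suc zero) r _ _ G _ c _ _ = (λ v → v) , (λ eq → eq) , λ { Fin.zero Fin.zero _ _ _ _ () }
theorem1p7 (suc (suc n)) r n≥1 r≥1 G few c c-sym gb =
  from-root (fourth-root (fourth 32 * r) (≤ᵇ⇒≤ 1 (fourth 32) _ ⊗ r≥1))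
  where
  α : ℕ
  α = c Fin.zero (Fin.suc Fin.zero)
  at-scale : ∀ s →
    (∃ λ k → ∃ λ t → ∃ λ Δ → ∃ λ E → ∃ λ w → Parameters 1370 32 512 r G c s k t Δ E w) → Rainbow G c
  at-scale s (k , t , Δ , E , w , P) = rainbow-copy c-sym n≥1 P
  from-root : (∃ λ p → fourth p < fourth 32 * r × fourth 32 * r ≤ fourth (suc p)) → Rainbow G c
  -- The scale is s = p + 1, the rounded-up fourth root; `32 ≤ s` follows from `r ≥ 1`.
  from-root (p , below , above) = at-scale (suc p) (parameters r G c few gb α (colour-used c) (suc p)
    (fourth-cancel {32} {suc p} (≤-trans (m≤m*n (fourth 32) r {{>-nonZero r≥1}}) above)) above
    (fourth-root-upper 32 r p r≥1 below))
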